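{- Let $G$ be a planar triangulation (a maximal planar simple graph) different from $K_4$. Then $\tau(G)\leq \frac{3}{2}\,\nu(G)$.
   Context: A simple graph is a maximal planar graph (planar triangulation) if it is planar and adding any edge between two nonadjacent vertices destroys planarity. $\tau(G)$ is the minimum size of a set of edges of $G$ whose removal leaves a triangle-free graph, and $\nu(G)$ is the maximum number of pairwise edge-disjoint triangles in $G$. -}

module Defs where

open import Data.Bool.Base using (Bool; true; false; T; not; _∧_; _∨_)
open import Data.Bool.Properties using (T?; ∨-comm)
open import Data.Fin.Base using (Fin)
open import Data.Fin.Properties using (_≟_; _<?_; all?)
open import Data.List.Base
  using (List; []; _∷_; [_]; _++_; map; filter; length; allFin; cartesianProduct)
open import Data.List.Extrema.Nat using (min; max)
import Data.List.Membership.DecPropositional as DecMembership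
open import Data.List.Relation.Binary.Disjoint.Propositional using (Disjoint)
import Data.List.Relation.Binary.Disjoint.DecPropositional as DecDisjoint
open import Data.List.Relation.Unary.AllPairs using (AllPairs; allPairs?)
open import Data.List.Relation.Unary.Any using (here)
open import Data.Nat.Base using (ℕ; _+_; _*_)
open import Data.Product.Base using (Σ-syntax; _×_; _,_; proj₁; proj₂)
open import Data.Product.Properties using (≡-dec)
open import Function.Base using (_on_)
open import Function.Bundles using (_↔_; _⇔_; Inverse)
open import Function.Definitions using (Surjective)
open import Relation.Binary.Construct.Closure.ReflexiveTransitive using (Star)
open import Relation.Binary.Definitions using (DecidableEquality)
open import Relation.Binary.PropositionalEquality
  using (_≡_; _≢_; refl; sym; trans; cong; cong₂)
open import Relation.Nullary using (¬_; Dec; yes; no; does; ¬?; _×-dec_)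
open import Relation.Nullary.Decidable using (dec-true; dec-false)
open import Relation.Unary using (Decidable)

record Graph (n : ℕ) : Set where
  field
    adj    : Fin n → Fin n → Bool
    symm   : ∀ u v → adj u v ≡ adj v u
    irrefl : ∀ v → adj v v ≡ false

  Adj : Fin n → Fin n → Set
  Adj u v = T (adj u v)

  Adj? : ∀ u v → Dec (Adj u v)
  Adj? u v = T? (adj u v)

open Graph

K : ∀ n → Graph n
K n .adj u v    = not (does (u ≟ v))
K n .symm u v   = cong not (does-sym u v)
  where
  does-sym : ∀ x y → does (x ≟ y) ≡ does (y ≟ x)
  does-sym x y with x ≟ y
  ... | yes x≡y = sym (dec-true (y ≟ x) (sym x≡y))
  ... | no  x≢y = sym (dec-false (y ≟ x) λ y≡x → x≢y (sym y≡x))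
K n .irrefl v   = cong not (dec-true (v ≟ v) refl)

_≅_ : ∀ {m n} → Graph m → Graph n → Set
_≅_ {m} {n} G H =
  Σ[ f ∈ Fin m ↔ Fin n ]
    (∀ u v → adj G u v ≡ adj H (Inverse.to f u) (Inverse.to f v))

Pair : ℕ → Set
Pair n = Fin n × Fin n

_≟ₚ_ : ∀ {n} → DecidableEquality (Pair n)
_≟ₚ_ = ≡-dec _≟_ _≟_

-- The unordered pair {x , y} belongs to S.
joins : ∀ {n} → List (Pair n) → Fin n → Fin n → Bool
joins S x y = does ((x , y) ∈? S) ∨ does ((y , x) ∈? S)
  where open DecMembership _≟ₚ_

joins-symm : ∀ {n} (S : List (Pair n)) x y → joins S x y ≡ joins S y x
joins-symm S x y = ∨-comm (does ((x , y) ∈? S)) (does ((y , x) ∈? S))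
  where open DecMembership _≟ₚ_

deleteEdges : ∀ {n} → Graph n → List (Pair n) → Graph n
deleteEdges G S .adj x y  = adj G x y ∧ not (joins S x y)
deleteEdges G S .symm x y = cong₂ (λ a b → a ∧ not b) (symm G x y) (joins-symm S x y)
deleteEdges G S .irrefl x = cong (_∧ not (joins S x x)) (irrefl G x)

addEdge : ∀ {n} → Graph n → (u v : Fin n) → u ≢ v → Graph n
addEdge G u v u≢v .adj x y  = adj G x y ∨ joins [ (u , v) ] x y
addEdge G u v u≢v .symm x y = cong₂ _∨_ (symm G x y) (joins-symm [ (u , v) ] x y)
addEdge G u v u≢v .irrefl x = cong₂ _∨_ (irrefl G x) (cong₂ _∨_ no-loop no-loop)
  where
  open DecMembership _≟ₚ_
  no-loop : does ((x , x) ∈? [ (u , v) ]) ≡ false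
  no-loop = dec-false ((x , x) ∈? [ (u , v) ])
    λ { (here e) → u≢v (trans (sym (cong proj₁ e)) (cong proj₂ e)) }

-- Every edge is listed once, with its endpoints in increasing order.
edges : ∀ {n} → Graph n → List (Pair n)
edges {n} G =
  filter (λ (u , v) → (u <? v) ×-dec Adj? G u v)
         (cartesianProduct (allFin n) (allFin n))

isolated : ∀ {n} → Graph n → List (Fin n)
isolated {n} G = filter (λ u → all? (λ v → ¬? (Adj? G u v))) (allFin n)

-- An embedding is given combinatorially, by a rotation system whose Euler
-- characteristic is that of the sphere on every connected component.

record Dart {n} (G : Graph n) : Set where
  constructor dart
  field
    tail head : Fin n
    adjacent  : Adj G tail head

open Dart

reverse : ∀ {n} {G : Graph n} → Dart G → Dart G
reverse {G = G} (dart u v uv) = dart v u (subst-T (symm G u v) uv)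
  where
  subst-T : ∀ {a b} → a ≡ b → T a → T b
  subst-T refl t = t

-- Reach f d e: some iterate fᵏ d (k ≥ 0) is e.  On a finite set with f
-- bijective this is the relation "d and e lie on the same cycle of f".
Reach : {A : Set} → (A → A) → A → A → Set
Reach f = Star (λ x y → f x ≡ y)

-- _∼_ is an equivalence relation with exactly k classes.
record HasClasses {A : Set} (_∼_ : A → A → Set) (k : ℕ) : Set where
  field
    class            : A → Fin k
    class-surjective : Surjective _≡_ _≡_ class
    class-∼          : ∀ x y → x ∼ y ⇔ class x ≡ class y

record PlaneEmbedding {n} (G : Graph n) : Set where
  field
    -- next permutes the darts leaving each vertex in a single cycle: bijectivity
    -- follows from next-cyclic because there are finitely many darts.
    next        : Dart G → Dart G
    next-tail   : ∀ d → tail (next d) ≡ tail d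
    next-cyclic : ∀ d e → tail d ≡ tail e → Reach next d e

  -- The successor of a dart on the boundary walk it traverses.
  face : Dart G → Dart G
  face d = next (reverse d)

  field
    #walks #components : ℕ
    walks      : HasClasses (Reach face) #walks
    components : HasClasses (Star (Adj G)) #components

    -- V - E + W = 2C, W being the number of facial walks over all components.
    -- An isolated vertex has no darts but one (trivial) facial walk.  Since
    -- V - E + W ≤ 2 for each component, equality of the totals says that every
    -- component has genus 0.
    euler : n + (#walks + length (isolated G)) ≡ length (edges G) + 2 * #components

Planar : ∀ {n} → Graph n → Set
Planar = PlaneEmbedding

MaximalPlanar : ∀ {n} → Graph n → Set
MaximalPlanar {n} G =
  Planar G ×
  (∀ (u v : Fin n) (u≢v : u ≢ v) → ¬ Adj G u v → ¬ Planar (addEdge G u v u≢v))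

TriangleFree : ∀ {n} → Graph n → Set
TriangleFree G = ∀ u v w → ¬ (Adj G u v × Adj G v w × Adj G u w)

triangleFree? : ∀ {n} → Decidable (TriangleFree {n})
triangleFree? G =
  all? λ u → all? λ v → all? λ w →
    ¬? (Adj? G u v ×-dec Adj? G v w ×-dec Adj? G u w)

Triple : ℕ → Set
Triple n = Fin n × Fin n × Fin n

-- Every triangle is listed once, with its vertices in increasing order.
triangles : ∀ {n} → Graph n → List (Triple n)
triangles {n} G =
  filter (λ (u , v , w) → (u <? v) ×-dec (v <? w) ×-dec
                          Adj? G u v ×-dec Adj? G v w ×-dec Adj? G u w)
         (cartesianProduct (allFin n) (cartesianProduct (allFin n) (allFin n)))

sides : ∀ {n} → Triple n → List (Pair n)
sides (u , v , w) = (u , v) ∷ (v , w) ∷ (u , w) ∷ []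

EdgeDisjoint : ∀ {n} → List (Triple n) → Set
EdgeDisjoint = AllPairs (Disjoint on sides)

edgeDisjoint? : ∀ {n} → Decidable (EdgeDisjoint {n})
edgeDisjoint? = allPairs? λ s t → disjoint? (sides s) (sides t)
  where open DecDisjoint _≟ₚ_

sublists : {A : Set} → List A → List (List A)
sublists []       = [ [] ]
sublists (x ∷ xs) = map (x ∷_) (sublists xs) ++ sublists xs

-- The default value of min is attained: deleting all edges leaves no triangle.
τ : ∀ {n} → Graph n → ℕ
τ G = min (length (edges G))
          (map length (filter (λ S → triangleFree? (deleteEdges G S))
                              (sublists (edges G))))

-- The default value of max is attained by the empty family.
ν : ∀ {n} → Graph n → ℕ
ν G = max 0 (map length (filter edgeDisjoint? (sublists (triangles G))))

{-# OPTIONS --safe #-}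
{-
Let W be the number of faces. A maximal planar graph with a triangle is
connected and all its faces are triangles: otherwise an edge could be added,
either between two components or as a chord of a face; if both chords of a path
of length 3 on a face were edges already, they would cross.

The dual graph is cubic and bridgeless, so by Petersen's theorem some set S of
edges of G has exactly one edge in every face, and |S| = W/2. Every triangle of
G, separating or not, is the sum mod 2 of the faces on one of its sides; hence
it has an odd number of edges in S, and τ ≤ |S|. Unless G is K₄, the argument of
Brooks' theorem colours the faces with 3 colours; a colour class is a family of
edge-disjoint triangles, so W ≤ 3ν. Together, 2τ ≤ W ≤ 3ν.

Planarity enters through Euler's formula alone: a choice of side for all faces but one
and of a subset of the edges of a spanning tree amounts to as many bits as
there are edges, so the injective linear map from these choices to edge sets is onto.
-}
module Submission where

open import Defs
open import Data.Nat.Base using (ℕ)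
open import Relation.Nullary using (¬_)
open import Algebra.Bundles using (CommutativeRing)
import Algebra.Properties.CommutativeMonoid.Sum as Sum
import Algebra.Properties.CommutativeSemigroup as CommutativeSemigroup
open import Data.Bool.Base using (Bool; true; false; T; not; _∧_; _∨_; _xor_; if_then_else_)
open import Data.Bool.Properties as Bool
  using (T-irrelevant; T-≡; T-∧; not-¬; ¬-not; xor-same; xor-comm; xor-identityʳ)
open import Data.Empty using (⊥; ⊥-elim)
open import Data.Fin.Base using (Fin; zero; suc; toℕ; punchOut; punchIn; funToFin; finToFun; splitAt; _↑ˡ_; _↑ʳ_; combine; join; inject≤)
open import Data.Fin.Patterns
open import Data.Fin.Properties using (_≟_; _<?_; any?; all?)
import Data.Fin.Properties as Fin
open import Data.Fin.Permutation using (Permutation; permutation)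
open import Data.List.Base
  using (List; []; _∷_; [_]; _++_; map; filter; length; allFin; cartesianProduct; lookup; concatMap)
import Data.List.Extrema.Nat as Extrema
open import Data.List.Membership.Propositional using (_∈_; _∉_; lose)
open import Data.List.Membership.Propositional.Properties
open import Data.List.Relation.Unary.All using (All; []; _∷_)
import Data.List.Relation.Unary.All as All
open import Data.List.Relation.Unary.AllPairs using (AllPairs; []; _∷_)
open import Data.List.Relation.Unary.Any using (here; there; index)
import Data.List.Relation.Unary.Any.Properties as Any
open import Data.List.Relation.Unary.Unique.Propositional using (Unique)
import Data.List.Relation.Unary.Unique.Propositional.Properties as Unique
import Data.List.Properties as List
open import Data.Nat.Base using (zero; suc; _+_; _<_; z≤n; s≤s) renaming (_≤_ to _≤ℕ_; _*_ to _*ℕ_)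
import Data.Nat.Properties as ℕ
import Data.Nat.Base as ℕ
open import Data.Product.Base using (Σ; Σ-syntax; ∃; ∃-syntax; _×_; _,_; proj₁; proj₂)
open import Data.Product.Properties using (≡-dec)
open import Data.Sum.Base using (_⊎_; inj₁; inj₂; [_,_]′)
open import Function.Base using (_∘_; id; case_of_)
open import Function.Bundles using (_⇔_; Inverse; Equivalence; mk⇔; mk↔ₛ′)
open import Relation.Binary.Construct.Closure.ReflexiveTransitive using (Star; ε; _◅_; _◅◅_)
import Relation.Binary.Construct.Closure.ReflexiveTransitive as Star
open import Relation.Binary.Definitions using (DecidableEquality; Tri; tri<; tri≈; tri>)
open import Relation.Binary.PropositionalEquality
  using (_≡_; _≢_; refl; sym; trans; cong; cong₂; subst; subst₂; ≢-sym; module ≡-Reasoning)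
open import Relation.Nullary using (Dec; yes; no; does; ¬?; _×-dec_; _⊎-dec_; _→-dec_; contradiction)
open import Relation.Nullary.Decidable using (dec-true; dec-false; decidable-stable; map′; from-yes; does-⇔)
import Data.Integer.Base as ℤ
import Data.Integer.Properties as ℤ
import Data.Rational.Properties as ℚ
open import Data.Rational.Base using (toℚᵘ)
open import Data.Rational.Unnormalised.Base using (mkℚᵘ; *≤*)
import Data.Rational.Unnormalised.Base as ℚᵘ
import Data.Rational.Unnormalised.Properties as ℚᵘ

open Graph
open Dart

-- The dual graph is never built: its vertices are the orbits of `face` on the darts of G, its edges
-- those of `reverse`, and its cuts are Boolean functions on darts that are constant on faces. Such
-- a function changes an even number of times round each vertex of G. This parity fact makes the
-- dual bridgeless, keeps face boundaries independent of tree edges, and connects the faces outside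
-- two suitably chosen ones, as Brooks' argument needs.
--
-- Petersen's theorem is proved by deleting both ends of an edge and rejoining the loose ends in one
-- of two ways. A matching of the smaller graph that uses both new edges does not lift, so the
-- induction proves more: some matching avoids any prescribed edge. The 3-colouring splits by
-- degrees: with a vertex of degree 2, G is a triangle; a vertex of degree at least 4 provides the
-- two faces; if all degrees are 3, G is K₄.
--
-- Whether a graph has a bridge or a colouring is not decided along the way. These results are
-- stated under a double negation, which disappears at the end because the inequality between
-- natural numbers is decidable.

-- Orbits of a self-map and equivalence classes

iterate : {A : Set} → (A → A) → ℕ → A → A
iterate f zero    x = x
iterate f (suc k) x = iterate f k (f x)

iterate-+ : {A : Set} (f : A → A) (k m : ℕ) (x : A) → iterate f (k + m) x ≡ iterate f m (iterate f k x)
iterate-+ f zero    m x = refl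
iterate-+ f (suc k) m x = iterate-+ f k m (f x)

iterate-suc : {A : Set} (f : A → A) (k : ℕ) (x : A) → iterate f (suc k) x ≡ f (iterate f k x)
iterate-suc f zero    x = refl
iterate-suc f (suc k) x = iterate-suc f k (f x)

module _ {A : Set} {f : A → A} where

  reach-iterate : ∀ {x y} → Reach f x y → ∃[ k ] iterate f k x ≡ y
  reach-iterate ε          = zero , refl
  reach-iterate (refl ◅ r) = let k , eq = reach-iterate r in suc k , eq

  step : ∀ {x y} → f x ≡ y → Reach f x y
  step eq = eq ◅ ε

  reach-invariant : {P : A → Set} → (∀ x → P x → P (f x)) → ∀ {x y} → Reach f x y → P x → P y
  reach-invariant inv ε          p = p
  reach-invariant inv (refl ◅ r) p = reach-invariant inv r (inv _ p)

  -- If both a and b lie on the orbit of their common image c, the shorter of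
  -- the two paths from c is a prefix of the longer one, which then runs
  -- through c again and can be shortened.
  private
    same-preimage : ∀ N k l {a b c} → k + l < N → iterate f k c ≡ a → iterate f l c ≡ b →
                    f a ≡ c → f b ≡ c → a ≡ b
    same-preimage (suc N) k l (s≤s k+l≤N) p q fa fb with ℕ.compare k l
    ... | ℕ.equal k = trans (sym p) q
    ... | ℕ.less k m = same-preimage N k m
      (ℕ.<-≤-trans (ℕ.+-monoʳ-< k (s≤s (ℕ.m≤n+m m k))) k+l≤N) p
      (trans (cong (iterate f m) (trans (sym fa) (trans (cong f (sym p)) (sym (iterate-suc f k _)))))
        (trans (sym (iterate-+ f (suc k) m _)) q)) fa fb
    ... | ℕ.greater l m = same-preimage N m l
      (ℕ.<-≤-trans (ℕ.+-monoˡ-< l (s≤s (ℕ.m≤n+m m l))) k+l≤N)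
      (trans (cong (iterate f m) (trans (sym fb) (trans (cong f (sym q)) (sym (iterate-suc f l _)))))
        (trans (sym (iterate-+ f (suc l) m _)) p)) q fa fb

  -- Supplies the injectivity of `next`, which a rotation system grants only through `next-cyclic`.
  cyclic⇒injective : ∀ {a b} → Reach f (f a) a → Reach f (f a) b → f a ≡ f b → a ≡ b
  cyclic⇒injective ra rb eq =
    let k , p = reach-iterate ra
        l , q = reach-iterate rb
    in same-preimage (suc (k + l)) k l ℕ.≤-refl p q refl (sym eq)

  last-step : ∀ {x y} → Reach f x y → x ≡ y ⊎ (∃[ z ] Reach f x z × f z ≡ y)
  last-step ε = inj₁ refl
  last-step (refl ◅ r) with last-step r
  ... | inj₁ refl        = inj₂ (_ , ε , refl)
  ... | inj₂ (z , s , p) = inj₂ (z , refl ◅ s , p)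

module Classes {A : Set} {R : A → A → Set} {k : ℕ} (C : HasClasses R k) where
  open HasClasses C public

  ∼⇒≡ : ∀ {x y} → R x y → class x ≡ class y
  ∼⇒≡ {x} {y} = Equivalence.to (class-∼ x y)

  ≡⇒∼ : ∀ {x y} → class x ≡ class y → R x y
  ≡⇒∼ {x} {y} = Equivalence.from (class-∼ x y)

  member : Fin k → A
  member c = proj₁ (class-surjective c)

  class-member : ∀ c → class (member c) ≡ c
  class-member c = proj₂ (class-surjective c) refl

mkClasses : {A : Set} {R : A → A → Set} {k : ℕ} (class : A → Fin k) → (∀ c → ∃[ x ] class x ≡ c) →
            (∀ {x y} → R x y → class x ≡ class y) → (∀ {x y} → class x ≡ class y → R x y) →
            HasClasses R k
mkClasses class surj to from = record
  { class            = class
  ; class-surjective = λ c → let x , eq = surj c in x , λ { refl → eq }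
  ; class-∼          = λ x y → mk⇔ to from
  }

step-invariant : {A B : Set} {R : A → A → Set} (g : A → B) → (∀ {x y} → R x y → g x ≡ g y) →
                 ∀ {x y} → Star R x y → g x ≡ g y
step-invariant g inv ε       = refl
step-invariant g inv (s ◅ r) = trans (inv s) (step-invariant g inv r)

-- The relabelling after two classes become one, as when a new edge joins two components or two
-- facial walks: label `i` disappears and its members go where `j` goes.
merge : ∀ {k} {i j : Fin (suc k)} → i ≢ j → Fin (suc k) → Fin k
merge {i = i} i≢j x with i ≟ x
... | yes _   = punchOut i≢j
... | no i≢x = punchOut i≢x

module _ {k : ℕ} {i j : Fin (suc k)} (i≢j : i ≢ j) where

  merge-i : merge i≢j i ≡ merge i≢j j
  merge-i with i ≟ i | i ≟ j
  ... | yes _  | no i≢j′ = Fin.punchOut-cong i refl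
  ... | yes _  | yes i≡j = contradiction i≡j i≢j
  ... | no i≢i | _       = contradiction refl i≢i

  merge-injective : ∀ {x y} → merge i≢j x ≡ merge i≢j y →
                    x ≡ y ⊎ (x ≡ i × y ≡ j) ⊎ (x ≡ j × y ≡ i)
  merge-injective {x} {y} eq with i ≟ x | i ≟ y
  ... | yes refl | yes refl = inj₁ refl
  ... | yes refl | no i≢y   = inj₂ (inj₁ (refl , sym (Fin.punchOut-injective i≢j i≢y eq)))
  ... | no i≢x   | yes refl = inj₂ (inj₂ (Fin.punchOut-injective i≢x i≢j eq , refl))
  ... | no i≢x   | no i≢y   = inj₁ (Fin.punchOut-injective i≢x i≢y eq)

  merge-surjective : ∀ c → ∃[ x ] merge i≢j x ≡ c
  merge-surjective c = punchIn i c , eq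
    where
    eq : merge i≢j (punchIn i c) ≡ c
    eq with i ≟ punchIn i c
    ... | yes p = contradiction (sym p) (Fin.punchInᵢ≢i i c)
    ... | no p  = trans (Fin.punchOut-cong i refl) (Fin.punchOut-punchIn i)

-- Filtered lists that differ in one entry

module _ {A : Set} {P Q : A → Set} (P? : ∀ x → Dec (P x)) (Q? : ∀ x → Dec (Q x)) where

  filter-cong-∈ : ∀ xs → (∀ {x} → x ∈ xs → P x ⇔ Q x) → filter P? xs ≡ filter Q? xs
  filter-cong-∈ []       eqv = refl
  filter-cong-∈ (x ∷ xs) eqv with P? x | Q? x
  ... | yes _ | yes _ = cong (x ∷_) (filter-cong-∈ xs (eqv ∘ there))
  ... | no _  | no _  = filter-cong-∈ xs (eqv ∘ there)
  ... | yes p | no ¬q = contradiction (Equivalence.to (eqv (here refl)) p) ¬q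
  ... | no ¬p | yes q = contradiction (Equivalence.from (eqv (here refl)) q) ¬p

  -- Serves both counts in Euler's formula that a new edge affects: the edges gain one entry, and
  -- the isolated vertices may lose one.
  length-filter-extra : ∀ {xs z} → Unique xs → z ∈ xs → ¬ P z → Q z → (∀ {x} → x ≢ z → P x ⇔ Q x) →
                        length (filter Q? xs) ≡ suc (length (filter P? xs))
  length-filter-extra {x ∷ xs} (x∉ ∷ _) (here refl) ¬p q eqv with P? x | Q? x
  ... | yes p | _     = contradiction p ¬p
  ... | no _  | no ¬q = contradiction q ¬q
  ... | no _  | yes _ = cong (suc ∘ length)
    (sym (filter-cong-∈ xs λ y∈ → eqv (≢-sym (All.lookup x∉ y∈))))
  length-filter-extra {x ∷ xs} (x∉ ∷ uniq) (there z∈) ¬p q eqv with P? x | Q? x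
  ... | yes _ | yes _ = cong suc (length-filter-extra uniq z∈ ¬p q eqv)
  ... | no _  | no _  = length-filter-extra uniq z∈ ¬p q eqv
  ... | yes p | no ¬q = contradiction (Equivalence.to (eqv (All.lookup x∉ z∈)) p) ¬q
  ... | no ¬p′ | yes q′ = contradiction (Equivalence.from (eqv (All.lookup x∉ z∈)) q′) ¬p′

lookup-injective : {A : Set} {xs : List A} → Unique xs → ∀ {i j} → lookup xs i ≡ lookup xs j → i ≡ j
lookup-injective (x∉ ∷ _) {zero}  {zero}  _  = refl
lookup-injective (x∉ ∷ _) {zero}  {suc j} eq = contradiction eq (All.lookup x∉ (∈-lookup j))
lookup-injective (x∉ ∷ _) {suc i} {zero}  eq = contradiction (sym eq) (All.lookup x∉ (∈-lookup i))
lookup-injective (_ ∷ u)  {suc i} {suc j} eq = cong suc (lookup-injective u eq)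

pairs : ∀ n → List (Pair n)
pairs n = cartesianProduct (allFin n) (allFin n)

unique-pairs : ∀ n → Unique (pairs n)
unique-pairs n = Unique.cartesianProduct⁺ (Unique.allFin⁺ n) (Unique.allFin⁺ n)

isEdge? : ∀ {n} (G : Graph n) (p : Pair n) → Dec (toℕ (proj₁ p) < toℕ (proj₂ p) × Adj G (proj₁ p) (proj₂ p))
isEdge? G p = (proj₁ p <? proj₂ p) ×-dec Adj? G (proj₁ p) (proj₂ p)

-- Darts and facial walks

module _ {n : ℕ} {G : Graph n} where

  dart-≡ : {d e : Dart G} → tail d ≡ tail e → head d ≡ head e → d ≡ e
  dart-≡ {dart x y p} {dart .x .y q} refl refl = cong (dart x y) (T-irrelevant p q)

  infix 4 _≟ᵈ_
  _≟ᵈ_ : DecidableEquality (Dart G)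
  d ≟ᵈ e = map′ (λ (p , q) → dart-≡ p q) (λ { refl → refl , refl }) (tail d ≟ tail e ×-dec head d ≟ head e)

  reverse-reverse : (d : Dart G) → reverse (reverse d) ≡ d
  reverse-reverse d = dart-≡ refl refl

  reverse-injective : {d e : Dart G} → reverse d ≡ reverse e → d ≡ e
  reverse-injective eq = trans (sym (reverse-reverse _)) (trans (cong reverse eq) (reverse-reverse _))

  Adj-sym : ∀ {x y} → Adj G x y → Adj G y x
  Adj-sym {x} {y} p = adjacent (reverse {G = G} (dart x y p))

  Adj-irrefl : ∀ {x} → ¬ Adj G x x
  Adj-irrefl {x} p = subst T (irrefl G x) p

  tail≢head : (d : Dart G) → tail d ≢ head d
  tail≢head (dart x _ p) refl = Adj-irrefl p

module Embedded {n : ℕ} {G : Graph n} (E : PlaneEmbedding G) where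
  open PlaneEmbedding E public
  module Walk = Classes walks
  module Component = Classes components

  next-injective : ∀ {d e} → next d ≡ next e → d ≡ e
  next-injective {d} {e} eq = cyclic⇒injective
    (next-cyclic (next d) d (next-tail d))
    (next-cyclic (next d) e (trans (cong tail eq) (next-tail e))) eq

  prev : ∀ d → ∃[ p ] next p ≡ d × tail p ≡ tail d
  prev d with last-step (next-cyclic (next d) d (next-tail d))
  ... | inj₁ nd≡d         = d , nd≡d , refl
  ... | inj₂ (p , _ , eq) = p , eq , trans (sym (next-tail p)) (cong tail eq)

  face-injective : ∀ {d e} → face d ≡ face e → d ≡ e
  face-injective = reverse-injective ∘ next-injective

  tail-face : ∀ d → tail (face d) ≡ head d
  tail-face d = next-tail (reverse d)

  next≡face-reverse : ∀ d → next d ≡ face (reverse d)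
  next≡face-reverse d = cong next (sym (reverse-reverse d))

  walk : Dart G → Fin #walks
  walk = Walk.class

  walk-face : ∀ d → walk (face d) ≡ walk d
  walk-face d = sym (Walk.∼⇒≡ (step refl))

-- Petersen's theorem, by Frink's reduction

≢⇒≡ : ∀ {a b c : Bool} → a ≢ c → b ≢ c → a ≡ b
≢⇒≡ {true}  {true}  _   _   = refl
≢⇒≡ {false} {false} _   _   = refl
≢⇒≡ {true}  {false} {true}  a≢c _ = contradiction refl a≢c
≢⇒≡ {true}  {false} {false} _ b≢c = contradiction refl b≢c
≢⇒≡ {false} {true}  {true}  _ b≢c = contradiction refl b≢c
≢⇒≡ {false} {true}  {false} a≢c _ = contradiction refl a≢c

data ExactlyOne : Bool → Bool → Bool → Set where
  first  : ExactlyOne true false false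
  second : ExactlyOne false true false
  third  : ExactlyOne false false true

rotate : ∀ {a b c} → ExactlyOne a b c → ExactlyOne b c a
rotate first  = third
rotate second = first
rotate third  = second

swap₂₃ : ∀ {a b c} → ExactlyOne a b c → ExactlyOne a c b
swap₂₃ first  = first
swap₂₃ second = third
swap₂₃ third  = second

-- When the ends of an edge are deleted, four loose ends remain: 0 and 1 from one vertex, 2 and 3
-- from the other. `flip₄` exchanges the two of one vertex; `σ₁` and `σ₂` are the two ways to join
-- each loose end to one from the other vertex.
flip₄ σ₁ σ₂ : Fin 4 → Fin 4
flip₄ 0F = 1F
flip₄ 1F = 0F
flip₄ 2F = 3F
flip₄ 3F = 2F
σ₁ 0F = 2F
σ₁ 1F = 3F
σ₁ 2F = 0F
σ₁ 3F = 1F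
σ₂ 0F = 3F
σ₂ 1F = 2F
σ₂ 2F = 1F
σ₂ 3F = 0F

σ₁σ₁ : ∀ i → σ₁ (σ₁ i) ≡ i
σ₁σ₁ = from-yes (all? λ i → σ₁ (σ₁ i) ≟ i)

σ₂σ₂ : ∀ i → σ₂ (σ₂ i) ≡ i
σ₂σ₂ = from-yes (all? λ i → σ₂ (σ₂ i) ≟ i)

σ₁≢ : ∀ i → σ₁ i ≢ i
σ₁≢ = from-yes (all? λ i → ¬? (σ₁ i ≟ i))

σ₂≢ : ∀ i → σ₂ i ≢ i
σ₂≢ = from-yes (all? λ i → ¬? (σ₂ i ≟ i))

ports₁ : ∀ i j → j ≡ i ⊎ j ≡ σ₁ i ⊎ j ≡ flip₄ i ⊎ j ≡ σ₁ (flip₄ i)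
ports₁ = from-yes (all? λ i → all? λ j → (j ≟ i) ⊎-dec (j ≟ σ₁ i) ⊎-dec (j ≟ flip₄ i) ⊎-dec (j ≟ σ₁ (flip₄ i)))

ports₂ : ∀ i j → j ≡ i ⊎ j ≡ σ₂ i ⊎ j ≡ flip₄ i ⊎ j ≡ σ₂ (flip₄ i)
ports₂ = from-yes (all? λ i → all? λ j → (j ≟ i) ⊎-dec (j ≟ σ₂ i) ⊎-dec (j ≟ flip₄ i) ⊎-dec (j ≟ σ₂ (flip₄ i)))

flip≢₁ : ∀ i → flip₄ i ≢ i × flip₄ i ≢ σ₁ i
flip≢₁ = from-yes (all? λ i → ¬? (flip₄ i ≟ i) ×-dec ¬? (flip₄ i ≟ σ₁ i))

flip≢₂ : ∀ i → flip₄ i ≢ i × flip₄ i ≢ σ₂ i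
flip≢₂ = from-yes (all? λ i → ¬? (flip₄ i ≟ i) ×-dec ¬? (flip₄ i ≟ σ₂ i))

-- The sides of the four loose ends under a cut that separates 0 from 1 and respects the pairing
-- `σ₁`, respectively `σ₂`. Together the two patterns put one loose end into each quadrant.
side₁ side₂ : Bool → Fin 4 → Bool
side₁ a 0F = a
side₁ a 1F = not a
side₁ a 2F = a
side₁ a 3F = not a
side₂ b 0F = b
side₂ b 1F = not b
side₂ b 2F = not b
side₂ b 3F = b

Quadrants : Bool → Bool → Bool → Bool → Set
Quadrants a b A B =
  ∃[ i ] side₁ a i ≡ A × side₂ b i ≡ B × (∀ j → j ≢ i → ¬ (side₁ a j ≡ A × side₂ b j ≡ B))

quadrants? : ∀ a b A B → Dec (Quadrants a b A B)
quadrants? a b A B = any? λ i → (side₁ a i Bool.≟ A) ×-dec (side₂ b i Bool.≟ B) ×-dec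
  all? λ j → ¬? (j ≟ i) →-dec ¬? ((side₁ a j Bool.≟ A) ×-dec (side₂ b j Bool.≟ B))

∀-Bool? : {P : Bool → Set} → (∀ b → Dec (P b)) → Dec (∀ b → P b)
∀-Bool? P? = map′ (λ { (p , q) true → p ; (p , q) false → q }) (λ f → f true , f false) (P? true ×-dec P? false)

quadrants : ∀ a b A B → Quadrants a b A B
quadrants = from-yes (∀-Bool? λ a → ∀-Bool? λ b → ∀-Bool? λ A → ∀-Bool? λ B → quadrants? a b A B)

-- Cubic multigraphs: the vertices are the orbits of a fixed permutation φ of
-- order 3, the edges are the orbits of an involution of the list L of darts
-- in use.
module CubicMultigraph
  {X : Set} (_≟ₓ_ : DecidableEquality X) (φ : X → X)
  (φ³ : ∀ x → φ (φ (φ x)) ≡ x) (φ≢ : ∀ x → φ x ≢ x) where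

  record Cubic (L : List X) (rev : X → X) : Set where
    field
      φ∈      : ∀ {x} → x ∈ L → φ x ∈ L
      rev∈    : ∀ {x} → x ∈ L → rev x ∈ L
      rev-rev : ∀ {x} → x ∈ L → rev (rev x) ≡ x
      rev≢    : ∀ {x} → x ∈ L → rev x ≢ x

  -- A bridge is witnessed by a set of vertices that only one edge leaves, rather than by
  -- disconnection, so that bridges are transferred between graphs by recolouring vertices, without
  -- paths. `side-φ` makes `side` a function of vertices.
  record Bridge (L : List X) (rev : X → X) : Set where
    field
      side    : X → Bool
      side-φ  : ∀ x → side (φ x) ≡ side x
      edge    : X
      edge∈   : edge ∈ L
      crosses : side edge ≢ side (rev edge)
      unique  : ∀ {e} → e ∈ L → side e ≢ side (rev e) → e ≡ edge ⊎ e ≡ rev edge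

  record PerfectMatching (L : List X) (rev : X → X) : Set where
    field
      matched : X → Bool
      m-rev   : ∀ {x} → x ∈ L → matched (rev x) ≡ matched x
      m-one   : ∀ {x} → x ∈ L → ExactlyOne (matched x) (matched (φ x)) (matched (φ (φ x)))

  open PerfectMatching

  Orbit : X → X → X → Set
  Orbit a b c = (φ a ≡ b × φ b ≡ c × φ c ≡ a) ⊎ (φ a ≡ c × φ c ≡ b × φ b ≡ a)

  orbit : ∀ x → Orbit x (φ x) (φ (φ x))
  orbit x = inj₁ (refl , refl , φ³ x)

  module _ {a b c : X} where

    Orbit-swap : Orbit a b c → Orbit a c b
    Orbit-swap (inj₁ p) = inj₂ p
    Orbit-swap (inj₂ p) = inj₁ p

    Orbit-rotate : Orbit a b c → Orbit b c a
    Orbit-rotate (inj₁ (p , q , r)) = inj₁ (q , r , p)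
    Orbit-rotate (inj₂ (p , q , r)) = inj₂ (r , p , q)

    Orbit-≢ : Orbit a b c → a ≢ b
    Orbit-≢ (inj₁ (refl , _ , _)) eq = φ≢ _ (sym eq)
    Orbit-≢ (inj₂ (_ , _ , refl)) eq = φ≢ _ eq

  pattern at₁ = inj₂ (inj₁ refl)
  pattern at₂ = inj₂ (inj₂ refl)

  In : X → X → X → X → Set
  In a b c x = x ≡ a ⊎ x ≡ b ⊎ x ≡ c

  In? : ∀ a b c x → Dec (In a b c x)
  In? a b c x = (x ≟ₓ a) ⊎-dec (x ≟ₓ b) ⊎-dec (x ≟ₓ c)

  In-φ : ∀ {a b c x} → Orbit a b c → In a b c x → In a b c (φ x)
  In-φ (inj₁ (p , q , r)) (inj₁ refl)        = inj₂ (inj₁ p)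
  In-φ (inj₁ (p , q , r)) at₁ = inj₂ (inj₂ q)
  In-φ (inj₁ (p , q , r)) at₂ = inj₁ r
  In-φ (inj₂ (p , q , r)) (inj₁ refl)        = inj₂ (inj₂ p)
  In-φ (inj₂ (p , q , r)) at₁ = inj₁ r
  In-φ (inj₂ (p , q , r)) at₂ = inj₂ (inj₁ q)

  In-φ⁻ : ∀ {a b c x} → Orbit a b c → In a b c (φ x) → In a b c x
  In-φ⁻ {x = x} o i = subst (In _ _ _) (φ³ x) (In-φ o (In-φ o i))

  In-∈ : ∀ {L rev a b c x} → Cubic L rev → Orbit a b c → a ∈ L → In a b c x → x ∈ L
  In-∈ C o a∈ (inj₁ refl) = a∈
  In-∈ C (inj₁ (refl , q , r)) a∈ at₁ = Cubic.φ∈ C a∈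
  In-∈ C (inj₁ (refl , refl , r)) a∈ at₂ = Cubic.φ∈ C (Cubic.φ∈ C a∈)
  In-∈ C (inj₂ (refl , refl , r)) a∈ at₁ = Cubic.φ∈ C (Cubic.φ∈ C a∈)
  In-∈ C (inj₂ (refl , q , r)) a∈ at₂ = Cubic.φ∈ C a∈

  ExactlyOne-orbit : ∀ {a b c x} (M : X → Bool) → Orbit a b c → ExactlyOne (M a) (M b) (M c) →
                     In a b c x → ExactlyOne (M x) (M (φ x)) (M (φ (φ x)))
  ExactlyOne-orbit M (inj₁ (refl , refl , r)) one (inj₁ refl) = one
  ExactlyOne-orbit {a} M (inj₁ (refl , refl , r)) one at₁ rewrite r = rotate one
  ExactlyOne-orbit M (inj₁ (refl , refl , r)) one at₂ rewrite r = rotate (rotate one)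
  ExactlyOne-orbit M (inj₂ (refl , refl , r)) one (inj₁ refl) = swap₂₃ one
  ExactlyOne-orbit M (inj₂ (refl , refl , r)) one at₁ rewrite r = rotate (rotate (swap₂₃ one))
  ExactlyOne-orbit M (inj₂ (refl , refl , r)) one at₂ rewrite r = rotate (swap₂₃ one)

  -- The third edge at a vertex with a loop is a bridge.
  loopless : ∀ {L rev a b c} → Cubic L rev → ¬ Bridge L rev → Orbit a b c → a ∈ L → rev a ≢ b
  loopless {L} {rev} {a} {b} {c} C noBridge o a∈ ra≡b = noBridge record
    { side    = side
    ; side-φ  = side-φ
    ; edge    = c
    ; edge∈   = c∈
    ; crosses = λ eq → contradiction (trans (sym (in-side rc∉)) (trans (sym eq) (in-side′ at₂))) λ ()
    ; unique  = uniq
    }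
    where
    open Cubic C
    side : X → Bool
    side x = does (In? a b c x)
    in-side′ : ∀ {x} → In a b c x → side x ≡ true
    in-side′ {x} i = dec-true (In? a b c x) i
    in-side : ∀ {x} → ¬ In a b c x → side x ≡ false
    in-side {x} i = dec-false (In? a b c x) i
    side-φ : ∀ x → side (φ x) ≡ side x
    side-φ x = does-⇔ (mk⇔ (In-φ⁻ o) (In-φ o)) (In? a b c (φ x)) (In? a b c x)
    c∈ : c ∈ L
    c∈ = In-∈ C o a∈ at₂
    rb≡a : rev b ≡ a
    rb≡a = trans (cong rev (sym ra≡b)) (rev-rev a∈)
    rc∉ : ¬ In a b c (rev c)
    rc∉ (inj₁ rc≡a) = Orbit-≢ (Orbit-rotate o) (trans (sym ra≡b) (trans (cong rev (sym rc≡a)) (rev-rev c∈)))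
    rc∉ (inj₂ (inj₁ rc≡b)) = Orbit-≢ (Orbit-rotate (Orbit-rotate o)) (trans (sym (rev-rev c∈)) (trans (cong rev rc≡b) rb≡a))
    rc∉ (inj₂ (inj₂ rc≡c)) = rev≢ c∈ rc≡c
    uniq : ∀ {e} → e ∈ L → side e ≢ side (rev e) → e ≡ c ⊎ e ≡ rev c
    uniq {e} e∈ cr with In? a b c e | In? a b c (rev e)
    ... | yes i | yes j = contradiction (trans (in-side′ i) (sym (in-side′ j))) cr
    ... | no ¬i | no ¬j = contradiction (trans (in-side ¬i) (sym (in-side ¬j))) cr
    ... | yes (inj₁ refl) | no re∉ = contradiction (inj₂ (inj₁ ra≡b)) re∉
    ... | yes at₁ | no re∉ = contradiction (inj₁ rb≡a) re∉
    ... | yes at₂ | no re∉ = inj₁ refl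
    ... | no e∉ | yes (inj₁ re≡a) = contradiction (inj₂ (inj₁ (trans (sym (rev-rev e∈)) (trans (cong rev re≡a) ra≡b)))) e∉
    ... | no e∉ | yes (inj₂ (inj₁ re≡b)) = contradiction (inj₁ (trans (sym (rev-rev e∈)) (trans (cong rev re≡b) rb≡a))) e∉
    ... | no e∉ | yes (inj₂ (inj₂ re≡c)) = inj₂ (trans (sym (rev-rev e∈)) (cong rev re≡c))

  In-swap : ∀ {a b c x} → In a b c x → In a c b x
  In-swap (inj₁ p)        = inj₁ p
  In-swap (inj₂ (inj₁ p)) = inj₂ (inj₂ p)
  In-swap (inj₂ (inj₂ p)) = inj₂ (inj₁ p)

  -- The edge of `b` does not return to its own vertex because there are no loops, and it does not
  -- end in `x` because `x` is already the other end of `a`.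
  kept-end : ∀ {L rev a b c x y z} → Cubic L rev → ¬ Bridge L rev → Orbit a b c → a ∈ L → rev a ≡ x →
         rev b ≢ y → rev b ≢ z → ¬ In a b c (rev b) × ¬ In x y z (rev b)
  kept-end {L} {rev} {a} {b} {c} {x} C nb o a∈ ra≡x ≢y ≢z = ¬i , ¬j
    where
    b∈ : b ∈ L
    b∈ = In-∈ C o a∈ at₁
    ¬i : ¬ In a b c (rev b)
    ¬i (inj₁ p)        = loopless C nb (Orbit-swap (Orbit-rotate o)) b∈ p
    ¬i (inj₂ (inj₁ p)) = Cubic.rev≢ C b∈ p
    ¬i (inj₂ (inj₂ p)) = loopless C nb (Orbit-rotate o) b∈ p
    ¬j : ¬ In x _ _ (rev b)
    ¬j (inj₁ p) = Orbit-≢ o (trans (sym (Cubic.rev-rev C a∈))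
      (trans (cong rev (trans ra≡x (sym p))) (Cubic.rev-rev C b∈)))
    ¬j (inj₂ (inj₁ p)) = ≢y p
    ¬j (inj₂ (inj₂ p)) = ≢z p

  module Removal
    {L : List X} {rev : X → X} (C : Cubic L rev) (noBridge : ¬ Bridge L rev)
    {d₀ d₁ d₂ e₀ e₁ e₂ : X} (oᵈ : Orbit d₀ d₁ d₂) (oᵉ : Orbit e₀ e₁ e₂)
    (d₀∈ : d₀ ∈ L) (rd₀ : rev d₀ ≡ e₀) where

    open Cubic C

    Removed : X → Set
    Removed x = In d₀ d₁ d₂ x ⊎ In e₀ e₁ e₂ x

    Removed? : ∀ x → Dec (Removed x)
    Removed? x = In? d₀ d₁ d₂ x ⊎-dec In? e₀ e₁ e₂ x

    Removed-φ : ∀ {x} → Removed x → Removed (φ x)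
    Removed-φ (inj₁ i) = inj₁ (In-φ oᵈ i)
    Removed-φ (inj₂ i) = inj₂ (In-φ oᵉ i)

    Removed-φ⁻ : ∀ {x} → Removed (φ x) → Removed x
    Removed-φ⁻ (inj₁ i) = inj₁ (In-φ⁻ oᵈ i)
    Removed-φ⁻ (inj₂ i) = inj₂ (In-φ⁻ oᵉ i)

    e₀∈ : e₀ ∈ L
    e₀∈ = subst (_∈ L) rd₀ (rev∈ d₀∈)

    re₀ : rev e₀ ≡ d₀
    re₀ = trans (cong rev (sym rd₀)) (rev-rev d₀∈)

    Removed-∈ : ∀ {x} → Removed x → x ∈ L
    Removed-∈ (inj₁ i) = In-∈ C oᵈ d₀∈ i
    Removed-∈ (inj₂ i) = In-∈ C oᵉ e₀∈ i

    rest : List X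
    rest = filter (¬? ∘ Removed?) L

    rest⁺ : ∀ {x} → x ∈ L → ¬ Removed x → x ∈ rest
    rest⁺ = ∈-filter⁺ (¬? ∘ Removed?)

    rest-∈ : ∀ {x} → x ∈ rest → x ∈ L
    rest-∈ = proj₁ ∘ ∈-filter⁻ (¬? ∘ Removed?)

    rest-∉ : ∀ {x} → x ∈ rest → ¬ Removed x
    rest-∉ x∈ = proj₂ (∈-filter⁻ (¬? ∘ Removed?) {xs = L} x∈)

    rest-φ : ∀ {x} → x ∈ rest → φ x ∈ rest
    rest-φ x∈ = rest⁺ (φ∈ (rest-∈ x∈)) (rest-∉ x∈ ∘ Removed-φ⁻)

    rest-shorter : length rest < length L
    rest-shorter = List.filter-notAll (¬? ∘ Removed?) L (lose d₀∈ (λ ¬r → ¬r (inj₁ (inj₁ refl))))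

    -- Carries a cut `γ` of the reduced graph back to the original one, with both removed vertices
    -- on side `c`; the edge between them then never crosses.
    extend : Bool → (X → Bool) → X → Bool
    extend c γ x = if does (Removed? x) then c else γ x

    module _ (c : Bool) (γ : X → Bool) where

      extend-in : ∀ {x} → Removed x → extend c γ x ≡ c
      extend-in {x} r = cong (if_then c else γ x) (dec-true (Removed? x) r)

      extend-out : ∀ {x} → ¬ Removed x → extend c γ x ≡ γ x
      extend-out {x} ¬r = cong (if_then c else γ x) (dec-false (Removed? x) ¬r)

      extend-φ : (∀ x → γ (φ x) ≡ γ x) → ∀ x → extend c γ (φ x) ≡ extend c γ x
      extend-φ γ-φ x with Removed? x
      ... | yes r = trans (extend-in (Removed-φ r)) (sym (extend-in r))
      ... | no ¬r = trans (extend-out (¬r ∘ Removed-φ⁻)) (trans (γ-φ x) (sym (extend-out ¬r)))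

    module _ {rev′ : X → X} (M′ : PerfectMatching rest rev′) (val : X → Bool)
      (one-d : ExactlyOne (val d₀) (val d₁) (val d₂))
      (one-e : ExactlyOne (val e₀) (val e₁) (val e₂))
      (in-in : ∀ {x} → Removed x → Removed (rev x) → val (rev x) ≡ val x)
      (in-out : ∀ {x} → Removed x → ¬ Removed (rev x) → matched M′ (rev x) ≡ val x)
      (out-out : ∀ {x} → x ∈ rest → rev x ∈ rest → rev′ x ≡ rev x) where

      private
        M : X → Bool
        M x = if does (Removed? x) then val x else matched M′ x

        M-in : ∀ {x} → Removed x → M x ≡ val x
        M-in {x} r = cong (if_then val x else matched M′ x) (dec-true (Removed? x) r)

        M-out : ∀ {x} → ¬ Removed x → M x ≡ matched M′ x
        M-out {x} ¬r = cong (if_then val x else matched M′ x) (dec-false (Removed? x) ¬r)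

        M-rev : ∀ {x} → x ∈ L → M (rev x) ≡ M x
        M-rev {x} x∈ with Removed? x | Removed? (rev x)
        ... | yes r | yes r′ = trans (M-in r′) (trans (in-in r r′) (sym (M-in r)))
        ... | yes r | no ¬r′ = trans (M-out ¬r′) (trans (in-out r ¬r′) (sym (M-in r)))
        ... | no ¬r | yes r′ = trans (M-in r′) (trans
          (trans (sym (in-out r′ (¬r ∘ subst Removed (rev-rev x∈)))) (cong (matched M′) (rev-rev x∈)))
          (sym (M-out ¬r)))
        ... | no ¬r | no ¬r′ = trans (M-out ¬r′) (trans
          (trans (cong (matched M′) (sym (out-out (rest⁺ x∈ ¬r) (rest⁺ (rev∈ x∈) ¬r′)))) (m-rev M′ (rest⁺ x∈ ¬r)))
          (sym (M-out ¬r)))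

        M-one : ∀ {x} → x ∈ L → ExactlyOne (M x) (M (φ x)) (M (φ (φ x)))
        M-one {x} x∈ with Removed? x
        ... | yes (inj₁ i) = ExactlyOne-orbit M oᵈ
          (subst (λ a → ExactlyOne a (M d₁) (M d₂)) (sym (M-in (inj₁ (inj₁ refl))))
            (subst₂ (ExactlyOne (val d₀)) (sym (M-in (inj₁ at₁))) (sym (M-in (inj₁ at₂))) one-d)) i
        ... | yes (inj₂ i) = ExactlyOne-orbit M oᵉ
          (subst (λ a → ExactlyOne a (M e₁) (M e₂)) (sym (M-in at₁))
            (subst₂ (ExactlyOne (val e₀)) (sym (M-in (inj₂ at₁))) (sym (M-in (inj₂ at₂))) one-e)) i
        ... | no ¬r = subst (λ a → ExactlyOne a (M (φ x)) (M (φ (φ x)))) (sym (M-out ¬r))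
          (subst₂ (ExactlyOne (matched M′ x))
            (sym (M-out (¬r ∘ Removed-φ⁻))) (sym (M-out (¬r ∘ Removed-φ⁻ ∘ Removed-φ⁻)))
            (m-one M′ (rest⁺ x∈ ¬r)))

      lift-matching : Σ[ N ∈ PerfectMatching L rev ] (∀ {x} → Removed x → matched N x ≡ val x)
      lift-matching = record { matched = M ; m-rev = M-rev ; m-one = M-one } , M-in

    -- The edges leaving the removed vertices are cut, and their outer ends
    -- are joined up again along σ.
    module Rejoin
      {k : ℕ} (inner : Fin k → X) (inner-injective : ∀ {i j} → inner i ≡ inner j → i ≡ j)
      (inner-removed : ∀ i → Removed (inner i))
      (outer-kept : ∀ i → ¬ Removed (rev (inner i)))
      (complete : ∀ {x} → Removed x → ¬ Removed (rev x) → ∃[ i ] x ≡ inner i)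
      (σ : Fin k → Fin k) (σσ : ∀ i → σ (σ i) ≡ i) (σ≢ : ∀ i → σ i ≢ i) where

      outer : Fin k → X
      outer i = rev (inner i)

      outer∈ : ∀ i → outer i ∈ rest
      outer∈ i = rest⁺ (rev∈ (Removed-∈ (inner-removed i))) (outer-kept i)

      rev-outer : ∀ i → rev (outer i) ≡ inner i
      rev-outer i = rev-rev (Removed-∈ (inner-removed i))

      outer-injective : ∀ {i j} → outer i ≡ outer j → i ≡ j
      outer-injective {i} {j} eq =
        inner-injective (trans (sym (rev-outer i)) (trans (cong rev eq) (rev-outer j)))

      rejoin : X → X
      rejoin x with any? (λ i → x ≟ₓ outer i)
      ... | yes (i , _) = outer (σ i)
      ... | no _        = rev x

      rejoin-outer : ∀ i → rejoin (outer i) ≡ outer (σ i)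
      rejoin-outer i with any? (λ j → outer i ≟ₓ outer j)
      ... | yes (j , eq) = cong (outer ∘ σ) (sym (outer-injective eq))
      ... | no ¬p        = contradiction (i , refl) ¬p

      rejoin-old : ∀ {x} → ¬ Removed (rev x) → rejoin x ≡ rev x
      rejoin-old {x} ¬r with any? (λ j → x ≟ₓ outer j)
      ... | yes (j , refl) = contradiction (subst Removed (sym (rev-outer j)) (inner-removed j)) ¬r
      ... | no _           = refl

      view : ∀ {x} → x ∈ rest → (∃[ i ] x ≡ outer i) ⊎ ¬ Removed (rev x)
      view {x} x∈ with Removed? (rev x)
      ... | no ¬r = inj₂ ¬r
      ... | yes r =
        let rrx≡x = rev-rev (rest-∈ x∈)
            i , eq = complete r (rest-∉ x∈ ∘ subst Removed rrx≡x)
        in inj₁ (i , trans (sym rrx≡x) (cong rev eq))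

      cubic : Cubic rest rejoin
      cubic = record { φ∈ = rest-φ ; rev∈ = rejoin∈ ; rev-rev = rejoin-rejoin ; rev≢ = rejoin≢ }
        where
        rejoin∈ : ∀ {x} → x ∈ rest → rejoin x ∈ rest
        rejoin∈ x∈ with view x∈
        ... | inj₁ (i , refl) = subst (_∈ rest) (sym (rejoin-outer i)) (outer∈ (σ i))
        ... | inj₂ ¬r         = subst (_∈ rest) (sym (rejoin-old ¬r)) (rest⁺ (rev∈ (rest-∈ x∈)) ¬r)
        rejoin-rejoin : ∀ {x} → x ∈ rest → rejoin (rejoin x) ≡ x
        rejoin-rejoin {x} x∈ with view x∈
        ... | inj₁ (i , refl) = trans (cong rejoin (rejoin-outer i)) (trans (rejoin-outer (σ i)) (cong outer (σσ i)))
        ... | inj₂ ¬r = trans (cong rejoin (rejoin-old ¬r))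
          (trans (rejoin-old (rest-∉ x∈ ∘ subst Removed rrx≡x)) rrx≡x)
          where rrx≡x = rev-rev (rest-∈ x∈)
        rejoin≢ : ∀ {x} → x ∈ rest → rejoin x ≢ x
        rejoin≢ x∈ eq with view x∈
        ... | inj₁ (i , refl) = σ≢ i (outer-injective (trans (sym (rejoin-outer i)) eq))
        ... | inj₂ ¬r         = rev≢ (rest-∈ x∈) (trans (sym (rejoin-old ¬r)) eq)

      -- Crossing edges that the reduced and the original graph have in common. The outer ends of
      -- cut edges are excluded, since their original reversals are removed.
      OldCrossing : (X → Bool) → X → Set
      OldCrossing γ e = e ∈ rest × ¬ Removed (rev e) × γ e ≢ γ (rev e)

      outer-¬old : ∀ {γ} i → ¬ OldCrossing γ (outer i)
      outer-¬old i (_ , ¬r , _) = ¬r (subst Removed (sym (rev-outer i)) (inner-removed i))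

      crossings : ∀ c γ {e} → e ∈ L → extend c γ e ≢ extend c γ (rev e) →
                  (∃[ i ] γ (outer i) ≢ c × (e ≡ outer i ⊎ e ≡ inner i)) ⊎ OldCrossing γ e
      crossings c γ {e} e∈ cr with Removed? e | Removed? (rev e)
      ... | yes r | yes r′ = contradiction (trans (extend-in c γ r) (sym (extend-in c γ r′))) cr
      ... | no ¬r | no ¬r′ = inj₂ (rest⁺ e∈ ¬r , ¬r′ , λ eq → cr (trans (extend-out c γ ¬r) (trans eq (sym (extend-out c γ ¬r′)))))
      ... | yes r | no ¬r′ with complete r ¬r′
      ...   | i , refl = inj₁ (i , (λ eq → cr (trans (extend-in c γ r) (trans (sym eq) (sym (extend-out c γ ¬r′))))) , inj₂ refl)
      crossings c γ {e} e∈ cr | no ¬r | yes r′ with complete r′ (¬r ∘ subst Removed (rev-rev e∈))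
      ...   | i , re≡i = inj₁ (i , (λ eq → cr (trans (extend-out c γ ¬r) (trans (cong γ e≡o) (trans eq (sym (extend-in c γ r′)))))) , inj₁ e≡o)
        where
        e≡o : e ≡ outer i
        e≡o = trans (sym (rev-rev e∈)) (cong rev re≡i)

      module _ {γ : X → Bool} (γ-φ : ∀ x → γ (φ x) ≡ γ x) (c : Bool) where

        -- With both removed vertices on side `c`, the edge at port `i` alone crosses in the
        -- original graph and would be a bridge there.
        no-odd-port : ∀ i → γ (outer i) ≢ c → (∀ j → j ≢ i → γ (outer j) ≡ c) →
                      (∀ e → ¬ OldCrossing γ e) → ⊥
        no-odd-port i i≢c others none = noBridge record
          { side    = extend c γ
          ; side-φ  = extend-φ c γ γ-φ
          ; edge    = inner i
          ; edge∈   = Removed-∈ (inner-removed i)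
          ; crosses = λ eq → i≢c (trans (sym (extend-out c γ (outer-kept i))) (trans (sym eq) (extend-in c γ (inner-removed i))))
          ; unique  = λ e∈ cr → case crossings c γ e∈ cr of λ where
              (inj₂ old) → contradiction old (none _)
              (inj₁ (j , j≢c , e≡)) → case j ≟ i of λ where
                (yes refl) → [ inj₂ , inj₁ ]′ e≡
                (no j≢i)   → contradiction (others j j≢i) j≢c
          }

        no-odd-old : ∀ s → (∀ i → γ (outer i) ≡ c) → OldCrossing γ s →
                     (∀ e → OldCrossing γ e → e ≡ s ⊎ e ≡ rev s) → ⊥
        no-odd-old s ports (s∈ , ¬r , s×) uniq = noBridge record
          { side    = extend c γ
          ; side-φ  = extend-φ c γ γ-φ
          ; edge    = s
          ; edge∈   = rest-∈ s∈
          ; crosses = λ eq → s× (trans (sym (extend-out c γ (rest-∉ s∈))) (trans eq (extend-out c γ ¬r)))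
          ; unique  = λ e∈ cr → case crossings c γ e∈ cr of λ where
              (inj₂ old) → uniq _ old
              (inj₁ (j , j≢c , _)) → contradiction (ports j) j≢c
          }

      module OfBridge (B : Bridge rest rejoin) where
        open Bridge B renaming (side to α; side-φ to α-φ; edge to s; edge∈ to s∈)
        private module ′ = Cubic cubic

        old-unique : ∀ e → OldCrossing α e → e ≡ s ⊎ e ≡ rejoin s
        old-unique e (e∈ , ¬r , e×) = unique e∈ (λ eq → e× (trans eq (cong α (rejoin-old ¬r))))

        -- A new edge that crosses is itself the bridge of the reduced graph, which leaves no
        -- crossing for the old edges.
        port-crosses : ∀ i → α (outer i) ≢ α (outer (σ i)) → ∀ e → ¬ OldCrossing α e
        port-crosses i i× e old
          with unique (outer∈ i) (λ eq → i× (trans eq (cong α (rejoin-outer i)))) | old-unique e old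
        ... | inj₁ refl | inj₁ refl = outer-¬old {α} i old
        ... | inj₁ refl | inj₂ refl = outer-¬old {α} (σ i) (subst (OldCrossing α) (rejoin-outer i) old)
        ... | inj₂ eq   | inj₂ refl = outer-¬old {α} i (subst (OldCrossing α) (sym eq) old)
        ... | inj₂ eq   | inj₁ refl = outer-¬old {α} (σ i) (subst (OldCrossing α) s≡ old)
          where
          s≡ : s ≡ outer (σ i)
          s≡ = trans (sym (′.rev-rev s∈)) (trans (cong rejoin (sym eq)) (rejoin-outer i))

        old-edge : (∀ i → α (outer i) ≡ α (outer (σ i))) →
                   OldCrossing α s × (∀ e → OldCrossing α e → e ≡ s ⊎ e ≡ rev s)
        old-edge agree with view s∈
        ... | inj₁ (i , refl) = contradiction (trans (agree i) (cong α (sym (rejoin-outer i)))) crosses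
        ... | inj₂ ¬r = (s∈ , ¬r , (λ eq → crosses (trans eq (cong α (sym (rejoin-old ¬r)))))) ,
          λ e old → [ inj₁ , (λ eq → inj₂ (trans eq (rejoin-old ¬r))) ]′ (old-unique e old)

        ports-cross-once : ∀ i j → α (outer i) ≢ α (outer (σ i)) → α (outer j) ≢ α (outer (σ j)) →
                           j ≡ i ⊎ j ≡ σ i
        ports-cross-once i j i× j×
          with unique (outer∈ i) (λ eq → i× (trans eq (cong α (rejoin-outer i))))
             | unique (outer∈ j) (λ eq → j× (trans eq (cong α (rejoin-outer j))))
        ... | inj₁ oi≡s  | inj₁ oj≡s  = inj₁ (outer-injective (trans oj≡s (sym oi≡s)))
        ... | inj₂ oi≡rs | inj₂ oj≡rs = inj₁ (outer-injective (trans oj≡rs (sym oi≡rs)))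
        ... | inj₁ refl  | inj₂ oj≡rs = inj₂ (outer-injective (trans oj≡rs (rejoin-outer i)))
        ... | inj₂ oi≡rs | inj₁ refl  =
          inj₂ (trans (sym (σσ j)) (cong σ (sym (outer-injective (trans oi≡rs (rejoin-outer j))))))

    -- The case of three parallel edges: nothing leaves the two removed vertices, so `Rejoin` is
    -- used with no ports and every bridge of the rest is an old one.
    module _ (closed : ∀ {x} → Removed x → Removed (rev x)) where

      private
        no-port : {P : Fin 0 → Set} (i : Fin 0) → P i
        no-port ()

        no-inner : Fin 0 → X
        no-inner ()

        no-inner-injective : ∀ {i j} → no-inner i ≡ no-inner j → i ≡ j
        no-inner-injective {()}

        open Rejoin no-inner no-inner-injective no-port no-port (λ r ¬r → contradiction (closed r) ¬r) id no-port no-port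

      closed-cubic : Cubic rest rejoin
      closed-cubic = cubic

      closed-bridgeless : ¬ Bridge rest rejoin
      closed-bridgeless B with OfBridge.old-edge B no-port
      ... | s-old , s-unique = no-odd-old (Bridge.side-φ B) false _ no-port s-old s-unique

    private
      d₀∉ᵉ : ∀ {x} → In d₀ d₁ d₂ x → ¬ In e₀ e₁ e₂ x
      d₀∉ᵉ i j = e₀∉ᵈ (meet oᵉ i j)
        where
        meet : Orbit e₀ e₁ e₂ → ∀ {x} → In d₀ d₁ d₂ x → In e₀ e₁ e₂ x → In d₀ d₁ d₂ e₀
        meet _ i (inj₁ refl) = i
        meet (inj₁ (refl , _ , _)) i at₁ = In-φ⁻ oᵈ i
        meet (inj₂ (_ , _ , p)) i at₁ = subst (In d₀ d₁ d₂) p (In-φ oᵈ i)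
        meet (inj₁ (_ , _ , p)) i at₂ = subst (In d₀ d₁ d₂) p (In-φ oᵈ i)
        meet (inj₂ (refl , _ , _)) i at₂ = In-φ⁻ oᵈ i
        e₀∉ᵈ : ¬ In d₀ d₁ d₂ e₀
        e₀∉ᵈ (inj₁ e₀≡d₀) = rev≢ d₀∈ (trans rd₀ e₀≡d₀)
        e₀∉ᵈ (inj₂ (inj₁ e₀≡d₁)) = loopless C noBridge oᵈ d₀∈ (trans rd₀ e₀≡d₁)
        e₀∉ᵈ (inj₂ (inj₂ e₀≡d₂)) = loopless C noBridge (Orbit-swap oᵈ) d₀∈ (trans rd₀ e₀≡d₂)

    d≢e : ∀ {x y} → In d₀ d₁ d₂ x → In e₀ e₁ e₂ y → x ≢ y
    d≢e i j refl = d₀∉ᵉ i j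

    rev-flip : ∀ {x y} → Removed x → rev x ≡ y → rev y ≡ x
    rev-flip r eq = trans (cong rev (sym eq)) (rev-rev (Removed-∈ r))

    private
      hub : X → Bool
      hub x = does (x ≟ₓ d₀) ∨ does (x ≟ₓ e₀)

      hub-d₀ : hub d₀ ≡ true
      hub-d₀ = cong (_∨ does (d₀ ≟ₓ e₀)) (dec-true (d₀ ≟ₓ d₀) refl)

      hub-e₀ : hub e₀ ≡ true
      hub-e₀ = trans (cong (does (e₀ ≟ₓ d₀) ∨_) (dec-true (e₀ ≟ₓ e₀) refl)) (Bool.∨-zeroʳ _)

      hub-false : ∀ {x} → x ≢ d₀ → x ≢ e₀ → hub x ≡ false
      hub-false {x} p q = cong₂ _∨_ (dec-false (x ≟ₓ d₀) p) (dec-false (x ≟ₓ e₀) q)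

      hub-d₁ : hub d₁ ≡ false
      hub-d₁ = hub-false (≢-sym (Orbit-≢ oᵈ)) (d≢e at₁ (inj₁ refl))

      hub-d₂ : hub d₂ ≡ false
      hub-d₂ = hub-false (≢-sym (Orbit-≢ (Orbit-swap oᵈ))) (d≢e at₂ (inj₁ refl))

      hub-e₁ : hub e₁ ≡ false
      hub-e₁ = hub-false (≢-sym (d≢e (inj₁ refl) at₁)) (≢-sym (Orbit-≢ oᵉ))

      hub-e₂ : hub e₂ ≡ false
      hub-e₂ = hub-false (≢-sym (d≢e (inj₁ refl) at₂)) (≢-sym (Orbit-≢ (Orbit-swap oᵉ)))

      hub-rev : ∀ {x} → Removed x → hub (rev x) ≡ hub x
      hub-rev {x} r = trans (cong₂ _∨_
          (does-⇔ (mk⇔ (λ p → sym (trans (sym rd₀) (rev-flip r p))) (λ { refl → re₀ })) (rev x ≟ₓ d₀) (x ≟ₓ e₀))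
          (does-⇔ (mk⇔ (λ p → sym (trans (sym re₀) (rev-flip r p))) (λ { refl → rd₀ })) (rev x ≟ₓ e₀) (x ≟ₓ d₀)))
        (Bool.∨-comm (does (x ≟ₓ e₀)) (does (x ≟ₓ d₀)))

    -- When no cut edge is matched, the removed edge alone covers both removed vertices, and neither
    -- `d₁` nor `d₂` is used, whichever of them is to be avoided.
    lift-hub : ∀ {rev′} (M′ : PerfectMatching rest rev′) →
      (∀ {x} → Removed x → ¬ Removed (rev x) → matched M′ (rev x) ≡ false × x ≢ d₀ × x ≢ e₀) →
      (∀ {x} → ¬ Removed (rev x) → rev′ x ≡ rev x) →
      Σ[ N ∈ PerfectMatching L rev ] matched N d₁ ≡ false × matched N d₂ ≡ false
    lift-hub M′ in-out out-out =
      proj₁ N , trans (proj₂ N (inj₁ at₁)) hub-d₁ , trans (proj₂ N (inj₁ at₂)) hub-d₂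
      where
      one : ∀ {a b c} → a ≡ true → b ≡ false → c ≡ false → ExactlyOne a b c
      one refl refl refl = first
      N = lift-matching M′ hub (one hub-d₀ hub-d₁ hub-d₂) (one hub-e₀ hub-e₁ hub-e₂)
        (λ r _ → hub-rev r)
        (λ r ¬r → let p , q , q′ = in-out r ¬r in trans p (sym (hub-false q q′)))
        (λ _ rx∈ → out-out (rest-∉ rx∈))

    -- The case of a double edge: one cut edge remains at each removed vertex, and a single new edge
    -- replaces the path through both.
    module TwoPorts (rd₁ : rev d₁ ≡ e₁) (kd : ¬ Removed (rev d₂)) (ke : ¬ Removed (rev e₂)) where

      inner₂ : Fin 2 → X
      inner₂ 0F = d₂
      inner₂ 1F = e₂

      private
        inj : ∀ {i j} → inner₂ i ≡ inner₂ j → i ≡ j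
        inj {0F} {0F} _ = refl
        inj {0F} {1F} p = contradiction p (d≢e at₂ at₂)
        inj {1F} {0F} p = contradiction (sym p) (d≢e at₂ at₂)
        inj {1F} {1F} _ = refl

        removed : ∀ i → Removed (inner₂ i)
        removed 0F = inj₁ at₂
        removed 1F = inj₂ at₂

        kept : ∀ i → ¬ Removed (rev (inner₂ i))
        kept 0F = kd
        kept 1F = ke

        complete : ∀ {x} → Removed x → ¬ Removed (rev x) → ∃[ i ] x ≡ inner₂ i
        complete (inj₁ (inj₁ refl)) ¬r = contradiction (inj₂ (inj₁ rd₀)) ¬r
        complete (inj₁ at₁) ¬r = contradiction (inj₂ (inj₂ (inj₁ rd₁))) ¬r
        complete (inj₁ at₂) ¬r = 0F , refl
        complete at₁ ¬r = contradiction (inj₁ (inj₁ re₀)) ¬r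
        complete (inj₂ at₁) ¬r =
          contradiction (inj₁ (inj₂ (inj₁ (rev-flip (inj₁ at₁) rd₁)))) ¬r
        complete (inj₂ at₂) ¬r = 1F , refl

        σ : Fin 2 → Fin 2
        σ 0F = 1F
        σ 1F = 0F

        σσ : ∀ i → σ (σ i) ≡ i
        σσ 0F = refl
        σσ 1F = refl

        σ≢ : ∀ i → σ i ≢ i
        σ≢ 0F ()
        σ≢ 1F ()

      open Rejoin inner₂ inj removed kept complete σ σσ σ≢ public

      bridgeless₂ : ¬ Bridge rest rejoin
      bridgeless₂ B with Bridge.side B (outer 0F) Bool.≟ Bridge.side B (outer 1F)
      ... | yes eq = no-odd-old (Bridge.side-φ B) (Bridge.side B (outer 1F)) _
            (λ { 0F → eq ; 1F → refl }) (proj₁ old) (proj₂ old)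
        where old = OfBridge.old-edge B λ { 0F → eq ; 1F → sym eq }
      ... | no neq = no-odd-port (Bridge.side-φ B) (Bridge.side B (outer 1F)) 0F neq
            (λ { 0F j≢i → contradiction refl j≢i ; 1F _ → refl }) (OfBridge.port-crosses B 0F neq)

      lift₂ : (M′ : PerfectMatching rest rejoin) → matched M′ (outer 0F) ≡ false →
              Σ[ N ∈ PerfectMatching L rev ] matched N d₁ ≡ false × matched N d₂ ≡ false
      lift₂ M′ avoids = lift-hub M′ in-out rejoin-old
        where
        outer-avoids : ∀ i → matched M′ (outer i) ≡ false
        outer-avoids 0F = avoids
        outer-avoids 1F = trans (cong (matched M′) (sym (rejoin-outer 0F))) (trans (m-rev M′ (outer∈ 0F)) avoids)
        in-out : ∀ {x} → Removed x → ¬ Removed (rev x) → matched M′ (rev x) ≡ false × x ≢ d₀ × x ≢ e₀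
        in-out r ¬r with complete r ¬r
        ... | i , refl = outer-avoids i ,
          (λ p → ¬r (inj₂ (inj₁ (trans (cong rev p) rd₀)))) , (λ p → ¬r (inj₁ (inj₁ (trans (cong rev p) re₀))))

    module FourPorts
      (kd₁ : ¬ Removed (rev d₁)) (kd₂ : ¬ Removed (rev d₂))
      (ke₁ : ¬ Removed (rev e₁)) (ke₂ : ¬ Removed (rev e₂)) where

      inner₄ : Fin 4 → X
      inner₄ = lookup (d₁ ∷ d₂ ∷ e₁ ∷ e₂ ∷ [])

      private
        removed : ∀ i → Removed (inner₄ i)
        removed 0F = inj₁ at₁
        removed 1F = inj₁ at₂
        removed 2F = inj₂ at₁
        removed 3F = inj₂ at₂

        inj : ∀ {i j} → inner₄ i ≡ inner₄ j → i ≡ j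
        inj = lookup-injective
          ( (Orbit-≢ (Orbit-rotate oᵈ) ∷ d≢e at₁ at₁ ∷ d≢e at₁ at₂ ∷ [])
          ∷ (d≢e at₂ at₁ ∷ d≢e at₂ at₂ ∷ [])
          ∷ (Orbit-≢ (Orbit-rotate oᵉ) ∷ [])
          ∷ [] ∷ [])

        kept : ∀ i → ¬ Removed (rev (inner₄ i))
        kept 0F = kd₁
        kept 1F = kd₂
        kept 2F = ke₁
        kept 3F = ke₂

        complete : ∀ {x} → Removed x → ¬ Removed (rev x) → ∃[ i ] x ≡ inner₄ i
        complete (inj₁ (inj₁ refl)) ¬r = contradiction (inj₂ (inj₁ rd₀)) ¬r
        complete (inj₁ at₁) ¬r = 0F , refl
        complete (inj₁ at₂) ¬r = 1F , refl
        complete at₁ ¬r = contradiction (inj₁ (inj₁ re₀)) ¬r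
        complete (inj₂ at₁) ¬r = 2F , refl
        complete (inj₂ at₂) ¬r = 3F , refl

      module Pairing (σ : Fin 4 → Fin 4) (σσ : ∀ i → σ (σ i) ≡ i) (σ≢ : ∀ i → σ i ≢ i)
        (ports : ∀ i j → j ≡ i ⊎ j ≡ σ i ⊎ j ≡ flip₄ i ⊎ j ≡ σ (flip₄ i))
        (flip≢ : ∀ i → flip₄ i ≢ i × flip₄ i ≢ σ i) where

        open Rejoin inner₄ inj removed kept complete σ σσ σ≢ public

        -- The new edge at port 0 is unmatched, so neither of the cut edges that it replaces is
        -- used. If the other new edge is matched, its two cut edges cover the removed vertices;
        -- otherwise the removed edge does. Hence the value `not m` on the latter.
        lift₄ : (σ 0F ≡ 2F × σ 1F ≡ 3F) ⊎ (σ 0F ≡ 3F × σ 1F ≡ 2F) →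
                (M′ : PerfectMatching rest rejoin) → matched M′ (outer 0F) ≡ false →
                Σ[ N ∈ PerfectMatching L rev ] matched N d₁ ≡ false
        lift₄ σ-ends M′ avoids = proj₁ N , trans (proj₂ N (removed 0F)) (trans (val-inner 0F) avoids)
          where
          m = matched M′ (outer 1F)
          val : X → Bool
          val x = if hub x then not m else matched M′ (rev x)
          val-hub : ∀ {x} → hub x ≡ true → val x ≡ not m
          val-hub {x} p = cong (if_then not m else matched M′ (rev x)) p
          val-inner : ∀ i → val (inner₄ i) ≡ matched M′ (outer i)
          val-inner i = cong (if_then not m else matched M′ (outer i)) (inner-hub i)
            where
            inner-hub : ∀ i → hub (inner₄ i) ≡ false
            inner-hub 0F = hub-d₁
            inner-hub 1F = hub-d₂
            inner-hub 2F = hub-e₁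
            inner-hub 3F = hub-e₂
          m-σ : ∀ i {j} → σ i ≡ j → matched M′ (outer j) ≡ matched M′ (outer i)
          m-σ i refl = trans (cong (matched M′) (sym (rejoin-outer i))) (m-rev M′ (outer∈ i))
          one-d : ∀ {a b c} → a ≡ not c → b ≡ false → ExactlyOne a b c
          one-d {c = true}  refl refl = third
          one-d {c = false} refl refl = first
          in-in : ∀ {x} → Removed x → Removed (rev x) → val (rev x) ≡ val x
          in-in (inj₁ (inj₁ refl)) _ = trans (cong val rd₀) (trans (val-hub hub-e₀) (sym (val-hub hub-d₀)))
          in-in at₁ _ = trans (cong val re₀) (trans (val-hub hub-d₀) (sym (val-hub hub-e₀)))
          in-in (inj₁ at₁) r = contradiction r kd₁
          in-in (inj₁ at₂) r = contradiction r kd₂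
          in-in (inj₂ at₁) r = contradiction r ke₁
          in-in (inj₂ at₂) r = contradiction r ke₂
          in-out : ∀ {x} → Removed x → ¬ Removed (rev x) → matched M′ (rev x) ≡ val x
          in-out r ¬r with complete r ¬r
          ... | i , refl = sym (val-inner i)
          one-e : (σ 0F ≡ 2F × σ 1F ≡ 3F) ⊎ (σ 0F ≡ 3F × σ 1F ≡ 2F) → ExactlyOne (val e₀) (val e₁) (val e₂)
          one-e (inj₁ (p , q)) = one-d
            (trans (val-hub hub-e₀) (cong not (sym (trans (val-inner 3F) (m-σ 1F q)))))
            (trans (val-inner 2F) (trans (m-σ 0F p) avoids))
          one-e (inj₂ (p , q)) = swap₂₃ (one-d
            (trans (val-hub hub-e₀) (cong not (sym (trans (val-inner 2F) (m-σ 1F q)))))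
            (trans (val-inner 3F) (trans (m-σ 0F p) avoids)))
          N = lift-matching M′ val
            (one-d (trans (val-hub hub-d₀) (cong not (sym (val-inner 1F)))) (trans (val-inner 0F) avoids))
            (one-e σ-ends) in-in in-out (λ _ rx∈ → rejoin-old (rest-∉ rx∈))

        module Cut (B : Bridge rest rejoin) where
          open Bridge B public using () renaming (side to α; side-φ to α-φ; edge to s)
          open OfBridge B

          -- Only one new edge can cross. If one did, it would be the bridge, and the four loose
          -- ends would split three against one; the odd one would then sit on a bridge of the
          -- original graph.
          agree : ∀ i → α (outer i) ≡ α (outer (σ i))
          agree i with α (outer i) Bool.≟ α (outer (σ i)) | α (outer (flip₄ i)) Bool.≟ α (outer (σ (flip₄ i)))
          ... | yes eq | _ = eq
          ... | no i× | no j× = contradiction (ports-cross-once i (flip₄ i) i× j×)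
            [ proj₁ (flip≢ i) , proj₂ (flip≢ i) ]′
          ... | no i× | yes eq with α (outer i) Bool.≟ α (outer (flip₄ i))
          ...   | no i≢c = ⊥-elim (no-odd-port α-φ (α (outer (flip₄ i))) i i≢c others (port-crosses i i×))
            where
            others : ∀ j → j ≢ i → α (outer j) ≡ α (outer (flip₄ i))
            others j j≢i with ports i j
            ... | inj₁ p                  = contradiction p j≢i
            ... | at₁        = ≢⇒≡ (≢-sym i×) (≢-sym i≢c)
            ... | inj₂ at₁ = refl
            ... | inj₂ at₂ = sym eq
          ...   | yes i≡c = ⊥-elim (no-odd-port α-φ (α (outer (flip₄ i))) (σ i) (λ p → i× (trans i≡c (sym p))) others
            (port-crosses i i×))
            where
            others : ∀ j → j ≢ σ i → α (outer j) ≡ α (outer (flip₄ i))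
            others j j≢i with ports i j
            ... | inj₁ refl               = i≡c
            ... | inj₂ (inj₁ p)           = contradiction p j≢i
            ... | inj₂ at₁ = refl
            ... | inj₂ at₂ = sym eq

          s-old : OldCrossing α s
          s-old = proj₁ (old-edge agree)

          s-unique : ∀ e → OldCrossing α e → e ≡ s ⊎ e ≡ rev s
          s-unique = proj₂ (old-edge agree)

          -- Otherwise `agree` puts all four loose ends on one side, and the bridge of the reduced
          -- graph is already a bridge of the original one.
          differ : α (outer 0F) ≢ α (outer 1F)
          differ eq = no-odd-old α-φ (α (outer 0F)) s same s-old s-unique
            where
            same : ∀ j → α (outer j) ≡ α (outer 0F)
            same j with ports 0F j
            ... | inj₁ refl               = refl
            ... | at₁        = sym (agree 0F)
            ... | inj₂ at₁ = sym eq
            ... | inj₂ at₂ = trans (sym (agree 1F)) (sym eq)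

      module P₁ = Pairing σ₁ σ₁σ₁ σ₁≢ ports₁ flip≢₁
      module P₂ = Pairing σ₂ σ₂σ₂ σ₂≢ ports₂ flip≢₂

      -- The two cuts meet in four quadrants with one outer end each; since
      -- each cut has one old edge, some quadrant meets neither of these.
      frink : Bridge rest P₁.rejoin → ¬ Bridge rest P₂.rejoin
      frink B₁ B₂ = free (C₂.β s Bool.≟ C₂.β (rev s))
        where
        open P₁ using (outer; OldCrossing)
        module C₁ = P₁.Cut B₁
        module C₂ where
          open P₂.Cut B₂ public renaming (α to β; α-φ to β-φ; s to r; s-old to r-old; s-unique to r-unique)
        open C₁ using (α; s; s-old; s-unique)
        open C₂ using (β; r; r-old; r-unique)

        Avoids : Bool → Bool → X → Set
        Avoids A B x = ¬ (α x ≡ A × β x ≡ B)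

        α-ports : ∀ i → α (outer i) ≡ side₁ (α (outer 0F)) i
        α-ports 0F = refl
        α-ports 1F = ¬-not (≢-sym C₁.differ)
        α-ports 2F = sym (C₁.agree 0F)
        α-ports 3F = trans (sym (C₁.agree 1F)) (α-ports 1F)

        β-ports : ∀ i → β (outer i) ≡ side₂ (β (outer 0F)) i
        β-ports 0F = refl
        β-ports 1F = ¬-not (≢-sym C₂.differ)
        β-ports 2F = trans (sym (C₂.agree 1F)) (β-ports 1F)
        β-ports 3F = sym (C₂.agree 0F)

        rs : rev (rev s) ≡ s
        rs = rev-rev (rest-∈ (proj₁ s-old))

        rr : rev (rev r) ≡ r
        rr = rev-rev (rest-∈ (proj₁ r-old))

        free-quadrant : ∀ A B → Avoids A B s → Avoids A B (rev s) → Avoids A B r → Avoids A B (rev r) → ⊥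
        free-quadrant A B as ars ar arr with quadrants (α (outer 0F)) (β (outer 0F)) A B
        ... | i , αi , βi , others =
          P₁.no-odd-port γ-φ false i (λ eq → contradiction (trans (sym γi) eq) λ ()) γj none
          where
          γ? : ∀ x → Dec (α x ≡ A × β x ≡ B)
          γ? x = (α x Bool.≟ A) ×-dec (β x Bool.≟ B)
          γ : X → Bool
          γ x = does (γ? x)
          γ-φ : ∀ x → γ (φ x) ≡ γ x
          γ-φ x = cong₂ (λ a b → does (a Bool.≟ A) ∧ does (b Bool.≟ B)) (C₁.α-φ x) (C₂.β-φ x)
          γi : γ (outer i) ≡ true
          γi = dec-true (γ? (outer i)) (trans (α-ports i) αi , trans (β-ports i) βi)
          γj : ∀ j → j ≢ i → γ (outer j) ≡ false
          γj j j≢i = dec-false (γ? (outer j))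
            λ (p , q) → others j j≢i (trans (sym (α-ports j)) p , trans (sym (β-ports j)) q)
          avoid : ∀ {e} → Avoids A B e → Avoids A B (rev e) → γ e ≡ γ (rev e)
          avoid {e} a b = trans (dec-false (γ? e) a) (sym (dec-false (γ? (rev e)) b))
          none : ∀ e → ¬ OldCrossing γ e
          none e (e∈ , ¬r , e×) with α e Bool.≟ α (rev e) | β e Bool.≟ β (rev e)
          ... | yes p | yes q = e× (cong₂ (λ a b → does (a Bool.≟ A) ∧ does (b Bool.≟ B)) p q)
          ... | no p | _ with s-unique e (e∈ , ¬r , p)
          ...   | inj₁ refl = e× (avoid as ars)
          ...   | inj₂ refl = e× (avoid ars (subst (Avoids A B) (sym rs) as))
          none e (e∈ , ¬r , e×) | yes _ | no q with r-unique e (e∈ , ¬r , q)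
          ...   | inj₁ refl = e× (avoid ar arr)
          ...   | inj₂ refl = e× (avoid arr (subst (Avoids A B) (sym rr) ar))

        free : Dec (β s ≡ β (rev s)) → ⊥
        free (no s×) with r-unique s (proj₁ s-old , proj₁ (proj₂ s-old) , s×)
        -- Here `s` and `r` are one edge, which crosses both cuts: its ends lie in opposite
        -- quadrants, and a quadrant next to them is free.
        ... | inj₁ refl = free-quadrant (α s) (not (β s)) av av′ av av′
          where
          av : Avoids (α s) (not (β s)) s
          av (_ , q) = not-¬ refl q
          av′ : Avoids (α s) (not (β s)) (rev s)
          av′ (p , _) = proj₂ (proj₂ s-old) (sym p)
        ... | inj₂ refl = free-quadrant (α s) (not (β s)) av av′ (subst (Avoids (α s) (not (β s))) rr av′) av
          where
          av : Avoids (α s) (not (β s)) s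
          av (_ , q) = not-¬ refl q
          av′ : Avoids (α s) (not (β s)) (rev s)
          av′ (p , _) = proj₂ (proj₂ s-old) (sym p)
        free (yes βs) with α r Bool.≟ α (rev r)
        -- Both ends of `s` lie on one side of `β` and both ends of `r` on one side of `α`, so the
        -- quadrant on the other side of each avoids all four.
        ... | yes αr = free-quadrant (not (α r)) (not (β s))
          (λ (_ , q) → not-¬ refl q) (λ (_ , q) → not-¬ (sym βs) q)
          (λ (p , _) → not-¬ refl p) (λ (p , _) → not-¬ (sym αr) p)
        ... | no αr with s-unique r (proj₁ r-old , proj₁ (proj₂ r-old) , αr)
        ...   | inj₁ refl = proj₂ (proj₂ r-old) βs
        ...   | inj₂ refl = proj₂ (proj₂ r-old) (trans (sym βs) (cong β (sym rs)))

  -- The strengthening that carries the induction: in the reduced graph, the edge to be avoided can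
  -- be chosen as one of the new edges, which excludes the matchings that do not lift.
  Avoiding : (L : List X) (rev : X → X) → X → Set
  Avoiding L rev e = Σ[ M ∈ PerfectMatching L rev ] matched M e ≡ false

  private
    Petersen : List X → Set
    Petersen L = ∀ {rev} → Cubic L rev → ¬ Bridge L rev → ∀ {e} → e ∈ L → ¬ ¬ Avoiding L rev e

    some-matching : ∀ {L rev} → Petersen L → Cubic L rev → ¬ Bridge L rev → ¬ ¬ PerfectMatching L rev
    some-matching {[]} P C nb k = k record { matched = λ _ → true ; m-rev = λ () ; m-one = λ () }
    some-matching {x ∷ L} P C nb k = P C nb (here refl) (k ∘ proj₁)

    module Step
      {L : List X} {rev : X → X} (C : Cubic L rev) (nb : ¬ Bridge L rev)
      (IH : ∀ L′ → length L′ < length L → Petersen L′) where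

      open Cubic C

      module _ {d₀ d₁ d₂ e₀ e₁ e₂ : X} (oᵈ : Orbit d₀ d₁ d₂) (oᵉ : Orbit e₀ e₁ e₂)
        (d₀∈ : d₀ ∈ L) (rd₀ : rev d₀ ≡ e₀) where

        open Removal C nb oᵈ oᵉ d₀∈ rd₀

        private
          d₁∈ : d₁ ∈ L
          d₁∈ = Removed-∈ (inj₁ at₁)

          d₂∈ : d₂ ∈ L
          d₂∈ = Removed-∈ (inj₁ at₂)

          kept-d₁ : rev d₁ ≢ e₁ → rev d₁ ≢ e₂ → ¬ Removed (rev d₁)
          kept-d₁ p q = let i , j = kept-end C nb oᵈ d₀∈ rd₀ p q in [ i , j ]′

          kept-d₂ : rev d₂ ≢ e₁ → rev d₂ ≢ e₂ → ¬ Removed (rev d₂)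
          kept-d₂ p q = let i , j = kept-end C nb (Orbit-swap oᵈ) d₀∈ rd₀ p q in [ i ∘ In-swap , j ]′

          kept-e₁ : rev d₁ ≢ e₁ → rev d₂ ≢ e₁ → ¬ Removed (rev e₁)
          kept-e₁ p q =
            let i , j = kept-end C nb oᵉ e₀∈ re₀
                  (λ r → p (rev-flip (inj₂ at₁) r)) (λ r → q (rev-flip (inj₂ at₁) r))
            in [ j , i ]′

          kept-e₂ : rev d₁ ≢ e₂ → rev d₂ ≢ e₂ → ¬ Removed (rev e₂)
          kept-e₂ p q =
            let i , j = kept-end C nb (Orbit-swap oᵉ) e₀∈ re₀
                  (λ r → p (rev-flip (inj₂ at₂) r)) (λ r → q (rev-flip (inj₂ at₂) r))
            in [ j , i ∘ In-swap ]′

        parallel : rev d₁ ≡ e₁ →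
          ¬ ¬ (Σ[ N ∈ PerfectMatching L rev ] matched N d₁ ≡ false × matched N d₂ ≡ false)
        parallel rd₁ with rev d₂ ≟ₓ e₂
        ... | yes rd₂ = λ k → some-matching (IH rest rest-shorter) (closed-cubic closed) (closed-bridgeless closed)
          λ M′ → k (lift-hub M′ (λ r ¬r → contradiction (closed r) ¬r) (λ _ → refl))
          where
          closed : ∀ {x} → Removed x → Removed (rev x)
          closed (inj₁ (inj₁ refl))        = inj₂ (inj₁ rd₀)
          closed (inj₁ at₁) = inj₂ (inj₂ (inj₁ rd₁))
          closed (inj₁ at₂) = inj₂ (inj₂ (inj₂ rd₂))
          closed at₁        = inj₁ (inj₁ re₀)
          closed (inj₂ at₁) = inj₁ (inj₂ (inj₁ (rev-flip (inj₁ at₁) rd₁)))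
          closed (inj₂ at₂) = inj₁ (inj₂ (inj₂ (rev-flip (inj₁ at₂) rd₂)))
        ... | no rd₂ = λ k → IH rest rest-shorter cubic bridgeless₂ (outer∈ 0F)
          λ (M′ , avoids) → k (lift₂ M′ avoids)
          where
          rev-injective : ∀ {x y} → x ∈ L → y ∈ L → rev x ≡ rev y → x ≡ y
          rev-injective x∈ y∈ eq = trans (sym (rev-rev x∈)) (trans (cong rev eq) (rev-rev y∈))
          open TwoPorts rd₁
            (kept-d₂ (λ p → Orbit-≢ (Orbit-rotate oᵈ) (rev-injective d₁∈ d₂∈ (trans rd₁ (sym p)))) rd₂)
            (kept-e₂ (λ p → Orbit-≢ (Orbit-rotate oᵉ) (trans (sym rd₁) p)) rd₂)

        -- By `frink` one of the two pairings gives a bridgeless graph. Which one is left undecided,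
        -- and this is a source of the double negation.
        four : rev d₁ ≢ e₁ → rev d₁ ≢ e₂ → rev d₂ ≢ e₁ → rev d₂ ≢ e₂ → ¬ ¬ Avoiding L rev d₁
        four ≢₁₁ ≢₁₂ ≢₂₁ ≢₂₂ k = noBridge₁ λ B₁ → noBridge₂ (frink B₁)
          where
          open FourPorts (kept-d₁ ≢₁₁ ≢₁₂) (kept-d₂ ≢₂₁ ≢₂₂) (kept-e₁ ≢₁₁ ≢₂₁) (kept-e₂ ≢₁₂ ≢₂₂)
          noBridge₁ : ¬ ¬ Bridge rest P₁.rejoin
          noBridge₁ nb₁ = IH rest rest-shorter P₁.cubic nb₁ (P₁.outer∈ 0F)
            λ (M′ , avoids) → k (P₁.lift₄ (inj₁ (refl , refl)) M′ avoids)
          noBridge₂ : ¬ ¬ Bridge rest P₂.rejoin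
          noBridge₂ nb₂ = IH rest rest-shorter P₂.cubic nb₂ (P₂.outer∈ 0F)
            λ (M′ , avoids) → k (P₂.lift₄ (inj₂ (refl , refl)) M′ avoids)

      avoiding : ∀ {e} → e ∈ L → ¬ ¬ Avoiding L rev e
      -- The edge removed is that of `φ d₁`, which meets the prescribed edge `d₁` in a vertex. The
      -- four tests ask whether a second edge joins the ends of the removed one.
      avoiding {d₁} d₁∈ k with rev d₁ ≟ₓ φ (rev (φ d₁)) | rev d₁ ≟ₓ φ (φ (rev (φ d₁)))
                         | rev (φ (φ d₁)) ≟ₓ φ (rev (φ d₁)) | rev (φ (φ d₁)) ≟ₓ φ (φ (rev (φ d₁)))
      ... | yes p | _ | _ | _ = parallel (Orbit-swap (Orbit-rotate (orbit d₁))) (orbit _) (φ∈ d₁∈) refl p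
                                  λ (N , q , _) → k (N , q)
      ... | no _ | yes p | _ | _ = parallel (Orbit-swap (Orbit-rotate (orbit d₁))) (Orbit-swap (orbit _)) (φ∈ d₁∈) refl p
                                  λ (N , q , _) → k (N , q)
      ... | no _ | no _ | yes p | _ = parallel (Orbit-rotate (orbit d₁)) (orbit _) (φ∈ d₁∈) refl p
                                  λ (N , _ , q) → k (N , q)
      ... | no _ | no _ | no _ | yes p = parallel (Orbit-rotate (orbit d₁)) (Orbit-swap (orbit _)) (φ∈ d₁∈) refl p
                                  λ (N , _ , q) → k (N , q)
      ... | no p | no q | no r | no s =
        four (Orbit-swap (Orbit-rotate (orbit d₁))) (orbit _) (φ∈ d₁∈) refl p q r s k

    petersen-bounded : ∀ n L → length L < n → Petersen L
    petersen-bounded (suc n) L (s≤s L≤n) C nb =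
      Step.avoiding C nb λ L′ L′<L → petersen-bounded n L′ (ℕ.<-≤-trans L′<L L≤n)

  petersen : ∀ {L rev} → Cubic L rev → ¬ Bridge L rev → ¬ ¬ PerfectMatching L rev
  petersen {L} = some-matching (petersen-bounded (suc (length L)) L ℕ.≤-refl)

-- Inserting an edge into a plane embedding

module Insertion {n : ℕ} {G : Graph n} (E : PlaneEmbedding G) {u v : Fin n} (u≢v : u ≢ v)
                 (nonadj : ¬ Adj G u v) where
  open Embedded E

  G⁺ : Graph n
  G⁺ = addEdge G u v u≢v

  private
    T-∨ : ∀ {a b} → T (a ∨ b) → T a ⊎ T b
    T-∨ {true}  t = inj₁ t
    T-∨ {false} t = inj₂ t

    T-∨ˡ : ∀ {a b} → T a → T (a ∨ b)
    T-∨ˡ {true} t = t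

    T-∨ʳ : ∀ {a b} → T b → T (a ∨ b)
    T-∨ʳ {true}  t = _
    T-∨ʳ {false} t = t

    does-true : ∀ {P : Set} (P? : Dec P) → T (does P?) → P
    does-true (yes p) _ = p

    open import Data.List.Membership.DecPropositional (_≟ₚ_ {n}) using (_∈?_)

    joins⁻ : ∀ {x y} → T (joins [ (u , v) ] x y) → (x ≡ u × y ≡ v) ⊎ (x ≡ v × y ≡ u)
    joins⁻ {x} {y} t with T-∨ {does ((x , y) ∈? [ (u , v) ])} t
    ... | inj₁ p = case does-true ((x , y) ∈? [ (u , v) ]) p of λ { (here refl) → inj₁ (refl , refl) }
    ... | inj₂ p = case does-true ((y , x) ∈? [ (u , v) ]) p of λ { (here refl) → inj₂ (refl , refl) }

  Adj⁺-old : ∀ {x y} → Adj G x y → Adj G⁺ x y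
  Adj⁺-old = T-∨ˡ

  Adj⁺-new : Adj G⁺ u v
  Adj⁺-new = T-∨ʳ {adj G u v} (T-∨ˡ (Equivalence.from T-≡ (dec-true ((u , v) ∈? [ (u , v) ]) (here refl))))

  Adj⁺⁻ : ∀ {x y} → Adj G⁺ x y → Adj G x y ⊎ (x ≡ u × y ≡ v) ⊎ (x ≡ v × y ≡ u)
  Adj⁺⁻ {x} {y} t with T-∨ {adj G x y} t
  ... | inj₁ a = inj₁ a
  ... | inj₂ j = inj₂ (joins⁻ j)

  -- A normal form for the darts of `G⁺`, whose adjacency proofs do not display whether the edge is
  -- new; rotation and walks can then be treated by cases.
  data Dart⁺ : Set where
    old   : Dart G → Dart⁺
    uv vu : Dart⁺

  tail⁺ : Dart⁺ → Fin n
  tail⁺ (old d) = tail d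
  tail⁺ uv      = u
  tail⁺ vu      = v

  rev⁺ : Dart⁺ → Dart⁺
  rev⁺ (old d) = old (reverse d)
  rev⁺ uv      = vu
  rev⁺ vu      = uv

  embed : Dart⁺ → Dart G⁺
  embed (old d) = dart (tail d) (head d) (Adj⁺-old (adjacent d))
  embed uv      = dart u v Adj⁺-new
  embed vu      = dart v u (Adj-sym {G = G⁺} Adj⁺-new)

  view : Dart G⁺ → Dart⁺
  view (dart x y p) with Adj⁺⁻ p
  ... | inj₁ a        = old (dart x y a)
  ... | inj₂ (inj₁ _) = uv
  ... | inj₂ (inj₂ _) = vu

  embed-view : ∀ d → embed (view d) ≡ d
  embed-view (dart x y p) with Adj⁺⁻ p
  ... | inj₁ a                    = dart-≡ refl refl
  ... | inj₂ (inj₁ (refl , refl)) = dart-≡ refl refl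
  ... | inj₂ (inj₂ (refl , refl)) = dart-≡ refl refl

  view-old : ∀ d → view (embed (old d)) ≡ old d
  view-old d with Adj⁺⁻ (Adj⁺-old (adjacent d))
  ... | inj₁ a                    = cong old (dart-≡ refl refl)
  ... | inj₂ (inj₁ (refl , refl)) = contradiction (adjacent d) nonadj
  ... | inj₂ (inj₂ (refl , refl)) = contradiction (Adj-sym {G = G} (adjacent d)) nonadj

  view-uv : view (embed uv) ≡ uv
  view-uv with Adj⁺⁻ Adj⁺-new
  ... | inj₁ a              = contradiction a nonadj
  ... | inj₂ (inj₁ _)       = refl
  ... | inj₂ (inj₂ (p , _)) = contradiction p u≢v

  view-vu : view (embed vu) ≡ vu
  view-vu with Adj⁺⁻ (Adj-sym {G = G⁺} Adj⁺-new)
  ... | inj₁ a              = contradiction (Adj-sym {G = G} a) nonadj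
  ... | inj₂ (inj₁ (p , _)) = contradiction (sym p) u≢v
  ... | inj₂ (inj₂ _)       = refl

  view-embed : ∀ x → view (embed x) ≡ x
  view-embed (old d) = view-old d
  view-embed uv      = view-uv
  view-embed vu      = view-vu

  tail-embed : ∀ x → tail (embed x) ≡ tail⁺ x
  tail-embed (old d) = refl
  tail-embed uv      = refl
  tail-embed vu      = refl

  tail-view : ∀ d → tail⁺ (view d) ≡ tail d
  tail-view d = trans (sym (tail-embed (view d))) (cong tail (embed-view d))

  reverse-embed : ∀ x → reverse (embed x) ≡ embed (rev⁺ x)
  reverse-embed (old d) = dart-≡ refl refl
  reverse-embed uv      = dart-≡ refl refl
  reverse-embed vu      = dart-≡ refl refl

  view-reverse : ∀ d → view (reverse d) ≡ rev⁺ (view d)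
  view-reverse d = trans (cong (view ∘ reverse) (sym (embed-view d)))
    (trans (cong view (reverse-embed (view d))) (view-embed (rev⁺ (view d))))

  -- The dart after which the new edge is inserted; an isolated vertex has none.
  Corner : Fin n → Set
  Corner w = (Σ[ p ∈ Dart G ] tail p ≡ w) ⊎ (∀ (d : Dart G) → tail d ≢ w)

  At : ∀ {w} → Corner w → Dart G → Set
  At (inj₁ (p , _)) d = d ≡ p
  At (inj₂ _)       d = ⊥

  At? : ∀ {w} (c : Corner w) d → Dec (At c d)
  At? (inj₁ (p , _)) d = d ≟ᵈ p
  At? (inj₂ _)       d = no λ ()

  At-tail : ∀ {w} (c : Corner w) {d} → At c d → tail d ≡ w
  At-tail (inj₁ (p , eq)) refl = eq

  after : ∀ {w} → Corner w → Dart⁺ → Dart⁺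
  after (inj₁ (p , _)) x = old (next p)
  after (inj₂ _)       x = x

  tail-after : ∀ {w} (c : Corner w) x → tail⁺ x ≡ w → tail⁺ (after c x) ≡ w
  tail-after (inj₁ (p , eq)) x _ = trans (next-tail p) eq
  tail-after (inj₂ _)        x q = q

  module Rotation (cu : Corner u) (cv : Corner v) where

    next⁺ : Dart⁺ → Dart⁺
    next⁺ (old d) with At? cu d | At? cv d
    ... | yes _ | _     = uv
    ... | no _  | yes _ = vu
    ... | no _  | no _  = old (next d)
    next⁺ uv = after cu uv
    next⁺ vu = after cv vu

    face⁺ : Dart⁺ → Dart⁺
    face⁺ x = next⁺ (rev⁺ x)

    next⁺-u : ∀ {d} → At cu d → next⁺ (old d) ≡ uv
    next⁺-u {d} a with At? cu d
    ... | yes _ = refl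
    ... | no ¬a = contradiction a ¬a

    next⁺-v : ∀ {d} → At cv d → next⁺ (old d) ≡ vu
    next⁺-v {d} a with At? cu d | At? cv d
    ... | yes a′ | _     = contradiction (trans (sym (At-tail cu a′)) (At-tail cv a)) u≢v
    ... | no _   | yes _ = refl
    ... | no _   | no ¬a = contradiction a ¬a

    next⁺-old : ∀ {d} → ¬ At cu d → ¬ At cv d → next⁺ (old d) ≡ old (next d)
    next⁺-old {d} ¬a ¬b with At? cu d | At? cv d
    ... | yes a | _     = contradiction a ¬a
    ... | no _  | yes b = contradiction b ¬b
    ... | no _  | no _  = refl

    tail-next⁺ : ∀ x → tail⁺ (next⁺ x) ≡ tail⁺ x
    tail-next⁺ (old d) with At? cu d | At? cv d
    ... | yes a | _     = sym (At-tail cu a)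
    ... | no _  | yes b = sym (At-tail cv b)
    ... | no _  | no _  = next-tail d
    tail-next⁺ uv = tail-after cu uv refl
    tail-next⁺ vu = tail-after cv vu refl

    private
      after-at : ∀ {w} (c : Corner w) {d} x → At c d → after c x ≡ old (next d)
      after-at (inj₁ (p , _)) x refl = refl

      corner : ∀ {w} (c : Corner w) {d : Dart G} → tail d ≡ w → Σ[ p ∈ Dart G ] At c p
      corner (inj₁ (p , _)) _   = p , refl
      corner (inj₂ none) {d} eq = contradiction eq (none d)

      reach-old : ∀ {d e} → Reach next d e → Reach next⁺ (old d) (old e)
      reach-old ε = ε
      reach-old {d} (refl ◅ r) with At? cu d | At? cv d
      ... | yes a | _     = next⁺-u a ◅ after-at cu uv a ◅ reach-old r
      ... | no _  | yes b = next⁺-v b ◅ after-at cv vu b ◅ reach-old r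
      ... | no ¬a | no ¬b = next⁺-old ¬a ¬b ◅ reach-old r

    cyclic⁺ : ∀ x y → tail⁺ x ≡ tail⁺ y → Reach next⁺ x y
    cyclic⁺ (old d) (old e) eq = reach-old (next-cyclic d e eq)
    cyclic⁺ (old d) uv eq =
      let p , a = corner cu {d} eq in reach-old (next-cyclic d p (trans eq (sym (At-tail cu a)))) ◅◅ step (next⁺-u a)
    cyclic⁺ (old d) vu eq =
      let p , a = corner cv {d} eq in reach-old (next-cyclic d p (trans eq (sym (At-tail cv a)))) ◅◅ step (next⁺-v a)
    cyclic⁺ uv (old e) eq =
      let p , a = corner cu {e} (sym eq)
      in after-at cu uv a ◅ reach-old (next-cyclic _ e (trans (next-tail p) (trans (At-tail cu a) eq)))
    cyclic⁺ vu (old e) eq =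
      let p , a = corner cv {e} (sym eq)
      in after-at cv vu a ◅ reach-old (next-cyclic _ e (trans (next-tail p) (trans (At-tail cv a) eq)))
    cyclic⁺ uv uv eq = ε
    cyclic⁺ vu vu eq = ε
    cyclic⁺ uv vu eq = contradiction eq u≢v
    cyclic⁺ vu uv eq = contradiction (sym eq) u≢v

    private
      next′ : Dart G⁺ → Dart G⁺
      next′ d = embed (next⁺ (view d))

      reach-embed : ∀ {f⁺ : Dart⁺ → Dart⁺} {f′ : Dart G⁺ → Dart G⁺} → (∀ d → f′ d ≡ embed (f⁺ (view d))) →
                    ∀ {x y} → Reach f⁺ x y → Reach f′ (embed x) (embed y)
      reach-embed eq ε = ε
      reach-embed {f⁺} eq {x} (refl ◅ r) = trans (eq (embed x)) (cong (embed ∘ f⁺) (view-embed x)) ◅ reach-embed eq r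

      reach-view : ∀ {f⁺ : Dart⁺ → Dart⁺} {f′ : Dart G⁺ → Dart G⁺} → (∀ d → f′ d ≡ embed (f⁺ (view d))) →
                   ∀ {d e} → Reach f⁺ (view d) (view e) → Reach f′ d e
      reach-view eq r = subst₂ (Reach _) (embed-view _) (embed-view _) (reach-embed eq r)

    embedding : ∀ {w c} → HasClasses (Reach face⁺) w → HasClasses (Star (Adj G⁺)) c →
                n + (w + length (isolated G⁺)) ≡ length (edges G⁺) + 2 *ℕ c → Planar G⁺
    embedding {w} {c} W C eq = record
      { next        = next′
      ; next-tail   = λ d → trans (tail-embed (next⁺ (view d))) (trans (tail-next⁺ (view d)) (tail-view d))
      ; next-cyclic = λ d e p → reach-view (λ _ → refl)
          (cyclic⁺ (view d) (view e) (trans (tail-view d) (trans p (sym (tail-view e)))))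
      ; #walks      = w
      ; #components = c
      ; walks       = mkClasses (W.class ∘ view)
          (λ c → embed (W.member c) , trans (cong W.class (view-embed (W.member c))) (W.class-member c))
          (step-invariant (W.class ∘ view) λ { {d} refl → trans (W.∼⇒≡ (step refl)) (cong W.class (sym (face-view d))) })
          (λ p → reach-view (λ d → trans (sym (embed-view _)) (cong embed (face-view d))) (W.≡⇒∼ p))
      ; components  = C
      ; euler       = eq
      }
      where
      module W = Classes W
      face-view : ∀ d → view (next′ (reverse d)) ≡ face⁺ (view d)
      face-view d = trans (view-embed _) (cong next⁺ (view-reverse d))

  private
    extra-edge : ∀ {x y} → (x ≡ u × y ≡ v) ⊎ (x ≡ v × y ≡ u) → toℕ x < toℕ y →
                 length (edges G⁺) ≡ suc (length (edges G))
    extra-edge {x} {y} xy x<y = length-filter-extra (isEdge? G) (isEdge? G⁺) (unique-pairs n)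
      (∈-cartesianProduct⁺ (∈-allFin x) (∈-allFin y)) (λ (_ , a) → not-adj xy a) (x<y , new-adj xy)
      (λ z≢ → mk⇔ (λ (p , a) → p , Adj⁺-old a) λ (p , a) → p , ([ id , (λ q → contradiction (same xy q p) z≢) ]′ (Adj⁺⁻ a)))
      where
      not-adj : (x ≡ u × y ≡ v) ⊎ (x ≡ v × y ≡ u) → ¬ Adj G x y
      not-adj (inj₁ (refl , refl)) a = nonadj a
      not-adj (inj₂ (refl , refl)) a = nonadj (Adj-sym {G = G} a)
      new-adj : (x ≡ u × y ≡ v) ⊎ (x ≡ v × y ≡ u) → Adj G⁺ x y
      new-adj (inj₁ (refl , refl)) = Adj⁺-new
      new-adj (inj₂ (refl , refl)) = Adj-sym {G = G⁺} Adj⁺-new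
      same : ∀ {a b} → (x ≡ u × y ≡ v) ⊎ (x ≡ v × y ≡ u) → (a ≡ u × b ≡ v) ⊎ (a ≡ v × b ≡ u) →
             toℕ a < toℕ b → (a , b) ≡ (x , y)
      same (inj₁ (refl , refl)) (inj₁ (refl , refl)) _ = refl
      same (inj₂ (refl , refl)) (inj₂ (refl , refl)) _ = refl
      same (inj₁ (refl , refl)) (inj₂ (refl , refl)) v<u = contradiction v<u (ℕ.<-asym x<y)
      same (inj₂ (refl , refl)) (inj₁ (refl , refl)) u<v = contradiction u<v (ℕ.<-asym x<y)

  length-edges⁺ : length (edges G⁺) ≡ suc (length (edges G))
  length-edges⁺ with Fin.<-cmp u v
  ... | tri< u<v _ _ = extra-edge (inj₁ (refl , refl)) u<v
  ... | tri≈ _ u≡v _ = contradiction u≡v u≢v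
  ... | tri> _ _ v<u = extra-edge (inj₂ (refl , refl)) v<u

  private
    Isolated : Graph n → Fin n → Set
    Isolated H x = ∀ y → ¬ Adj H x y

    isolated? : (H : Graph n) → ∀ x → Dec (Isolated H x)
    isolated? H x = all? (λ y → ¬? (Adj? H x y))

    isolated⁺ : ¬ Isolated G v → ∀ {x} → x ≢ u → Isolated G⁺ x ⇔ Isolated G x
    isolated⁺ ¬v x≢u = mk⇔ (λ i y a → i y (Adj⁺-old a)) λ i y a → case Adj⁺⁻ a of λ where
      (inj₁ b)                 → i y b
      (inj₂ (inj₁ (x≡u , _)))  → x≢u x≡u
      (inj₂ (inj₂ (refl , _))) → ¬v i

    same-isolated : ¬ Isolated G u → ¬ Isolated G v → length (isolated G⁺) ≡ length (isolated G)
    same-isolated ¬u ¬v = cong length (filter-cong-∈ (isolated? G⁺) (isolated? G) (allFin n) λ {x} _ → case x ≟ u of λ where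
      (no x≢u)   → isolated⁺ ¬v x≢u
      (yes refl) → mk⇔ (λ i y a → i y (Adj⁺-old a)) (λ i → contradiction i ¬u))

    merged-components : ∀ {c} (C : HasClasses (Star (Adj G)) (suc c)) →
                        HasClasses.class C u ≢ HasClasses.class C v → HasClasses (Star (Adj G⁺)) c
    merged-components C u≁v = mkClasses (merge u≁v ∘ C.class)
      (λ c → let x , eq = merge-surjective u≁v c
             in C.member x , trans (cong (merge u≁v) (C.class-member x)) eq)
      (step-invariant (merge u≁v ∘ C.class) λ a → case Adj⁺⁻ a of λ where
        (inj₁ b)                    → cong (merge u≁v) (C.∼⇒≡ (b ◅ ε))
        (inj₂ (inj₁ (refl , refl))) → merge-i u≁v
        (inj₂ (inj₂ (refl , refl))) → sym (merge-i u≁v))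
      λ eq → case merge-injective u≁v eq of λ where
        (inj₁ p)             → old-path p
        (inj₂ (inj₁ (p , q))) → old-path p ◅◅ (Adj⁺-new ◅ old-path (sym q))
        (inj₂ (inj₂ (p , q))) → old-path p ◅◅ (Adj-sym {G = G⁺} Adj⁺-new ◅ old-path (sym q))
      where
      module C = Classes C
      old-path : ∀ {x y} → C.class x ≡ C.class y → Star (Adj G⁺) x y
      old-path p = Star.map Adj⁺-old (C.≡⇒∼ p)

    -- Joining two components costs one facial walk: two walks merge, or an isolated vertex gives up
    -- its trivial one. There is one more edge and one component less, so both sides of Euler's
    -- formula drop by one.
    joined-euler : ∀ {k c} → n + suc k ≡ length (edges G) + 2 *ℕ suc c → n + k ≡ length (edges G⁺) + 2 *ℕ c
    joined-euler {k} {c} eq = ℕ.suc-injective (begin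
      suc (n + k)                              ≡⟨ ℕ.+-suc n k ⟨
      n + suc k                                ≡⟨ eq ⟩
      length (edges G) + 2 *ℕ suc c            ≡⟨ cong (length (edges G) +_) (ℕ.*-suc 2 c) ⟩
      length (edges G) + suc (suc (2 *ℕ c))    ≡⟨ ℕ.+-suc _ _ ⟩
      suc (length (edges G) + suc (2 *ℕ c))    ≡⟨ cong suc (ℕ.+-suc _ _) ⟩
      suc (suc (length (edges G)) + 2 *ℕ c)    ≡⟨ cong (λ e → suc (e + 2 *ℕ c)) length-edges⁺ ⟨
      suc (length (edges G⁺) + 2 *ℕ c)         ∎)
      where open ≡-Reasoning

    component-tail : ∀ {c} (C : HasClasses (Star (Adj G)) c) {d e} → Reach face d e →
                     HasClasses.class C (tail d) ≡ HasClasses.class C (tail e)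
    component-tail C = step-invariant (HasClasses.class C ∘ tail) λ { {d} refl →
      Classes.∼⇒≡ C (subst (Star (Adj G) (tail d)) (sym (tail-face d)) (adjacent d ◅ ε)) }

  -- The walk that passes the chosen corner at `v` makes a detour along `vu` and back along `uv`.
  -- The number of proper walks is unchanged; the trivial walk of `u` is lost.
  pendant : (∀ y → ¬ Adj G u y) → (q : Dart G) → tail q ≡ v →
            Component.class u ≢ Component.class v → Planar G⁺
  pendant u-isolated q tq u≁v = build components u≁v euler
    where
    cu : Corner u
    cu = inj₂ λ { d refl → u-isolated _ (adjacent d) }
    cv : Corner v
    cv = inj₁ (q , tq)
    open Rotation cu cv
    Q : Dart G
    Q = reverse q
    cls : Dart⁺ → Fin #walks
    cls (old d) = walk d
    cls uv      = walk Q
    cls vu      = walk Q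
    face⁺-Q : face⁺ (old Q) ≡ vu
    face⁺-Q = next⁺-v (reverse-reverse q)
    face⁺-uv : face⁺ uv ≡ old (face Q)
    face⁺-uv = cong old (next≡face-reverse q)
    face⁺-old : ∀ {d} → d ≢ Q → face⁺ (old d) ≡ old (face d)
    face⁺-old d≢Q = next⁺-old id λ p → d≢Q (trans (sym (reverse-reverse _)) (cong reverse p))
    inv : ∀ x → cls x ≡ cls (face⁺ x)
    inv (old d) with d ≟ᵈ Q
    ... | yes refl = cong cls (sym face⁺-Q)
    ... | no d≢Q   = trans (sym (walk-face d)) (cong cls (sym (face⁺-old d≢Q)))
    inv uv = trans (sym (walk-face Q)) (cong cls (sym face⁺-uv))
    inv vu = refl
    reach-old : ∀ {d e} → Reach face d e → Reach face⁺ (old d) (old e)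
    reach-old ε = ε
    reach-old {d} (refl ◅ r) with d ≟ᵈ Q
    ... | yes refl = face⁺-Q ◅ refl ◅ face⁺-uv ◅ reach-old r
    ... | no d≢Q   = face⁺-old d≢Q ◅ reach-old r
    to-Q : ∀ x → cls x ≡ walk Q → Reach face⁺ x (old Q)
    to-Q (old d) eq = reach-old (Walk.≡⇒∼ eq)
    to-Q uv eq = face⁺-uv ◅ reach-old (Walk.≡⇒∼ (walk-face Q))
    to-Q vu eq = refl ◅ to-Q uv eq
    from-Q : ∀ x → cls x ≡ walk Q → Reach face⁺ (old Q) x
    from-Q (old d) eq = reach-old (Walk.≡⇒∼ (sym eq))
    from-Q uv eq = face⁺-Q ◅ step refl
    from-Q vu eq = step face⁺-Q
    reach : ∀ x y → cls x ≡ cls y → Reach face⁺ x y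
    reach (old d) (old e) eq = reach-old (Walk.≡⇒∼ eq)
    reach (old d) uv eq = to-Q (old d) eq ◅◅ from-Q uv refl
    reach (old d) vu eq = to-Q (old d) eq ◅◅ from-Q vu refl
    reach uv y eq = to-Q uv refl ◅◅ from-Q y (sym eq)
    reach vu y eq = to-Q vu refl ◅◅ from-Q y (sym eq)
    fewer-isolated : length (isolated G) ≡ suc (length (isolated G⁺))
    fewer-isolated = length-filter-extra (isolated? G⁺) (isolated? G) (Unique.allFin⁺ n) (∈-allFin u)
      (λ i → i v Adj⁺-new) u-isolated (isolated⁺ λ i → i (head q) (subst (λ x → Adj G x (head q)) tq (adjacent q)))
    build : ∀ {c} (C : HasClasses (Star (Adj G)) c) → HasClasses.class C u ≢ HasClasses.class C v →
            n + (#walks + length (isolated G)) ≡ length (edges G) + 2 *ℕ c → Planar G⁺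
    build {zero} C _ _ = case HasClasses.class C u of λ ()
    build {suc c} C u≁v eq = embedding {w = #walks}
      (mkClasses cls (λ c → old (Walk.member c) , Walk.class-member c)
        (step-invariant cls λ { {x} refl → inv x }) (λ {x} {y} → reach x y))
      (merged-components C u≁v) (joined-euler (trans (cong (n +_) (sym (ℕ.+-suc #walks _)))
        (trans (cong (λ i → n + (#walks + i)) (sym fewer-isolated)) eq)))

  -- The walks through the two corners are different because they lie in different components; the
  -- new edge leads from each into the other and makes them one.
  bridge : (p q : Dart G) → tail p ≡ u → tail q ≡ v → Component.class u ≢ Component.class v → Planar G⁺
  bridge p q tp tq u≁v = build walks components u≁v euler
    where
    cu : Corner u
    cu = inj₁ (p , tp)
    cv : Corner v
    cv = inj₁ (q , tq)
    open Rotation cu cv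
    P Q : Dart G
    P = reverse p
    Q = reverse q
    face⁺-P : face⁺ (old P) ≡ uv
    face⁺-P = next⁺-u (reverse-reverse p)
    face⁺-Q : face⁺ (old Q) ≡ vu
    face⁺-Q = next⁺-v (reverse-reverse q)
    face⁺-uv : face⁺ uv ≡ old (face Q)
    face⁺-uv = cong old (next≡face-reverse q)
    face⁺-vu : face⁺ vu ≡ old (face P)
    face⁺-vu = cong old (next≡face-reverse p)
    face⁺-old : ∀ {d} → d ≢ P → d ≢ Q → face⁺ (old d) ≡ old (face d)
    face⁺-old d≢P d≢Q = next⁺-old
      (λ p → d≢P (trans (sym (reverse-reverse _)) (cong reverse p)))
      (λ p → d≢Q (trans (sym (reverse-reverse _)) (cong reverse p)))
    P≁Q : ∀ {x} → Reach face x P → ¬ Reach face x Q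
    P≁Q r s = u≁v (begin
      Component.class u         ≡⟨ cong Component.class tp ⟨
      Component.class (tail p)  ≡⟨ Component.∼⇒≡ (adjacent p ◅ ε) ⟩
      Component.class (head p)  ≡⟨ trans (sym (component-tail components r)) (component-tail components s) ⟩
      Component.class (head q)  ≡⟨ Component.∼⇒≡ (adjacent q ◅ ε) ⟨
      Component.class (tail q)  ≡⟨ cong Component.class tq ⟩
      Component.class v         ∎)
      where open ≡-Reasoning
    -- Until they reach P or Q, walks are unchanged.
    reach-P : ∀ {d} → Reach face d P → Reach face⁺ (old d) (old P)
    reach-P ε = ε
    reach-P {d} (refl ◅ r) with d ≟ᵈ P | d ≟ᵈ Q
    ... | yes refl | _        = ε
    ... | no _     | yes refl = contradiction ε (P≁Q (refl ◅ r))
    ... | no d≢P   | no d≢Q   = face⁺-old d≢P d≢Q ◅ reach-P r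
    reach-Q : ∀ {d} → Reach face d Q → Reach face⁺ (old d) (old Q)
    reach-Q ε = ε
    reach-Q {d} (refl ◅ r) with d ≟ᵈ Q | d ≟ᵈ P
    ... | yes refl | _        = ε
    ... | no _     | yes refl = contradiction (refl ◅ r) (P≁Q ε)
    ... | no d≢Q   | no d≢P   = face⁺-old d≢P d≢Q ◅ reach-Q r
    P→Q : Reach face⁺ (old P) (old Q)
    P→Q = face⁺-P ◅ face⁺-uv ◅ reach-Q (Walk.≡⇒∼ (walk-face Q))
    Q→P : Reach face⁺ (old Q) (old P)
    Q→P = face⁺-Q ◅ face⁺-vu ◅ reach-P (Walk.≡⇒∼ (walk-face P))
    reach-old : ∀ {d e} → Reach face d e → Reach face⁺ (old d) (old e)
    reach-old ε = ε
    reach-old {d} (refl ◅ r) with d ≟ᵈ P | d ≟ᵈ Q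
    ... | yes refl | _        = P→Q ◅◅ face⁺-Q ◅ face⁺-vu ◅ reach-old r
    ... | no _     | yes refl = Q→P ◅◅ face⁺-P ◅ face⁺-uv ◅ reach-old r
    ... | no d≢P   | no d≢Q   = face⁺-old d≢P d≢Q ◅ reach-old r
    build : ∀ {w c} (W : HasClasses (Reach face) w) (C : HasClasses (Star (Adj G)) c) →
            HasClasses.class C u ≢ HasClasses.class C v →
            n + (w + length (isolated G)) ≡ length (edges G) + 2 *ℕ c → Planar G⁺
    build {zero} W _ _ _ = case HasClasses.class W P of λ ()
    build {suc w} {zero} _ C _ _ = case HasClasses.class C u of λ ()
    build {suc w} {suc c} W C u≁v eq = embedding {w = w}
      (mkClasses cls
        (λ c → let x , eq = merge-surjective cP≢cQ c
               in old (W.member x) , trans (cong (merge cP≢cQ) (W.class-member x)) eq)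
        (step-invariant cls λ { {x} refl → inv x }) (λ {x} {y} → reach x y))
      (merged-components C u≁v) (joined-euler (trans
        (cong (λ i → n + (suc w + i)) (same-isolated (not-isolated p tp) (not-isolated q tq))) eq))
      where
      module W = Classes W
      not-isolated : ∀ {w} (d : Dart G) → tail d ≡ w → ¬ Isolated G w
      not-isolated d refl i = i (head d) (adjacent d)
      cP≢cQ : W.class P ≢ W.class Q
      cP≢cQ eq = P≁Q ε (W.≡⇒∼ eq)
      m : Fin (suc w) → Fin w
      m = merge cP≢cQ
      cls : Dart⁺ → Fin w
      cls (old d) = m (W.class d)
      cls uv      = m (W.class Q)
      cls vu      = m (W.class Q)
      W-face : ∀ d → W.class d ≡ W.class (face d)
      W-face d = W.∼⇒≡ (step refl)
      inv : ∀ x → cls x ≡ cls (face⁺ x)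
      inv (old d) with d ≟ᵈ P | d ≟ᵈ Q
      ... | yes refl | _        = trans (merge-i cP≢cQ) (cong cls (sym face⁺-P))
      ... | no _     | yes refl = cong cls (sym face⁺-Q)
      ... | no d≢P   | no d≢Q   = trans (cong m (W-face d)) (cong cls (sym (face⁺-old d≢P d≢Q)))
      inv uv = trans (cong m (W-face Q)) (cong cls (sym face⁺-uv))
      inv vu = trans (sym (merge-i cP≢cQ)) (trans (cong m (W-face P)) (cong cls (sym face⁺-vu)))
      reach-merged : ∀ {d e} → m (W.class d) ≡ m (W.class e) → Reach face⁺ (old d) (old e)
      reach-merged eq with merge-injective cP≢cQ eq
      ... | inj₁ p              = reach-old (W.≡⇒∼ p)
      ... | inj₂ (inj₁ (p , q)) = reach-old (W.≡⇒∼ p) ◅◅ P→Q ◅◅ reach-old (W.≡⇒∼ (sym q))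
      ... | inj₂ (inj₂ (p , q)) = reach-old (W.≡⇒∼ p) ◅◅ Q→P ◅◅ reach-old (W.≡⇒∼ (sym q))
      reach : ∀ x y → cls x ≡ cls y → Reach face⁺ x y
      reach (old d) (old e) eq = reach-merged eq
      reach (old d) uv eq = reach-merged eq ◅◅ Q→P ◅◅ step face⁺-P
      reach (old d) vu eq = reach-merged eq ◅◅ step face⁺-Q
      reach uv (old e) eq = face⁺-uv ◅ reach-merged (trans (cong m (sym (W-face Q))) eq)
      reach vu (old e) eq = face⁺-vu ◅ reach-merged (trans (trans (cong m (sym (W-face P))) (merge-i cP≢cQ)) eq)
      reach uv uv eq = ε
      reach vu vu eq = ε
      reach uv vu eq = reach uv (old Q) refl ◅◅ step face⁺-Q
      reach vu uv eq = reach vu (old P) (sym (merge-i cP≢cQ)) ◅◅ step face⁺-P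

  -- The new edge cuts the triangle `d₁`, `d₂`, `vu` off the facial walk and leaves `uv` in place of
  -- `d₁` and `d₂`: one more edge, one more walk, the same components.
  chord : (d₁ d₂ : Dart G) → face d₁ ≡ d₂ → tail d₁ ≡ u → head d₂ ≡ v → Planar G⁺
  chord d₁ d₂ f₁ t₁ h₂ with prev d₁
  ... | p , np , tp = embedding {w = suc #walks}
    (mkClasses cls surj (step-invariant cls λ { {x} refl → inv x }) (λ {x} {y} → reach x y))
    (mkClasses Component.class
      (λ c → Component.member c , Component.class-member c)
      (step-invariant Component.class λ a → case Adj⁺⁻ a of λ where
        (inj₁ b)                    → Component.∼⇒≡ (b ◅ ε)
        (inj₂ (inj₁ (refl , refl))) → u∼v
        (inj₂ (inj₂ (refl , refl))) → sym u∼v)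
      (λ eq → Star.map Adj⁺-old (Component.≡⇒∼ eq)))
    (begin
      n + suc (#walks + length (isolated G⁺))      ≡⟨ ℕ.+-suc n _ ⟩
      suc (n + (#walks + length (isolated G⁺)))    ≡⟨ cong (λ i → suc (n + (#walks + i))) (same-isolated not-isolated-u not-isolated-v) ⟩
      suc (n + (#walks + length (isolated G)))     ≡⟨ cong suc euler ⟩
      suc (length (edges G)) + 2 *ℕ #components    ≡⟨ cong (_+ 2 *ℕ #components) length-edges⁺ ⟨
      length (edges G⁺) + 2 *ℕ #components         ∎)
    where
    open ≡-Reasoning
    -- These are the corners of the given face: `next p` is `d₁`, and `next (reverse d₂)` is `d₃`,
    -- so the chord is drawn inside it.
    cu : Corner u
    cu = inj₁ (p , trans tp t₁)
    cv : Corner v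
    cv = inj₁ (reverse d₂ , h₂)
    open Rotation cu cv
    P d₃ : Dart G
    P  = reverse p
    d₃ = face d₂
    not-isolated-u : ¬ Isolated G u
    not-isolated-u i = i (head d₁) (subst (λ x → Adj G x (head d₁)) t₁ (adjacent d₁))
    not-isolated-v : ¬ Isolated G v
    not-isolated-v i = i (tail d₂) (subst (λ x → Adj G x (tail d₂)) h₂ (adjacent (reverse d₂)))
    t₂ : tail d₂ ≡ head d₁
    t₂ = trans (cong tail (sym f₁)) (tail-face d₁)
    u∼v : Component.class u ≡ Component.class v
    u∼v = begin
      Component.class u         ≡⟨ cong Component.class t₁ ⟨
      Component.class (tail d₁) ≡⟨ Component.∼⇒≡ (adjacent d₁ ◅ ε) ⟩
      Component.class (head d₁) ≡⟨ cong Component.class t₂ ⟨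
      Component.class (tail d₂) ≡⟨ Component.∼⇒≡ (adjacent d₂ ◅ ε) ⟩
      Component.class (head d₂) ≡⟨ cong Component.class h₂ ⟩
      Component.class v         ∎
    face-P : face P ≡ d₁
    face-P = trans (sym (next≡face-reverse p)) np
    d₁≢d₂ : d₁ ≢ d₂
    d₁≢d₂ eq = tail≢head d₁ (trans (cong tail eq) t₂)
    d₃≢d₁ : d₃ ≢ d₁
    d₃≢d₁ eq = u≢v (trans (sym t₁) (trans (cong tail (sym eq)) (trans (tail-face d₂) h₂)))
    d₃≢d₂ : d₃ ≢ d₂
    d₃≢d₂ eq = d₁≢d₂ (sym (face-injective (trans eq (sym f₁))))
    InCut : Dart G → Set
    InCut d = d ≡ d₁ ⊎ d ≡ d₂
    InCut? : ∀ d → Dec (InCut d)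
    InCut? d = (d ≟ᵈ d₁) ⊎-dec (d ≟ᵈ d₂)
    P∉ : ¬ InCut P
    P∉ (inj₁ eq) = d₁≢d₂ (trans (sym face-P) (trans (cong face eq) f₁))
    P∉ (inj₂ eq) = u≢v (trans (sym (trans tp t₁)) (trans (cong head eq) h₂))
    d₃∉ : ¬ InCut d₃
    d₃∉ (inj₁ eq) = d₃≢d₁ eq
    d₃∉ (inj₂ eq) = d₃≢d₂ eq
    face⁺-P : face⁺ (old P) ≡ uv
    face⁺-P = next⁺-u (reverse-reverse p)
    face⁺-d₂ : face⁺ (old d₂) ≡ vu
    face⁺-d₂ = next⁺-v refl
    face⁺-old : ∀ {d} → d ≢ P → d ≢ d₂ → face⁺ (old d) ≡ old (face d)
    face⁺-old d≢P d≢d₂ = next⁺-old (λ q → d≢P (trans (sym (reverse-reverse _)) (cong reverse q)))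
      (λ q → d≢d₂ (reverse-injective q))
    face⁺-d₁ : face⁺ (old d₁) ≡ old d₂
    face⁺-d₁ = trans (face⁺-old (λ eq → P∉ (inj₁ (sym eq))) d₁≢d₂) (cong old f₁)
    face⁺-uv : face⁺ uv ≡ old d₃
    face⁺-uv = refl
    face⁺-vu : face⁺ vu ≡ old d₁
    face⁺-vu = cong old np
    -- Label `zero` is the triangle cut off; all other labels are those of the old walks, shifted by
    -- one.
    cls : Dart⁺ → Fin (suc #walks)
    cls (old d) = if does (InCut? d) then zero else suc (walk d)
    cls uv      = suc (walk d₁)
    cls vu      = zero
    cls-cut : ∀ {d} → InCut d → cls (old d) ≡ zero
    cls-cut {d} i = cong (if_then zero else suc (walk d)) (dec-true (InCut? d) i)
    cls-not : ∀ {d} → ¬ InCut d → cls (old d) ≡ suc (walk d)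
    cls-not {d} ¬i = cong (if_then zero else suc (walk d)) (dec-false (InCut? d) ¬i)
    face∉ : ∀ {d} → ¬ InCut d → d ≢ P → ¬ InCut (face d)
    face∉ d∉ d≢P (inj₁ eq) = d≢P (face-injective (trans eq (sym face-P)))
    face∉ d∉ d≢P (inj₂ eq) = d∉ (inj₁ (face-injective (trans eq (sym f₁))))
    walk-d₃ : walk d₃ ≡ walk d₁
    walk-d₃ = trans (walk-face d₂) (trans (cong walk (sym f₁)) (walk-face d₁))
    walk-P : walk P ≡ walk d₁
    walk-P = trans (sym (walk-face P)) (cong walk face-P)
    inv-old : ∀ d → Dec (InCut d) → Dec (d ≡ P) → cls (old d) ≡ cls (face⁺ (old d))
    inv-old d (yes (inj₁ refl)) _ = trans (cls-cut (inj₁ refl)) (sym (trans (cong cls face⁺-d₁) (cls-cut (inj₂ refl))))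
    inv-old d (yes (inj₂ refl)) _ = trans (cls-cut (inj₂ refl)) (sym (cong cls face⁺-d₂))
    inv-old d (no d∉) (yes refl) = trans (cls-not d∉) (trans (cong suc walk-P) (sym (cong cls face⁺-P)))
    inv-old d (no d∉) (no d≢P)   = trans (cls-not d∉) (sym (trans (cong cls (face⁺-old d≢P (d∉ ∘ inj₂)))
      (trans (cls-not (face∉ d∉ d≢P)) (cong suc (walk-face d)))))
    inv : ∀ x → cls x ≡ cls (face⁺ x)
    inv (old d) = inv-old d (InCut? d) (d ≟ᵈ P)
    inv uv = trans (cong suc (sym walk-d₃)) (sym (cls-not d₃∉))
    inv vu = sym (trans (cong cls face⁺-vu) (cls-cut (inj₁ refl)))
    surj : ∀ c → ∃[ x ] cls x ≡ c
    surj zero = vu , refl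
    surj (suc c) with InCut? (Walk.member c)
    ... | no d∉ = old (Walk.member c) , trans (cls-not d∉) (cong suc (Walk.class-member c))
    -- The old representative has been cut off, but the rest of its walk survives and contains `uv`.
    ... | yes (inj₁ eq) = uv , cong suc (trans (cong walk (sym eq)) (Walk.class-member c))
    ... | yes (inj₂ eq) = uv , cong suc
      (trans (sym (walk-face d₁)) (trans (cong walk (trans f₁ (sym eq))) (Walk.class-member c)))
    -- The old walk, with the cut-off darts d₁ and d₂ skipped.
    reach-old : ∀ {d e} → Reach face d e → ¬ InCut e →
                (InCut d → Reach face⁺ (old d₃) (old e)) × (¬ InCut d → Reach face⁺ (old d) (old e))
    reach-old ε e∉ = (λ i → contradiction i e∉) , λ _ → ε
    reach-old {d} {e} (refl ◅ r) e∉ = cut , not-cut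
      where
      cut : InCut d → Reach face⁺ (old d₃) (old e)
      cut (inj₁ refl) = proj₁ (reach-old r e∉) (inj₂ f₁)
      cut (inj₂ refl) = proj₂ (reach-old r e∉) d₃∉
      not-cut : ¬ InCut d → Reach face⁺ (old d) (old e)
      not-cut d∉ with d ≟ᵈ P
      ... | yes refl = face⁺-P ◅ face⁺-uv ◅ proj₁ (reach-old r e∉) (inj₁ face-P)
      ... | no d≢P   = face⁺-old d≢P (d∉ ∘ inj₂) ◅ proj₂ (reach-old r e∉) (face∉ d∉ d≢P)
    reach-kept : ∀ {d e} → ¬ InCut d → ¬ InCut e → walk d ≡ walk e → Reach face⁺ (old d) (old e)
    reach-kept d∉ e∉ eq = proj₂ (reach-old (Walk.≡⇒∼ eq) e∉) d∉
    d₁→vu : Reach face⁺ (old d₁) vu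
    d₁→vu = face⁺-d₁ ◅ step face⁺-d₂
    cls-zero : ∀ d → cls (old d) ≡ zero → InCut d
    cls-zero d eq = decidable-stable (InCut? d) λ d∉ → case trans (sym (cls-not d∉)) eq of λ ()
    cls-suc : ∀ d {c} → cls (old d) ≡ suc c → ¬ InCut d × walk d ≡ c
    cls-suc d eq = d∉ , Fin.suc-injective (trans (sym (cls-not d∉)) eq)
      where
      d∉ : ¬ InCut d
      d∉ i = case trans (sym (cls-cut i)) eq of λ ()
    to-d₁ : ∀ x → cls x ≡ zero → Reach face⁺ x (old d₁)
    to-d₁ (old d) eq with cls-zero d eq
    ... | inj₁ refl = ε
    ... | inj₂ refl = face⁺-d₂ ◅ step face⁺-vu
    to-d₁ vu eq = step face⁺-vu
    from-d₁ : ∀ x → cls x ≡ zero → Reach face⁺ (old d₁) x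
    from-d₁ (old d) eq with cls-zero d eq
    ... | inj₁ refl = ε
    ... | inj₂ refl = step face⁺-d₁
    from-d₁ vu eq = d₁→vu
    reach-suc : ∀ x y {c} → cls x ≡ suc c → cls y ≡ suc c → Reach face⁺ x y
    reach-suc (old d) (old e) p q with cls-suc d p | cls-suc e q
    ... | d∉ , wd | e∉ , we = reach-kept d∉ e∉ (trans wd (sym we))
    reach-suc (old d) uv p q with cls-suc d p
    ... | d∉ , wd = reach-kept d∉ P∉ (trans wd (trans (sym (Fin.suc-injective q)) (sym walk-P))) ◅◅ step face⁺-P
    reach-suc uv (old e) p q with cls-suc e q
    ... | e∉ , we = face⁺-uv ◅ reach-kept d₃∉ e∉ (trans walk-d₃ (trans (Fin.suc-injective p) (sym we)))
    reach-suc uv uv p q = ε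
    reach : ∀ x y → cls x ≡ cls y → Reach face⁺ x y
    reach x y eq with cls y in q
    ... | zero  = to-d₁ x eq ◅◅ from-d₁ y q
    ... | suc c = reach-suc x y eq q

-- Chords and connectedness in maximal planar graphs

module Maximal {n : ℕ} {G : Graph n} (M : MaximalPlanar G) where

  open Embedded (proj₁ M) public

  Adj-chord : ∀ d → tail d ≡ head (face d) ⊎ Adj G (tail d) (head (face d))
  Adj-chord d with tail d ≟ head (face d) | Adj? G (tail d) (head (face d))
  ... | yes eq | _     = inj₁ eq
  ... | no _   | yes a = inj₂ a
  ... | no u≢v | no ¬a =
    contradiction (Insertion.chord (proj₁ M) u≢v ¬a d (face d) refl refl refl) (proj₂ M _ _ u≢v ¬a)

  module _ (δ : Dart G) where

    private
      class-δ : ∀ x → Component.class x ≡ Component.class (tail δ)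
      class-δ x = decidable-stable (Component.class x ≟ Component.class (tail δ)) λ x≁δ →
        let x≢δ = λ { refl → x≁δ refl }
            ¬a  = λ a → x≁δ (Component.∼⇒≡ (a ◅ ε))
        in proj₂ M x (tail δ) x≢δ ¬a (joined x x≢δ ¬a x≁δ)
        where
        joined : ∀ x (x≢δ : x ≢ tail δ) → ¬ Adj G x (tail δ) → Component.class x ≢ Component.class (tail δ) →
                 Planar (addEdge G x (tail δ) x≢δ)
        joined x x≢δ ¬a x≁δ with any? (λ y → Adj? G x y)
        ... | yes (y , a) = Insertion.bridge (proj₁ M) x≢δ ¬a (dart x y a) δ refl refl x≁δ
        ... | no none     = Insertion.pendant (proj₁ M) x≢δ ¬a (λ y a → none (y , a)) δ refl x≁δ

    connected : ∀ x y → Star (Adj G) x y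
    connected x y = Component.≡⇒∼ (trans (class-δ x) (sym (class-δ y)))

    private
      one-component : ∀ {k} (C : HasClasses (Star (Adj G)) k) → k ≡ 1
      one-component {zero} C = case HasClasses.class C (tail δ) of λ ()
      one-component {suc zero} C = refl
      one-component {suc (suc k)} C = contradiction
        (trans (sym (C.class-member 0F)) (trans (C.∼⇒≡ (connected _ _)) (C.class-member 1F))) λ ()
        where module C = Classes C

      no-isolated : length (isolated G) ≡ 0
      no-isolated = cong length (empty (isolated G) λ x∈ → let x-isolated = proj₂ (∈-filter⁻ _ {xs = allFin n} x∈)
        in not-isolated _ x-isolated)
        where
        empty : ∀ (xs : List (Fin n)) → (∀ {x} → x ∉ xs) → xs ≡ []
        empty []       _ = refl
        empty (x ∷ xs) ∉ = contradiction (here refl) ∉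
        not-isolated : ∀ x → ¬ (∀ y → ¬ Adj G x y)
        not-isolated x i with connected x (tail δ)
        ... | a ◅ _ = i _ a
        ... | ε     = i _ (adjacent δ)

    euler-connected : n + #walks ≡ length (edges G) + 2
    euler-connected = begin
      n + #walks                            ≡⟨ cong (n +_) (ℕ.+-identityʳ #walks) ⟨
      n + (#walks + 0)                      ≡⟨ cong (λ i → n + (#walks + i)) no-isolated ⟨
      n + (#walks + length (isolated G))    ≡⟨ euler ⟩
      length (edges G) + 2 *ℕ #components   ≡⟨ cong (λ c → length (edges G) + 2 *ℕ c) (one-component components) ⟩
      length (edges G) + 2                  ∎
      where open ≡-Reasoning

-- Parity of side changes round a vertex

module Sides {n : ℕ} {G : Graph n} (E : PlaneEmbedding G) (α : Dart G → Bool)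
             (α-face : ∀ d → α (PlaneEmbedding.face E d) ≡ α d) where
  open Embedded E

  α-next : ∀ d → α (next d) ≡ α (reverse d)
  α-next d = trans (cong α (next≡face-reverse d)) (α-face (reverse d))

  -- Going round a vertex, the colour changes an even number of times.
  no-single-change : ∀ d → (∀ e → tail e ≡ tail d → e ≢ d → α (reverse e) ≡ α e) → α (reverse d) ≡ α d
  no-single-change d others =
    trans (sym (α-next d)) (sym (proj₂ (reach-invariant {P = P} inv
      (next-cyclic (next d) d (next-tail d)) (next-tail d , refl))))
    where
    P : Dart G → Set
    P x = tail x ≡ tail d × α x ≡ α (next d)
    inv : ∀ x → P x → P (next x)
    inv x (t , p) with x ≟ᵈ d
    ... | yes refl = next-tail d , refl
    ... | no x≢d   = trans (next-tail x) t , trans (α-next x) (trans (others x t x≢d) p)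

-- Breadth-first spanning trees

least : {P : ℕ → Set} → (∀ k → Dec (P k)) → ∀ k → P k → ∃[ m ] P m × (∀ j → j < m → ¬ P j)
least P? k p with P? zero
... | yes p₀ = zero , p₀ , λ _ ()
least P? zero    p | no ¬p₀ = contradiction p ¬p₀
least P? (suc k) p | no ¬p₀ =
  let m , pm , below = least (P? ∘ suc) k p
  in suc m , pm , λ { zero _ → ¬p₀ ; (suc j) (s≤s j<m) → below j j<m }

bounded : ∀ {n} (f : Fin n → ℕ) → ∃[ b ] (∀ i → f i < b)
bounded {zero}  f = zero , λ ()
bounded {suc n} f =
  let b , f<b = bounded (f ∘ suc)
  in suc (f zero) ℕ.⊔ b , λ { zero → ℕ.m≤m⊔n (suc (f zero)) b ; (suc i) → ℕ.≤-trans (f<b i) (ℕ.m≤n⊔m (suc (f zero)) b) }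

module SpanningTree {n : ℕ} (G : Graph n) (connected : ∀ x y → Star (Adj G) x y) (r : Fin n) where

  private
    WalkTo : ℕ → Fin n → Set
    WalkTo zero    x = x ≡ r
    WalkTo (suc k) x = ∃[ y ] Adj G x y × WalkTo k y

    walkTo? : ∀ k x → Dec (WalkTo k x)
    walkTo? zero    x = x ≟ r
    walkTo? (suc k) x = any? λ y → Adj? G x y ×-dec walkTo? k y

    walkTo : ∀ {x} → Star (Adj G) x r → ∃[ k ] WalkTo k x
    walkTo ε       = zero , refl
    walkTo (a ◅ s) = let k , w = walkTo s in suc k , _ , a , w

    shortest : ∀ x → ∃[ m ] WalkTo m x × (∀ j → j < m → ¬ WalkTo j x)
    shortest x = let k , w = walkTo (connected x r) in least (λ k → walkTo? k x) k w

  rank : Fin n → ℕ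
  rank x = proj₁ (shortest x)

  private
    rank-≤ : ∀ {x k} → WalkTo k x → rank x ≤ℕ k
    rank-≤ {x} {k} w = ℕ.≮⇒≥ λ k<m → proj₂ (proj₂ (shortest x)) k k<m w

    closer : ∀ x → x ≢ r → ∃[ y ] Adj G x y × rank y < rank x
    closer x x≢r with shortest x
    ... | zero  , x≡r         , _ = contradiction x≡r x≢r
    ... | suc m , (y , a , w) , _ = y , a , s≤s (rank-≤ w)

  private
    parent′ : ∀ x → Dec (x ≡ r) → Fin n
    parent′ x (yes _)  = r
    parent′ x (no x≢r) = proj₁ (closer x x≢r)

    parent′-closer : ∀ {x} (d : Dec (x ≡ r)) → x ≢ r → Adj G x (parent′ x d) × rank (parent′ x d) < rank x
    parent′-closer (yes x≡r) x≢r = contradiction x≡r x≢r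
    parent′-closer (no x≢r)  _   = proj₂ (closer _ x≢r)

    parent′-root : (d : Dec (r ≡ r)) → parent′ r d ≡ r
    parent′-root (yes _)  = refl
    parent′-root (no r≢r) = contradiction refl r≢r

  abstract
    parent : Fin n → Fin n
    parent x = parent′ x (x ≟ r)

    parent-root : parent r ≡ r
    parent-root = parent′-root (r ≟ r)

    parent-adj : ∀ {x} → x ≢ r → Adj G x (parent x)
    parent-adj {x} = proj₁ ∘ parent′-closer (x ≟ r)

    parent-rank : ∀ {x} → x ≢ r → rank (parent x) < rank x
    parent-rank {x} = proj₂ ∘ parent′-closer (x ≟ r)

  -- Ranks are distances from the root: a neighbour of `r` has rank at most 1, so its parent has
  -- rank 0. Thus both edges of a triangle at a corner chosen as root belong to the tree.
  parent-neighbour : ∀ {x} → Adj G x r → parent x ≡ r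
  parent-neighbour {x} a = decidable-stable (parent x ≟ r) λ px≢r → ℕ.<-irrefl refl (ℕ.<-≤-trans
    (ℕ.≤-<-trans z≤n (parent-rank px≢r))
    (ℕ.≤-pred (ℕ.≤-trans (parent-rank x≢r) (rank-≤ {k = 1} (r , a , refl)))))
    where
    x≢r : x ≢ r
    x≢r refl = Adj-irrefl {G = G} a

  parent-parent : ∀ {x} → x ≢ r → parent (parent x) ≢ x
  parent-parent {x} x≢r eq = case parent x ≟ r of λ where
    (yes px≡r) → x≢r (trans (sym eq) (trans (cong parent px≡r) parent-root))
    (no px≢r)  → ℕ.<-asym (parent-rank x≢r) (subst (λ y → rank y < rank (parent x)) eq (parent-rank px≢r))

  -- Induction from the leaves towards the root. Children have larger rank than their parent, and
  -- ranks are bounded, so the distance to the bound decreases.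
  leaves-up : {P : Fin n → Set} → (∀ w → w ≢ r → (∀ x → x ≢ r → parent x ≡ w → P x) → P w) →
              ∀ w → w ≢ r → P w
  leaves-up {P} up w w≢r = go b w w≢r (ℕ.m≤n+m b (rank w))
    where
    b = proj₁ (bounded rank)
    go : ∀ k w → w ≢ r → b ≤ℕ rank w + k → P w
    go zero w _ b≤ = contradiction (ℕ.<-≤-trans (proj₂ (bounded rank) w) (subst (b ≤ℕ_) (ℕ.+-identityʳ _) b≤)) (ℕ.<-irrefl refl)
    go (suc k) w w≢r b≤ = up w w≢r λ { x x≢r refl → go k x x≢r
      (ℕ.≤-trans b≤ (subst (_≤ℕ rank x + k) (sym (ℕ.+-suc (rank (parent x)) k)) (ℕ.+-monoˡ-≤ k (parent-rank x≢r)))) }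

-- Dimension counting over the field with two elements, done by cardinality: bit vectors are coded
-- as numbers below 2 to the power p, where an injective self-map is onto by the pigeonhole
-- principle. Bit vectors are functions, hence compared pointwise.
injective⇒surjective : ∀ {p q} → p ≡ q → (f : (Fin p → Bool) → (Fin q → Bool)) →
  (∀ x y → (∀ i → f x i ≡ f y i) → ∀ i → x i ≡ y i) → ∀ (y : Fin q → Bool) → ∃[ x ] (∀ i → f x i ≡ y i)
injective⇒surjective {p} refl f f-injective y =
  decode (proj₁ hit) , λ i → trans (sym (decode-encode (f (decode (proj₁ hit))) i))
    (trans (cong (λ c → decode c i) (proj₂ hit)) (decode-encode y i))
  where
  open Inverse Fin.2↔Bool using () renaming (to to bit; from to code)
  bit-code : ∀ b → bit (code b) ≡ b
  bit-code true  = refl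
  bit-code false = refl
  code-bit : ∀ k → code (bit k) ≡ k
  code-bit 0F = refl
  code-bit 1F = refl
  encode : (Fin p → Bool) → Fin (2 ℕ.^ p)
  encode x = funToFin (code ∘ x)
  decode : Fin (2 ℕ.^ p) → Fin p → Bool
  decode k i = bit (finToFun k i)
  decode-encode : ∀ x i → decode (encode x) i ≡ x i
  decode-encode x i = trans (cong bit (Fin.finToFun-funToFin (λ j → code (x j)) i)) (bit-code (x i))
  g : Fin (2 ℕ.^ p) → Fin (2 ℕ.^ p)
  g = encode ∘ f ∘ decode
  g-injective : ∀ {k l} → g k ≡ g l → k ≡ l
  g-injective {k} {l} eq = trans (sym (Fin.funToFin-finToFin {m = p} k)) (trans (funToFin-cong same) (Fin.funToFin-finToFin {m = p} l))
    where
    funToFin-cong : ∀ {m} {u v : Fin m → Fin 2} → (∀ i → u i ≡ v i) → funToFin u ≡ funToFin v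
    funToFin-cong {zero}  eq = refl
    funToFin-cong {suc m} eq = cong₂ combine (eq zero) (funToFin-cong (eq ∘ suc))
    same : ∀ i → finToFun k i ≡ finToFun l i
    same i = trans (sym (code-bit _)) (trans (cong code (f-injective (decode k) (decode l)
      (λ j → trans (sym (decode-encode (f (decode k)) j)) (trans (cong (λ c → decode c j) eq) (decode-encode (f (decode l)) j))) i))
      (code-bit _))
  surjective : ∀ {m} (h : Fin m → Fin m) → (∀ {k l} → h k ≡ h l → k ≡ l) → ∀ y → ∃[ k ] h k ≡ y
  surjective {suc m} h h-injective y with any? (λ k → h k ≟ y)
  ... | yes hit = hit
  ... | no miss = contradiction
    (Fin.injective⇒≤ {f = λ k → punchOut (λ eq → miss (k , sym eq))}
      (λ {k} {l} eq → h-injective (Fin.punchOut-injective (λ e → miss (k , sym e)) (λ e → miss (l , sym e)) eq)))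
    (ℕ.<-irrefl refl)
  hit : ∃[ k ] g k ≡ encode y
  hit = surjective g g-injective (encode y)

xor-interchange : ∀ a b c d → (a xor b) xor (c xor d) ≡ (a xor c) xor (b xor d)
xor-interchange = CommutativeSemigroup.interchange (CommutativeRing.+-commutativeSemigroup Bool.xor-∧-commutativeRing)

xor-≡ : ∀ {a b} → a xor b ≡ false → a ≡ b
xor-≡ {true}  {true}  _ = refl
xor-≡ {false} {false} _ = refl

≡-xor : ∀ {a b} → a ≡ b → a xor b ≡ false
≡-xor {a} refl = xor-same a

-- Triangles separate the sphere

module Homology {n : ℕ} {G : Graph n} (E : PlaneEmbedding G) (connected : ∀ x y → Star (Adj G) x y)
                (euler′ : n + PlaneEmbedding.#walks E ≡ length (edges G) + 2) where
  open Embedded E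

  -- As `next` is `face` after `reverse`, such an `α` is constant round every vertex, and edges
  -- carry its value from vertex to vertex.
  constant : (α : Dart G → Bool) → (∀ d → α (face d) ≡ α d) → (∀ d → α (reverse d) ≡ α d) →
             ∀ d e → α d ≡ α e
  constant α α-face α-rev d e = along (connected (tail d) (tail e)) d e refl refl
    where
    open Sides E α α-face using (α-next)
    same-tail : ∀ d e → tail d ≡ tail e → α d ≡ α e
    same-tail d e eq = step-invariant α (λ { {x} refl → sym (trans (α-next x) (α-rev x)) }) (next-cyclic d e eq)
    along : ∀ {x y} → Star (Adj G) x y → ∀ d e → tail d ≡ x → tail e ≡ y → α d ≡ α e
    along ε d e p q = same-tail d e (trans p (sym q))
    along (_◅_ {x} {y} a s) d e p q = trans (same-tail d (dart x y a) p)
      (trans (sym (α-rev (dart x y a))) (along s (reverse (dart x y a)) e refl q))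

  private
    edgeDart : Fin (length (edges G)) → Dart G
    edgeDart i = dart (proj₁ (lookup (edges G) i)) (proj₂ (lookup (edges G) i))
      (proj₂ (proj₂ (∈-filter⁻ (isEdge? G) {xs = pairs n} (∈-lookup i))))

    index-of : ∀ d → toℕ (tail d) < toℕ (head d) → ∃[ i ] edgeDart i ≡ d
    index-of d lt = index d∈ , dart-≡ (cong proj₁ (sym (Any.lookup-index d∈))) (cong proj₂ (sym (Any.lookup-index d∈)))
      where
      d∈ : (tail d , head d) ∈ edges G
      d∈ = ∈-filter⁺ (isEdge? G) (∈-cartesianProduct⁺ (∈-allFin (tail d)) (∈-allFin (head d))) (lt , adjacent d)

    edge-index : ∀ d → ∃[ i ] (edgeDart i ≡ d ⊎ edgeDart i ≡ reverse d)
    edge-index d with Fin.<-cmp (tail d) (head d)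
    ... | tri< lt _ _ = let i , eq = index-of d lt in i , inj₁ eq
    ... | tri≈ _ eq _ = contradiction eq (tail≢head d)
    ... | tri> _ _ gt = let i , eq = index-of (reverse d) gt in i , inj₂ eq

  module Rooted (r : Fin n) where
    open SpanningTree G connected r public

    -- The boundary modulo 2 of the set `a` of faces, as a set of edges.
    ∂ : (Fin #walks → Bool) → Dart G → Bool
    ∂ a d = a (walk d) xor a (walk (reverse d))

    -- A set of tree edges, each named by its lower end. The value of `t` at the root names no edge.
    treeEdge : (Fin n → Bool) → Fin n → Fin n → Bool
    treeEdge t x y = (does (parent x ≟ y) ∧ t x) xor (does (parent y ≟ x) ∧ t y)

    Φ : (Fin #walks → Bool) → (Fin n → Bool) → Dart G → Bool
    Φ a t d = ∂ a d xor treeEdge t (tail d) (head d)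

    Φ-reverse : ∀ a t d → Φ a t (reverse d) ≡ Φ a t d
    Φ-reverse a t d = cong₂ _xor_
      (trans (cong (λ e → a (walk (reverse d)) xor a (walk e)) (reverse-reverse d)) (xor-comm (a (walk (reverse d))) (a (walk d))))
      (xor-comm (does (parent (head d) ≟ tail d) ∧ t (head d)) (does (parent (tail d) ≟ head d) ∧ t (tail d)))

    Φ-xor : ∀ a t a′ t′ d → Φ (λ c → a c xor a′ c) (λ x → t x xor t′ x) d ≡ Φ a t d xor Φ a′ t′ d
    Φ-xor a t a′ t′ d = begin
      ((a w xor a′ w) xor (a w′ xor a′ w′)) xor ((p ∧ (t x xor t′ x)) xor (q ∧ (t y xor t′ y)))
        ≡⟨ cong₂ _xor_ (xor-interchange (a w) (a′ w) (a w′) (a′ w′))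
             (trans (cong₂ _xor_ (Bool.∧-distribˡ-xor p (t x) (t′ x)) (Bool.∧-distribˡ-xor q (t y) (t′ y)))
                    (xor-interchange (p ∧ t x) (p ∧ t′ x) (q ∧ t y) (q ∧ t′ y))) ⟩
      ((a w xor a w′) xor (a′ w xor a′ w′)) xor (((p ∧ t x) xor (q ∧ t y)) xor ((p ∧ t′ x) xor (q ∧ t′ y)))
        ≡⟨ xor-interchange (a w xor a w′) _ ((p ∧ t x) xor (q ∧ t y)) _ ⟩
      Φ a t d xor Φ a′ t′ d ∎
      where
      open ≡-Reasoning
      x = tail d
      y = head d
      p = does (parent x ≟ y)
      q = does (parent y ≟ x)
      w = walk d
      w′ = walk (reverse d)

    module _ (a : Fin #walks → Bool) (t : Fin n → Bool) where

      private
        side : Dart G → Bool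
        side d = a (walk d)

        open Sides E side (λ d → cong a (walk-face d))

      treeEdge-none : ∀ {x y} → (parent x ≡ y → t x ≡ false) → (parent y ≡ x → t y ≡ false) → treeEdge t x y ≡ false
      treeEdge-none {x} {y} p q = cong₂ _xor_ (none (parent x ≟ y) p) (none (parent y ≟ x) q)
        where
        none : ∀ {A : Set} {b} (A? : Dec A) → (A → b ≡ false) → does A? ∧ b ≡ false
        none (yes z) f = f z
        none (no _)  f = refl

      treeEdge-parent : ∀ {x} → x ≢ r → treeEdge t x (parent x) ≡ t x
      treeEdge-parent {x} x≢r = trans
        (cong₂ (λ p q → (p ∧ t x) xor (q ∧ t (parent x)))
          (dec-true (parent x ≟ parent x) refl) (dec-false (parent (parent x) ≟ x) (parent-parent x≢r)))
        (xor-identityʳ (t x))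

      -- A vertex of even degree in ∂ a cannot be joined by ∂ a to its parent only.
      no-leaf-edge : ∀ {w} → w ≢ r → (∀ d → tail d ≡ w → Φ a t d ≡ false) →
                     (∀ x → x ≢ r → parent x ≡ w → t x ≡ false) → t w ≡ false
      no-leaf-edge {w} w≢r fit children = begin
        t w                        ≡⟨ treeEdge-parent w≢r ⟨
        treeEdge t w (parent w)    ≡⟨ xor-≡ (fit up refl) ⟨
        ∂ a up                     ≡⟨ ≡-xor (sym (no-single-change up λ e te e≢up → sym (xor-≡ (trans (xor-≡ (fit e te)) (only e te e≢up))))) ⟩
        false                      ∎
        where
        open ≡-Reasoning
        up : Dart G
        up = dart w (parent w) (parent-adj w≢r)
        only : ∀ e → tail e ≡ w → e ≢ up → treeEdge t (tail e) (head e) ≡ false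
        only e refl e≢up = treeEdge-none (λ p → contradiction (dart-≡ refl (sym p)) e≢up)
          (λ p → children (head e) (λ h≡r → w≢r (trans (sym p) (trans (cong parent h≡r) (trans parent-root refl)))) p)

      -- Peeling leaves by `no-leaf-edge` empties `t`. Then `a` has no boundary, so it is constant
      -- on the connected dual, and its value at `d₀` settles it.
      kernel : ∀ d₀ → (∀ d → Φ a t d ≡ false) → a (walk d₀) ≡ false → t r ≡ false →
               (∀ c → a c ≡ false) × (∀ x → t x ≡ false)
      kernel d₀ fit a₀ t₀ = a-zero , t-zero
        where
        t-zero : ∀ x → t x ≡ false
        t-zero x with x ≟ r
        ... | yes refl = t₀
        ... | no x≢r   = leaves-up (λ w w≢r children → no-leaf-edge w≢r (λ d _ → fit d) children) x x≢r
        a-zero : ∀ c → a c ≡ false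
        a-zero c = trans (cong a (sym (Walk.class-member c))) (trans
          (constant side (λ d → cong a (walk-face d))
            (λ d → sym (xor-≡ (trans (xor-≡ (fit d)) (treeEdge-none {x = tail d} (λ _ → t-zero _) (λ _ → t-zero _))))) _ d₀) a₀)

    -- By Euler's formula the unknowns and the equations are equal in number.
    solve : Dart G → (y : Fin (length (edges G)) → Bool) →
            Σ[ a ∈ (Fin #walks → Bool) ] Σ[ t ∈ (Fin n → Bool) ] (∀ i → Φ a t (edgeDart i) ≡ y i) × t r ≡ false
    solve d₀ y = faces f , vertices f , (λ i → trans (sym (Ψ-edge f i)) (trans (eq (i ↑ˡ 2)) (target-edge i))) ,
                 trans (sym (Ψ-root f)) (trans (eq (m ↑ʳ 1F)) target-root)
      where
      m = length (edges G)
      faces : (Fin (n + #walks) → Bool) → Fin #walks → Bool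
      faces f c = f (n ↑ʳ c)
      vertices : (Fin (n + #walks) → Bool) → Fin n → Bool
      vertices f x = f (x ↑ˡ #walks)
      -- Complementing `a` does not change its boundary, and `t r` names no edge. Fixing one value
      -- for each of these two freedoms gives the two equations beyond the edges, the 2 of Euler's
      -- formula.
      base : (Fin (n + #walks) → Bool) → Fin 2 → Bool
      base f 0F = faces f (walk d₀)
      base f 1F = vertices f r
      Ψ : (Fin (n + #walks) → Bool) → Fin (m + 2) → Bool
      Ψ f k = [ (λ i → Φ (faces f) (vertices f) (edgeDart i)) , base f ]′ (splitAt m k)
      Ψ-edge : ∀ f i → Ψ f (i ↑ˡ 2) ≡ Φ (faces f) (vertices f) (edgeDart i)
      Ψ-edge f i = cong [ (λ i → Φ (faces f) (vertices f) (edgeDart i)) , base f ]′ (Fin.splitAt-↑ˡ m i 2)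
      Ψ-base : ∀ f b → Ψ f (m ↑ʳ b) ≡ base f b
      Ψ-base f b = cong [ (λ i → Φ (faces f) (vertices f) (edgeDart i)) , base f ]′ (Fin.splitAt-↑ʳ m 2 b)
      Ψ-root : ∀ f → Ψ f (m ↑ʳ 1F) ≡ vertices f r
      Ψ-root f = Ψ-base f 1F
      Ψ-injective : ∀ f g → (∀ k → Ψ f k ≡ Ψ g k) → ∀ k → f k ≡ g k
      Ψ-injective f g eq k = xor-≡ (trans (cong h (sym (Fin.join-splitAt n #walks k))) (h-zero (splitAt n k)))
        where
        h : Fin (n + #walks) → Bool
        h k = f k xor g k
        at-edge : ∀ i → Φ (faces h) (vertices h) (edgeDart i) ≡ false
        at-edge i = trans (Φ-xor (faces f) (vertices f) (faces g) (vertices g) (edgeDart i))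
          (≡-xor (trans (sym (Ψ-edge f i)) (trans (eq (i ↑ˡ 2)) (Ψ-edge g i))))
        at-dart : ∀ d → Φ (faces h) (vertices h) d ≡ false
        at-dart d with edge-index d
        ... | i , inj₁ refl = at-edge i
        ... | i , inj₂ p    = trans (sym (Φ-reverse (faces h) (vertices h) d))
          (trans (cong (Φ (faces h) (vertices h)) (sym p)) (at-edge i))
        at-base : ∀ b → base f b xor base g b ≡ false
        at-base b = ≡-xor (trans (sym (Ψ-base f b)) (trans (eq (m ↑ʳ b)) (Ψ-base g b)))
        zeros = kernel (faces h) (vertices h) d₀ at-dart (at-base 0F) (at-base 1F)
        h-zero : ∀ s → h (join n #walks s) ≡ false
        h-zero (inj₁ x) = proj₂ zeros x
        h-zero (inj₂ c) = proj₁ zeros c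
      target : Fin (m + 2) → Bool
      target k = [ y , (λ _ → false) ]′ (splitAt m k)
      target-edge : ∀ i → target (i ↑ˡ 2) ≡ y i
      target-edge i = cong [ y , (λ _ → false) ]′ (Fin.splitAt-↑ˡ m i 2)
      target-root : target (m ↑ʳ 1F) ≡ false
      target-root = cong [ y , (λ _ → false) ]′ (Fin.splitAt-↑ʳ m 2 1F)
      solution : ∃[ f ] (∀ k → Ψ f k ≡ target k)
      solution = injective⇒surjective euler′ Ψ Ψ-injective target
      f = proj₁ solution
      eq = proj₂ solution

    -- Writes the single edge `e` as a boundary plus tree edges. For `e` outside the tree, the
    -- boundary is the cycle that `e` closes with the tree.
    solve-edge : (e : Dart G) →
      Σ[ a ∈ (Fin #walks → Bool) ] Σ[ t ∈ (Fin n → Bool) ]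
        (∀ d → d ≢ e → d ≢ reverse e → Φ a t d ≡ false) × Φ a t e ≡ true × t r ≡ false
    solve-edge e with edge-index e
    ... | i , i≡e with solve e (λ j → does (j ≟ i))
    ...   | a , t , eq , t-root = a , t , others , this i≡e , t-root
      where
      this : edgeDart i ≡ e ⊎ edgeDart i ≡ reverse e → Φ a t e ≡ true
      this (inj₁ refl) = trans (eq i) (dec-true (i ≟ i) refl)
      this (inj₂ p)    = trans (sym (Φ-reverse a t e)) (trans (cong (Φ a t) (sym p)) (trans (eq i) (dec-true (i ≟ i) refl)))
      others : ∀ d → d ≢ e → d ≢ reverse e → Φ a t d ≡ false
      others d d≢e d≢re with edge-index d
      ... | j , j≡d = at-j j≡d
        where
        clash : edgeDart i ≡ e ⊎ edgeDart i ≡ reverse e → edgeDart i ≡ d ⊎ edgeDart i ≡ reverse d → ⊥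
        clash (inj₁ p) (inj₁ q) = d≢e (trans (sym q) p)
        clash (inj₁ p) (inj₂ q) = d≢re (trans (sym (reverse-reverse d)) (cong reverse (trans (sym q) p)))
        clash (inj₂ p) (inj₁ q) = d≢re (trans (sym q) p)
        clash (inj₂ p) (inj₂ q) = d≢e (reverse-injective (trans (sym q) p))
        j≢i : j ≢ i
        j≢i refl = clash i≡e j≡d
        at-j : edgeDart j ≡ d ⊎ edgeDart j ≡ reverse d → Φ a t d ≡ false
        at-j (inj₁ refl) = trans (eq j) (dec-false (j ≟ i) j≢i)
        at-j (inj₂ q)    = trans (sym (Φ-reverse a t d)) (trans (cong (Φ a t) (sym q)) (trans (eq j) (dec-false (j ≟ i) j≢i)))

  OnTriangle : Fin n → Fin n → Fin n → Dart G → Set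
  OnTriangle x y z d = On (tail d) × On (head d)
    where
    On : Fin n → Set
    On w = w ≡ x ⊎ w ≡ y ⊎ w ≡ z

  -- A discrete Jordan curve theorem for triangles. As the graph is simple, the darts with both ends
  -- among the corners are those of the three edges.
  record Separation (x y z : Fin n) : Set where
    field
      side      : Fin #walks → Bool
      separated : ∀ d → OnTriangle x y z d → side (walk (reverse d)) ≢ side (walk d)
      joined    : ∀ d → ¬ OnTriangle x y z d → side (walk (reverse d)) ≡ side (walk d)

  -- In a tree with root x in which y and z are children of x, the triangle is
  -- the cycle that the edge yz closes.
  separation : ∀ {x y z} → Adj G x y → Adj G x z → Adj G y z → Separation x y z
  separation {x} {y} {z} xy xz yz = build (solve-edge yz-dart)
    where
    open Rooted x
    yz-dart : Dart G
    yz-dart = dart y z yz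
    x≢y : x ≢ y
    x≢y refl = Adj-irrefl {G = G} xy
    x≢z : x ≢ z
    x≢z refl = Adj-irrefl {G = G} xz
    y≢z : y ≢ z
    y≢z refl = Adj-irrefl {G = G} yz
    parent-y : parent y ≡ x
    parent-y = parent-neighbour (Adj-sym {G = G} xy)
    parent-z : parent z ≡ x
    parent-z = parent-neighbour (Adj-sym {G = G} xz)
    build : Σ[ a ∈ (Fin #walks → Bool) ] Σ[ t ∈ (Fin n → Bool) ]
              (∀ d → d ≢ yz-dart → d ≢ reverse yz-dart → Φ a t d ≡ false) × Φ a t yz-dart ≡ true × t x ≡ false →
            Separation x y z
    build (a , t , others , this , t-x) = record { side = a ; separated = separated ; joined = joined }
      where
      open Sides E (a ∘ walk) (λ d → cong a (walk-face d))
      -- Away from the edge yz the boundary agrees with the tree edges, so leaves can be peeled at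
      -- all vertices except the corners. The peeling never meets `y` or `z` as children, since
      -- their parent is `x`.
      t-other : ∀ w → w ≢ x → w ≢ y → w ≢ z → t w ≡ false
      t-other = leaves-up λ w w≢x children w≢y w≢z → no-leaf-edge a t w≢x
        (λ d td → others d (λ { refl → w≢y (sym td) }) (λ { refl → w≢z (sym td) }))
        (λ v v≢x pv → children v v≢x pv
          (λ { refl → w≢x (trans (sym pv) parent-y) }) (λ { refl → w≢x (trans (sym pv) parent-z) }))
      yz-tree : treeEdge t y z ≡ false
      yz-tree = treeEdge-none a t (λ p → contradiction (trans (sym parent-y) p) x≢z) (λ p → contradiction (trans (sym parent-z) p) x≢y)
      change-yz : ∂ a yz-dart ≡ true
      change-yz = trans (sym (xor-identityʳ _)) (trans (cong (∂ a yz-dart xor_) (sym yz-tree)) this)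
      changed : ∀ {d} → ∂ a d ≡ true → a (walk (reverse d)) ≢ a (walk d)
      changed p eq = case trans (sym p) (≡-xor (sym eq)) of λ ()
      unchanged : ∀ {d} → ∂ a d ≡ false → a (walk (reverse d)) ≡ a (walk d)
      unchanged p = sym (xor-≡ p)
      -- If the tree edge from this end to `x` were missing, the boundary would meet the end in the
      -- edge yz alone, against `no-single-change`.
      t-end : ∀ (e : Dart G) → e ≡ yz-dart ⊎ e ≡ reverse yz-dart → parent (tail e) ≡ x → tail e ≢ x → t (tail e) ≡ true
      t-end e e≡ pe e≢x = ¬-not λ t≡false → changed (∂-e e≡) (no-single-change e λ d td d≢e →
        unchanged (trans (xor-≡ (others d (d≢yz e≡ d td d≢e) (d≢zy e≡ d td d≢e))) (treeEdge-none a t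
          (λ _ → trans (cong t td) t≡false)
          (λ pd → t-child d (trans pd td)))))
        where
        ∂-e : e ≡ yz-dart ⊎ e ≡ reverse yz-dart → ∂ a e ≡ true
        ∂-e (inj₁ refl) = change-yz
        ∂-e (inj₂ refl) = trans (xor-comm (a (walk (reverse yz-dart))) _)
          (trans (cong (λ d → a (walk d) xor a (walk (reverse yz-dart))) (reverse-reverse yz-dart)) change-yz)
        d≢yz : e ≡ yz-dart ⊎ e ≡ reverse yz-dart → ∀ d → tail d ≡ tail e → d ≢ e → d ≢ yz-dart
        d≢yz (inj₁ refl) d td d≢e eq = d≢e eq
        d≢yz (inj₂ refl) d td d≢e refl = y≢z td
        d≢zy : e ≡ yz-dart ⊎ e ≡ reverse yz-dart → ∀ d → tail d ≡ tail e → d ≢ e → d ≢ reverse yz-dart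
        d≢zy (inj₁ refl) d td d≢e refl = y≢z (sym td)
        d≢zy (inj₂ refl) d td d≢e eq = d≢e eq
        t-child : ∀ d → parent (head d) ≡ tail e → t (head d) ≡ false
        t-child d pd with head d ≟ x | head d ≟ y | head d ≟ z
        ... | yes hx | _ | _ = trans (cong t hx) t-x
        ... | no _ | yes hy | _ = contradiction (trans (sym pd) (trans (cong parent hy) parent-y)) e≢x
        ... | no _ | no _ | yes hz = contradiction (trans (sym pd) (trans (cong parent hz) parent-z)) e≢x
        ... | no hx | no hy | no hz = t-other (head d) hx hy hz
      t-y : t y ≡ true
      t-y = t-end yz-dart (inj₁ refl) parent-y (≢-sym x≢y)
      t-z : t z ≡ true
      t-z = t-end (reverse yz-dart) (inj₂ refl) parent-z (≢-sym x≢z)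
      t-on : ∀ {w} → t w ≡ true → w ≡ y ⊎ w ≡ z
      t-on {w} tw with w ≟ x | w ≟ y | w ≟ z
      ... | _ | yes wy | _ = inj₁ wy
      ... | _ | no _ | yes wz = inj₂ wz
      ... | yes refl | no _ | no _ = case trans (sym tw) t-x of λ ()
      ... | no wx | no wy | no wz = case trans (sym tw) (t-other w wx wy wz) of λ ()
      to-x : ∀ {w v} → parent w ≡ v → t w ≡ true → w ≡ y ⊎ w ≡ z → v ≡ x
      to-x refl tw (inj₁ refl) = parent-y
      to-x refl tw (inj₂ refl) = parent-z
      root-edge : ∀ d → tail d ≡ x → head d ≡ y ⊎ head d ≡ z → Φ a t d ≡ false → ∂ a d ≡ true
      root-edge d tx hd fit = trans (xor-≡ fit) (trans (cong₂ _xor_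
          (cong₂ _∧_ (dec-false (parent (tail d) ≟ head d) λ p → tail≢head d (trans tx (trans (sym (trans (cong parent tx) parent-root)) p))) (refl {x = t (tail d)}))
          (cong₂ _∧_ (dec-true (parent (head d) ≟ tail d) (trans (parent-h hd) (sym tx))) (t-h hd))) refl)
        where
        parent-h : head d ≡ y ⊎ head d ≡ z → parent (head d) ≡ x
        parent-h (inj₁ p) = trans (cong parent p) parent-y
        parent-h (inj₂ p) = trans (cong parent p) parent-z
        t-h : head d ≡ y ⊎ head d ≡ z → t (head d) ≡ true
        t-h (inj₁ p) = trans (cong t p) t-y
        t-h (inj₂ p) = trans (cong t p) t-z
      from-root : ∀ d → tail d ≡ x → head d ≡ y ⊎ head d ≡ z → ∂ a d ≡ true
      from-root d tx hd = root-edge d tx hd (others d (λ { refl → x≢y (sym tx) }) (λ { refl → x≢z (sym tx) }))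
      ∂-reverse : ∀ d → ∂ a (reverse d) ≡ ∂ a d
      ∂-reverse d = trans (cong (λ e → a (walk (reverse d)) xor a (walk e)) (reverse-reverse d)) (xor-comm (a (walk (reverse d))) _)
      separated : ∀ d → OnTriangle x y z d → a (walk (reverse d)) ≢ a (walk d)
      separated d (inj₁ p , inj₂ q) = changed (from-root d p q)
      separated d (inj₂ p , inj₁ q) = changed (trans (sym (∂-reverse d)) (from-root (reverse d) q p))
      separated d (inj₁ p , inj₁ q) = contradiction (trans p (sym q)) (tail≢head d)
      separated d (inj₂ (inj₁ p) , inj₂ (inj₁ q)) = contradiction (trans p (sym q)) (tail≢head d)
      separated d (inj₂ (inj₂ p) , inj₂ (inj₂ q)) = contradiction (trans p (sym q)) (tail≢head d)
      separated d (inj₂ (inj₁ p) , inj₂ (inj₂ q)) = changed (trans (cong (∂ a) (dart-≡ p q)) change-yz)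
      separated d (inj₂ (inj₂ p) , inj₂ (inj₁ q)) =
        changed (trans (cong (∂ a) (dart-≡ {e = reverse yz-dart} p q)) (trans (∂-reverse yz-dart) change-yz))
      joined : ∀ d → ¬ OnTriangle x y z d → a (walk (reverse d)) ≡ a (walk d)
      joined d off = unchanged (trans
        (xor-≡ (others d (λ { refl → off (inj₂ (inj₁ refl) , inj₂ (inj₂ refl)) })
                         (λ { refl → off (inj₂ (inj₂ refl) , inj₂ (inj₁ refl)) })))
        (treeEdge-none a t
          (λ p → ¬-not λ tw → off (inj₂ (t-on tw) , inj₁ (to-x p tw (t-on tw))))
          (λ p → ¬-not λ tw → off (inj₁ (to-x p tw (t-on tw)) , inj₂ (t-on tw)))))

-- Maximal planar graphs are triangulated

star-closed : {A : Set} {R : A → A → Set} {P : A → Set} → (∀ {x y} → R x y → P x → P y) →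
              ∀ {x y} → Star R x y → P x → P y
star-closed closed ε       p = p
star-closed closed (s ◅ r) p = star-closed closed r (closed s p)

module Triangulation {n : ℕ} {G : Graph n} (M : MaximalPlanar G)
                     {x y z : Fin n} (xy : Adj G x y) (xz : Adj G x z) (yz : Adj G y z) where

  open Maximal M using (Adj-chord; euler-connected)
  open Embedded (proj₁ M) public

  connected : ∀ a b → Star (Adj G) a b
  connected = Maximal.connected M (dart x y xy)

  open Homology (proj₁ M) connected (euler-connected (dart x y xy)) public using (constant; Separation; separation)

  same-tail : ∀ {P : Dart G → Set} → (∀ d → P d → P (next d)) → ∀ {d} e → tail d ≡ tail e → P d → P e
  same-tail inv e eq = reach-invariant inv (next-cyclic _ e eq)

  -- Otherwise `head d` has degree 1. Let `p` precede `d` in the rotation at `tail d`. If `p` also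
  -- leads to `head d`, then G is a single edge and has no triangle; if not, maximality makes
  -- `head p` a second neighbour of `head d`.
  no-leaf : ∀ d → head (face d) ≢ tail d
  no-leaf d h≡t with prev d
  ... | p , np , tp = case Adj-chord (reverse p) of λ where
      (inj₁ eq) → two-vertices (trans eq (cong head face-p))
      (inj₂ a)  → let up = subst (Adj G (head p)) (cong head face-p) a
                      q  = cong head (at-head (dart _ _ (Adj-sym {G = G} up)) refl)
                  in tail≢head p (trans tp (sym q))
    where
    face-p : face (reverse p) ≡ d
    face-p = trans (sym (next≡face-reverse p)) np
    at-head : ∀ e → tail e ≡ head d → e ≡ reverse d
    at-head e te = same-tail {P = _≡ reverse d}
      (λ { _ refl → dart-≡ (tail-face d) h≡t }) e (sym te) refl
    two-vertices : head p ≡ head d → ⊥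
    two-vertices hp = clash (all x) (all y) (all z)
      where
      p≡d : p ≡ d
      p≡d = dart-≡ tp hp
      at-tail : ∀ e → tail e ≡ tail d → e ≡ d
      at-tail e te = same-tail {P = _≡ d} (λ { _ refl → trans (cong next (sym p≡d)) np }) e (sym te) refl
      End : Fin n → Set
      End w = w ≡ tail d ⊎ w ≡ head d
      all : ∀ w → End w
      all w = star-closed {P = End} (λ where
        a (inj₁ refl) → inj₂ (cong head (at-tail (dart _ _ a) refl))
        a (inj₂ refl) → inj₁ (cong head (at-head (dart _ _ a) refl))) (connected (tail d) w) (inj₁ refl)
      ≢-of : ∀ {a b} → Adj G a b → a ≢ b
      ≢-of a refl = Adj-irrefl {G = G} a
      clash : End x → End y → End z → ⊥
      clash (inj₁ p) (inj₁ q) _ = ≢-of xy (trans p (sym q))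
      clash (inj₂ p) (inj₂ q) _ = ≢-of xy (trans p (sym q))
      clash (inj₁ p) (inj₂ q) (inj₁ r) = ≢-of xz (trans p (sym r))
      clash (inj₁ p) (inj₂ q) (inj₂ r) = ≢-of yz (trans q (sym r))
      clash (inj₂ p) (inj₁ q) (inj₁ r) = ≢-of yz (trans q (sym r))
      clash (inj₂ p) (inj₁ q) (inj₂ r) = ≢-of xz (trans p (sym r))

  Adj-third : ∀ d → Adj G (tail d) (head (face d))
  Adj-third d with Adj-chord d
  ... | inj₁ eq = contradiction (sym eq) (no-leaf d)
  ... | inj₂ a  = a

  -- Let d and face d run along the triangle tail d, head d, head (face d), and
  -- colour the faces according to this triangle. At head d, the walk of d fills
  -- the whole sector on its side of the triangle; hence a further vertex w on
  -- that walk has no neighbour head d, as it must by maximality.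
  head-face-face : ∀ d → head (face (face d)) ≡ tail d
  head-face-face d₁ = decidable-stable (head (face (face d₁)) ≟ tail d₁) absurd
    where
    d₂ d₃ : Dart G
    d₂ = face d₁
    d₃ = face d₂
    t₂ : tail d₂ ≡ head d₁
    t₂ = tail-face d₁
    open Separation (separation (adjacent d₁) (Adj-third d₁) (subst (λ v → Adj G v (head d₂)) t₂ (adjacent d₂)))
    open Sides (proj₁ M) (side ∘ walk) (λ d → cong side (walk-face d))
    α : Dart G → Bool
    α = side ∘ walk
    α₃ : α d₃ ≡ α d₂
    α₃ = cong side (walk-face d₂)
    absurd : head d₃ ≢ tail d₁ → ⊥
    absurd w≢v₁ = case sector of λ where
        (inj₁ b≡d₂) → w≢v₃ (cong head b≡d₂)
        (inj₂ αb)   → αb (trans (sym (joined b off-b)) (trans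
          (around-w (reverse b) refl) α₃))
      where
      w = head d₃
      b : Dart G
      b = dart (tail d₂) w (Adj-third d₂)
      w≢v₂ : w ≢ head d₁
      w≢v₂ eq = no-leaf d₂ (trans eq (sym t₂))
      w≢v₃ : w ≢ head d₂
      w≢v₃ eq = tail≢head d₃ (trans (tail-face d₂) (sym eq))
      On : Fin n → Set
      On v = v ≡ tail d₁ ⊎ v ≡ head d₁ ⊎ v ≡ head d₂
      off-w : ¬ On w
      off-w (inj₁ p)        = w≢v₁ p
      off-w (inj₂ (inj₁ p)) = w≢v₂ p
      off-w (inj₂ (inj₂ p)) = w≢v₃ p
      off-b : ¬ (On (tail b) × On (head b))
      off-b (_ , p) = off-w p
      around-w : ∀ e → tail e ≡ w → α e ≡ α d₃
      around-w e te = proj₂ (same-tail {P = λ e → tail e ≡ w × α e ≡ α d₃}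
        (λ e (t , p) → trans (next-tail e) t , trans (α-next e) (trans (joined e (λ (q , _) → off-w (subst On t q))) p))
        {d = reverse d₃} e (sym te) (refl , joined d₃ (λ (_ , q) → off-w q)))
      -- Turning round this vertex from `d₂`, the side changes at once and stays changed up to
      -- `reverse d₁`, the only other dart of the triangle here; but the successor of `reverse d₁`
      -- is `d₂` again.
      sector : b ≡ d₂ ⊎ α b ≢ α d₂
      sector = proj₂ (same-tail {P = λ e → tail e ≡ tail d₂ × (e ≡ d₂ ⊎ α e ≢ α d₂)}
        (λ e (t , p) → trans (next-tail e) t , turn e t p) {d = d₂} b refl (refl , inj₁ refl))
        where
        turn : ∀ e → tail e ≡ tail d₂ → e ≡ d₂ ⊎ α e ≢ α d₂ → next e ≡ d₂ ⊎ α (next e) ≢ α d₂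
        turn e t (inj₁ refl) = inj₂ λ eq → separated d₂
          (inj₂ (inj₁ t₂) , inj₂ (inj₂ refl)) (trans (sym (α-next d₂)) eq)
        turn e t (inj₂ αe) with e ≟ᵈ reverse d₁
        ... | yes refl = inj₁ refl
        ... | no e≢rd₁ = inj₂ λ eq → αe (trans (sym (joined e off-e)) (trans (sym (α-next e)) eq))
          where
          off-e : ¬ (On (tail e) × On (head e))
          off-e (_ , inj₁ p)        = e≢rd₁ (dart-≡ (trans t t₂) p)
          off-e (_ , inj₂ (inj₁ p)) = tail≢head e (trans t (trans t₂ (sym p)))
          off-e (_ , inj₂ (inj₂ p)) = αe (cong α (dart-≡ t p))

  face³ : ∀ d → face (face (face d)) ≡ d
  face³ d = dart-≡ (trans (tail-face (face (face d))) (head-face-face d))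
    (trans (head-face-face (face d)) (tail-face d))

  face≢ : ∀ d → face d ≢ d
  face≢ d eq = tail≢head d (trans (cong tail (sym eq)) (tail-face d))

  On-face : ∀ d {e} → walk d ≡ walk e → e ≡ d ⊎ e ≡ face d ⊎ e ≡ face (face d)
  On-face d {e} eq = reach-invariant {P = λ e → e ≡ d ⊎ e ≡ face d ⊎ e ≡ face (face d)}
    (λ { _ (inj₁ refl) → inj₂ (inj₁ refl) ; _ (inj₂ (inj₁ refl)) → inj₂ (inj₂ refl) ; _ (inj₂ (inj₂ refl)) → inj₁ (face³ d) })
    (Walk.≡⇒∼ eq) (inj₁ refl)

  walk-reverse : ∀ d → walk d ≢ walk (reverse d)
  walk-reverse d eq with On-face d eq
  ... | inj₁ p        = tail≢head d (cong head p)
  ... | inj₂ (inj₁ p) = no-leaf d (cong head (sym p))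
  ... | inj₂ (inj₂ p) = tail≢head (face d) (trans (tail-face d) (trans (cong tail p) (tail-face (face d))))

  private
    dartsAt : Pair n → List (Dart G)
    dartsAt (a , b) with Adj? G a b
    ... | yes ab = [ dart a b ab ]
    ... | no _   = []

    dart∈ : ∀ d → d ∈ dartsAt (tail d , head d)
    dart∈ d with Adj? G (tail d) (head d)
    ... | yes ab = here (dart-≡ refl refl)
    ... | no ¬ab = contradiction (adjacent d) ¬ab

  darts : List (Dart G)
  darts = concatMap dartsAt (pairs n)

  ∈-darts : ∀ d → d ∈ darts
  ∈-darts d = ∈-concatMap⁺ dartsAt (lose (∈-cartesianProduct⁺ (∈-allFin (tail d)) (∈-allFin (head d))) (dart∈ d))

  open CubicMultigraph _≟ᵈ_ face face³ face≢ using (Cubic; Bridge; PerfectMatching; petersen)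

  dual-cubic : Cubic darts reverse
  dual-cubic = record
    { φ∈      = λ _ → ∈-darts _
    ; rev∈    = λ _ → ∈-darts _
    ; rev-rev = λ {d} _ → reverse-reverse d
    ; rev≢    = λ {d} _ eq → tail≢head d (cong head eq)
    }

  -- A bridge of the dual would be the only edge between a set of faces and its complement, so the
  -- side would change just once round the tail of that edge.
  dual-bridgeless : ¬ Bridge darts reverse
  dual-bridgeless B = crosses (sym (no-single-change edge λ e te e≢ →
    sym (decidable-stable (side e Bool.≟ side (reverse e)) λ cr → case unique (∈-darts e) cr of λ where
      (inj₁ p)    → e≢ p
      (inj₂ refl) → tail≢head edge (sym te))))
    where
    open Bridge B
    open Sides (proj₁ M) side side-φ

  dual-matching : ¬ ¬ PerfectMatching darts reverse
  dual-matching = petersen dual-cubic dual-bridgeless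

-- Colouring the faces with three colours

module FaceColouring {n : ℕ} {G : Graph n} (M : MaximalPlanar G)
                     {x y z : Fin n} (xy : Adj G x y) (xz : Adj G x z) (yz : Adj G y z) where

  open Triangulation M xy xz yz

  Colouring : Set
  Colouring = Σ[ c ∈ (Fin #walks → Fin 3) ] (∀ d → c (walk d) ≢ c (walk (reverse d)))

  Corner : Dart G → Fin n → Set
  Corner e v = v ≡ tail e ⊎ v ≡ head e ⊎ v ≡ head (face e)

  corner-tail : ∀ e {g} → walk e ≡ walk g → Corner e (tail g)
  corner-tail e eq with On-face e eq
  ... | inj₁ refl        = inj₁ refl
  ... | inj₂ (inj₁ refl) = inj₂ (inj₁ (tail-face e))
  ... | inj₂ (inj₂ refl) = inj₂ (inj₂ (tail-face (face e)))

  corner-head : ∀ e {g} → walk e ≡ walk g → Corner e (head g)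
  corner-head e eq with On-face e eq
  ... | inj₁ refl        = inj₂ (inj₁ refl)
  ... | inj₂ (inj₁ refl) = inj₂ (inj₂ refl)
  ... | inj₂ (inj₂ refl) = inj₁ (head-face-face e)

  walk-next : ∀ d → walk (next d) ≡ walk (reverse d)
  walk-next d = trans (cong walk (next≡face-reverse d)) (walk-face (reverse d))

  walk-face² : ∀ d → walk (face (face d)) ≡ walk d
  walk-face² d = trans (walk-face (face d)) (walk-face d)

  face-face-next : ∀ d → face (face (next d)) ≡ reverse d
  face-face-next d = face-injective (trans (face³ (next d)) (next≡face-reverse d))

  head-face-next : ∀ d → head (face (next d)) ≡ head d
  head-face-next d = trans (sym (tail-face (face (next d)))) (cong tail (face-face-next d))

  next≢ : ∀ d → next d ≢ d
  next≢ d eq = no-leaf (reverse d) (cong head (trans (sym (next≡face-reverse d)) eq))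

  heads-≢ : ∀ {d e : Dart G} → tail d ≡ tail e → d ≢ e → head d ≢ head e
  heads-≢ t d≢e h = d≢e (dart-≡ t h)

  -- At a vertex of degree 2, both faces have the same three edges. Crossing an edge of either leads
  -- to the other, so there are no further faces and two colours suffice.
  two-faces : ∀ d → next (next d) ≡ d → Colouring
  two-faces d nnd = c , proper
    where
    A B : Fin #walks
    A = walk d
    B = walk (reverse d)
    face-face-d : face (face d) ≡ reverse (next d)
    face-face-d = trans (cong (face ∘ face) (sym nnd)) (face-face-next (next d))
    rev-face-d : reverse (face d) ≡ face (next d)
    rev-face-d = dart-≡ (trans (trans (sym (tail-face (face d))) (cong tail face-face-d)) (sym (tail-face (next d))))
                   (trans (tail-face d) (sym (head-face-next d)))
    from-A : ∀ e → walk e ≡ A → walk (reverse e) ≡ B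
    from-A e eq with On-face d (sym eq)
    ... | inj₁ refl        = refl
    ... | inj₂ (inj₁ refl) = trans (cong walk rev-face-d) (trans (walk-face (next d)) (walk-next d))
    ... | inj₂ (inj₂ refl) = trans (cong (walk ∘ reverse) face-face-d)
      (trans (cong walk (reverse-reverse (next d))) (walk-next d))
    from-B : ∀ e → walk e ≡ B → walk (reverse e) ≡ A
    from-B e eq with On-face (next d) (trans (walk-next d) (sym eq))
    ... | inj₁ refl        = trans (cong walk (sym face-face-d)) (walk-face² d)
    ... | inj₂ (inj₁ refl) = trans (cong walk (trans (cong reverse (sym rev-face-d)) (reverse-reverse (face d)))) (walk-face d)
    ... | inj₂ (inj₂ refl) = cong walk (trans (cong reverse (face-face-next d)) (reverse-reverse d))
    AB? : ∀ e → Dec (walk e ≡ A ⊎ walk e ≡ B)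
    AB? e = (walk e ≟ A) ⊎-dec (walk e ≟ B)
    all : ∀ e → walk e ≡ A ⊎ walk e ≡ B
    all e = decidable-stable (AB? e) λ ¬ab → contradiction
      (trans (sym (dec-true (AB? d) (inj₁ refl))) (trans
        (constant (λ e → does (AB? e)) (λ e → cong (λ w → does ((w ≟ A) ⊎-dec (w ≟ B))) (walk-face e))
          (λ e → does-⇔ (mk⇔ (λ p → subst (λ e → walk e ≡ A ⊎ walk e ≡ B) (reverse-reverse e) (swap (reverse e) p)) (swap e)) (AB? (reverse e)) (AB? e)) d e)
        (dec-false (AB? e) ¬ab))) λ ()
      where
      swap : ∀ e → walk e ≡ A ⊎ walk e ≡ B → walk (reverse e) ≡ A ⊎ walk (reverse e) ≡ B
      swap e (inj₁ p) = inj₂ (from-A e p)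
      swap e (inj₂ p) = inj₁ (from-B e p)
    c : Fin #walks → Fin 3
    c w = if does (w ≟ A) then 0F else 1F
    c-A : ∀ {w} → w ≡ A → c w ≡ 0F
    c-A {w} p = cong (if_then 0F else 1F) (dec-true (w ≟ A) p)
    c-B : ∀ {w} → w ≡ B → c w ≡ 1F
    c-B {w} p = cong (if_then 0F else 1F) (dec-false (w ≟ A) (λ q → walk-reverse d (trans (sym q) p)))
    proper : ∀ e → c (walk e) ≢ c (walk (reverse e))
    proper e eq = case all e of λ where
      (inj₁ p) → contradiction (trans (sym (c-A p)) (trans eq (c-B (from-A e p)))) λ ()
      (inj₂ p) → contradiction (trans (sym (c-B p)) (trans eq (c-A (from-B e p)))) λ ()

  module _ (not-two : ∀ d → next (next d) ≢ d) (three : ∀ d → next (next (next d)) ≡ d) where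

    private
      around : ∀ d e → tail d ≡ tail e → e ≡ d ⊎ e ≡ next d ⊎ e ≡ next (next d)
      around d e eq = same-tail {P = λ e → e ≡ d ⊎ e ≡ next d ⊎ e ≡ next (next d)}
        (λ { _ (inj₁ refl) → inj₂ (inj₁ refl) ; _ (inj₂ (inj₁ refl)) → inj₂ (inj₂ refl) ; _ (inj₂ (inj₂ refl)) → inj₁ (three d) })
        e eq (inj₁ refl)

      head-face : ∀ d → head (face d) ≡ head (next (next d))
      head-face d = trans (cong (head ∘ face) (sym (three d))) (head-face-next (next (next d)))

      next-next-reverse : ∀ d → head (next (next (reverse d))) ≡ head (next d)
      next-next-reverse d = trans (cong head (next-injective (trans (three (reverse d)) (sym turn)))) (tail-face (next d))
        where
        turn : next (reverse (face (next d))) ≡ reverse d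
        turn = face-face-next d

      neighbours : ∀ d e → tail e ≡ head d →
                   head e ≡ tail d ⊎ head e ≡ head (next d) ⊎ head e ≡ head (next (next d))
      neighbours d e te with around (reverse d) e (sym te)
      ... | inj₁ refl        = inj₁ refl
      ... | inj₂ (inj₁ refl) = inj₂ (inj₂ (head-face d))
      ... | inj₂ (inj₂ refl) = inj₂ (inj₁ (next-next-reverse d))

      d₀ d₁ d₂ : Dart G
      d₀ = dart x y xy
      d₁ = next d₀
      d₂ = next d₁

      corners : Fin 4 → Fin n
      corners 0F = tail d₀
      corners 1F = head d₀
      corners 2F = head d₁
      corners 3F = head d₂

      t₁ : tail d₁ ≡ tail d₀
      t₁ = next-tail d₀

      t₂ : tail d₂ ≡ tail d₀
      t₂ = trans (next-tail d₁) t₁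

      opposite : ∀ d → Adj G (head d) (head (next (next d)))
      opposite d = subst₂ (Adj G) (tail-face d) (head-face d) (adjacent (face d))

      adjacent-corners : ∀ i j → i ≢ j → Adj G (corners i) (corners j)
      adjacent-corners 0F 1F _ = adjacent d₀
      adjacent-corners 0F 2F _ = subst (λ v → Adj G v (head d₁)) t₁ (adjacent d₁)
      adjacent-corners 0F 3F _ = subst (λ v → Adj G v (head d₂)) t₂ (adjacent d₂)
      adjacent-corners 1F 3F _ = opposite d₀
      adjacent-corners 2F 1F _ = subst (Adj G (head d₁)) (cong head (three d₀)) (opposite d₁)
      adjacent-corners 3F 2F _ = subst (Adj G (head d₂)) (cong head (three d₁)) (opposite d₂)
      adjacent-corners 1F 0F i≢j = Adj-sym {G = G} (adjacent-corners 0F 1F (≢-sym i≢j))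
      adjacent-corners 2F 0F i≢j = Adj-sym {G = G} (adjacent-corners 0F 2F (≢-sym i≢j))
      adjacent-corners 3F 0F i≢j = Adj-sym {G = G} (adjacent-corners 0F 3F (≢-sym i≢j))
      adjacent-corners 3F 1F i≢j = Adj-sym {G = G} (adjacent-corners 1F 3F (≢-sym i≢j))
      adjacent-corners 1F 2F i≢j = Adj-sym {G = G} (adjacent-corners 2F 1F (≢-sym i≢j))
      adjacent-corners 2F 3F i≢j = Adj-sym {G = G} (adjacent-corners 3F 2F (≢-sym i≢j))
      adjacent-corners 0F 0F i≢j = contradiction refl i≢j
      adjacent-corners 1F 1F i≢j = contradiction refl i≢j
      adjacent-corners 2F 2F i≢j = contradiction refl i≢j
      adjacent-corners 3F 3F i≢j = contradiction refl i≢j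

      corners-injective : ∀ {i j} → corners i ≡ corners j → i ≡ j
      corners-injective {i} {j} eq = decidable-stable (i ≟ j) λ i≢j →
        Adj-irrefl {G = G} (subst (Adj G (corners i)) (sym eq) (adjacent-corners i j i≢j))

      Corners : Fin n → Set
      Corners v = ∃[ i ] corners i ≡ v

      closed : ∀ {v w} → Adj G v w → Corners v → Corners w
      closed a (0F , refl) with around d₀ (dart _ _ a) refl
      ... | inj₁ p        = 1F , cong head (sym p)
      ... | inj₂ (inj₁ p) = 2F , cong head (sym p)
      ... | inj₂ (inj₂ p) = 3F , cong head (sym p)
      closed a (1F , refl) with neighbours d₀ (dart _ _ a) refl
      ... | inj₁ p        = 0F , sym p
      ... | inj₂ (inj₁ p) = 2F , sym p
      ... | inj₂ (inj₂ p) = 3F , sym p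
      closed a (2F , refl) with neighbours d₁ (dart _ _ a) refl
      ... | inj₁ p        = 0F , sym (trans p t₁)
      ... | inj₂ (inj₁ p) = 3F , sym p
      ... | inj₂ (inj₂ p) = 1F , sym (trans p (cong head (three d₀)))
      closed a (3F , refl) with neighbours d₂ (dart _ _ a) refl
      ... | inj₁ p        = 0F , sym (trans p t₂)
      ... | inj₂ (inj₁ p) = 1F , sym (trans p (cong head (three d₀)))
      ... | inj₂ (inj₂ p) = 2F , sym (trans p (cong head (three d₁)))

      cover : ∀ v → Corners v
      cover v = star-closed closed (connected (tail d₀) v) (0F , refl)

      index-of : Fin n → Fin 4
      index-of v = proj₁ (cover v)

      corners-index : ∀ v → corners (index-of v) ≡ v
      corners-index v = proj₂ (cover v)

    -- The three faces at a vertex make its three neighbours pairwise adjacent. Having degree 3,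
    -- these have no further neighbours, and by connectedness there are no further vertices.
    all-degree-three : G ≅ K 4
    all-degree-three = mk↔ₛ′ index-of corners (λ i → corners-injective (corners-index (corners i))) corners-index , same
      where
      same : ∀ u v → adj G u v ≡ not (does (index-of u ≟ index-of v))
      same u v with u ≟ v
      ... | yes refl = trans (irrefl G u) (sym (cong not (dec-true (index-of u ≟ index-of u) refl)))
      ... | no u≢v   = trans
        (Equivalence.to T-≡ (subst₂ (Adj G) (corners-index u) (corners-index v) (adjacent-corners _ _ i≢j)))
        (sym (cong not (dec-false (index-of u ≟ index-of v) i≢j)))
        where
        i≢j : index-of u ≢ index-of v
        i≢j eq = u≢v (trans (sym (corners-index u)) (trans (cong corners eq) (corners-index v)))

  open import Data.List.Membership.DecPropositional (_≟_ {#walks}) using (_∈?_)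

  private
    another : ∀ (a b : Fin 3) → ∃[ k ] k ≢ a × k ≢ b
    another = from-yes (all? {n = 3} λ a → all? {n = 3} λ b → any? {n = 3} λ k → ¬? (k ≟ a) ×-dec ¬? (k ≟ b))

  -- At a vertex of degree at least 4, the faces X and Y are not adjacent but
  -- have the common neighbour V, and the other faces remain connected without
  -- X and Y. As in Brooks' theorem, X and Y receive the same colour, and the
  -- remaining faces are coloured greedily towards V.
  module Greedy (d : Dart G) (not-two : next (next d) ≢ d) (not-three : next (next (next d)) ≢ d) where

    private
      e₁ e₂ e₃ : Dart G
      e₁ = next d
      e₂ = next e₁
      e₃ = next e₂

      X V Y : Fin #walks
      X = walk e₁
      V = walk e₂
      Y = walk e₃

      t₁ : tail e₁ ≡ tail d
      t₁ = next-tail d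
      t₂ : tail e₂ ≡ tail d
      t₂ = trans (next-tail e₁) t₁
      t₃ : tail e₃ ≡ tail d
      t₃ = trans (next-tail e₂) t₂

      V-reverse : walk (reverse e₁) ≡ V
      V-reverse = sym (walk-next e₁)

      Y-reverse : walk (reverse e₂) ≡ Y
      Y-reverse = sym (walk-next e₂)

      V≢X : V ≢ X
      V≢X eq = walk-reverse e₁ (trans (sym eq) (sym V-reverse))

      V≢Y : V ≢ Y
      V≢Y eq = walk-reverse e₂ (trans eq (sym Y-reverse))

      apart : ∀ {u v : Dart G} → tail u ≡ tail d → tail v ≡ tail d → u ≢ v → head u ≢ head v
      apart p q = heads-≢ (trans p (sym q))

      off-tail : ∀ {u : Dart G} → tail u ≡ tail d → head u ≢ tail d
      off-tail {u} p q = tail≢head u (trans p (sym q))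

      -- Apart from `tail d`, the corners of X are the heads of `d` and `e₁`, those of Y the heads
      -- of `e₂` and `e₃`. As the degree is at least 4, these are four different neighbours.
      X∩Y : ∀ {v} → Corner e₁ v → Corner e₃ v → v ≡ tail d
      X∩Y (inj₁ p) _ = trans p t₁
      X∩Y _ (inj₁ p) = trans p t₃
      X∩Y (inj₂ (inj₁ p)) (inj₂ (inj₁ q)) = contradiction (trans (sym p) q)
        (apart t₁ t₃ λ eq → not-two (sym (next-injective eq)))
      X∩Y (inj₂ (inj₁ p)) (inj₂ (inj₂ q)) = contradiction (trans (sym p) (trans q (head-face-next e₂)))
        (apart t₁ t₂ (≢-sym (next≢ e₁)))
      X∩Y (inj₂ (inj₂ p)) (inj₂ (inj₁ q)) = contradiction (trans (sym (trans p (head-face-next d))) q)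
        (apart refl t₃ (≢-sym not-three))
      X∩Y (inj₂ (inj₂ p)) (inj₂ (inj₂ q)) = contradiction (trans (sym (trans p (head-face-next d))) (trans q (head-face-next e₂)))
        (apart refl t₂ (≢-sym not-two))

      not-adjacent : ∀ e → walk e ≡ X → walk (reverse e) ≢ Y
      not-adjacent e p q = tail≢head e (trans
        (X∩Y (corner-tail e₁ (sym p)) (corner-head e₃ (sym q)))
        (sym (X∩Y (corner-head e₁ (sym p)) (corner-tail e₃ (sym q)))))

      In : List (Fin #walks) → Fin #walks → Set
      In U f = f ∈ U ⊎ f ≡ X ⊎ f ≡ Y

      In? : ∀ U f → Dec (In U f)
      In? U f = (f ∈? U) ⊎-dec (f ≟ X) ⊎-dec (f ≟ Y)

      -- A partial colouring: `c` is total, but only its values on X, Y and the faces of `U` count.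
      record Coloured (U : List (Fin #walks)) (c : Fin #walks → Fin 3) : Set where
        field
          at-X   : c X ≡ 0F
          at-Y   : c Y ≡ 0F
          proper : ∀ e → In U (walk e) → In U (walk (reverse e)) → c (walk e) ≢ c (walk (reverse e))

      recolour : ∀ {U U′ c f} k → Coloured U′ c → f ≢ X → f ≢ Y →
                 (∀ {g} → g ∈ U → g ≡ f ⊎ g ∈ U′) →
                 (∀ e → walk e ≡ f → In U′ (walk (reverse e)) → k ≢ c (walk (reverse e))) →
                 Σ[ c ∈ (Fin #walks → Fin 3) ] Coloured U c
      recolour {U} {U′} {c} {f} k C f≢X f≢Y split free = c⁺ , record
        { at-X = trans (old (≢-sym f≢X)) at-X ; at-Y = trans (old (≢-sym f≢Y)) at-Y ; proper = proper⁺ }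
        where
        open Coloured C
        c⁺ : Fin #walks → Fin 3
        c⁺ g = if does (g ≟ f) then k else c g
        new : ∀ {g} → g ≡ f → c⁺ g ≡ k
        new {g} p = cong (if_then k else c g) (dec-true (g ≟ f) p)
        old : ∀ {g} → g ≢ f → c⁺ g ≡ c g
        old {g} p = cong (if_then k else c g) (dec-false (g ≟ f) p)
        In′ : ∀ {g} → g ≢ f → In U g → In U′ g
        In′ g≢f (inj₁ g∈) = [ (λ p → contradiction p g≢f) , inj₁ ]′ (split g∈)
        In′ g≢f (inj₂ p)  = inj₂ p
        proper⁺ : ∀ e → In U (walk e) → In U (walk (reverse e)) → c⁺ (walk e) ≢ c⁺ (walk (reverse e))
        proper⁺ e i j eq with walk e ≟ f | walk (reverse e) ≟ f
        ... | yes p | yes q = walk-reverse e (trans p (sym q))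
        ... | yes p | no q  = free e p (In′ q j) eq
        ... | no p  | yes q = free (reverse e) q (subst (In U′) (cong walk (sym (reverse-reverse e))) (In′ p i))
          (trans (sym eq) (cong (c ∘ walk) (sym (reverse-reverse e))))
        ... | no p  | no q  = proper e (In′ p i) (In′ q j) eq

      -- The connectedness of the faces without X and Y, in the form that a set avoiding V and
      -- closed under adjacency outside X and Y is empty. A set of faces has an even number of
      -- boundary edges at each vertex. Applied to `U` together with X and Y, this shows that all
      -- edges of X and Y are boundary edges, so `U` touches neither and is closed under all
      -- adjacencies.
      module Reachable {U : List (Fin #walks)} (X∉ : X ∉ U) (Y∉ : Y ∉ U) (V∉ : V ∉ U)
        (closed : ∀ e → walk e ∈ U → In U (walk (reverse e))) where

        Done : Fin #walks → Set
        Done f = ¬ In U f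

        α : Dart G → Bool
        α e = does (In? U (walk e))

        open Sides (proj₁ M) α (λ e → cong (λ f → does (In? U f)) (walk-face e))

        α-true : ∀ {e} → In U (walk e) → α e ≡ true
        α-true {e} = dec-true (In? U (walk e))

        α-false : ∀ {e} → Done (walk e) → α e ≡ false
        α-false {e} = dec-false (In? U (walk e))

        Flip : Dart G → Set
        Flip e = α (reverse e) ≢ α e

        flip-reverse : ∀ {e} → Flip e → Flip (reverse e)
        flip-reverse {e} f eq = f (trans (sym eq) (cong α (reverse-reverse e)))

        XY : Fin #walks → Set
        XY f = f ≡ X ⊎ f ≡ Y

        flip-at : ∀ e → Flip e → XY (walk e) ⊎ XY (walk (reverse e))
        flip-at e fl with In? U (walk e) | In? U (walk (reverse e))
        ... | yes (inj₂ p) | _ = inj₁ p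
        ... | _ | yes (inj₂ p) = inj₂ p
        ... | yes (inj₁ p) | no q = contradiction (closed e p) q
        ... | no p | yes (inj₁ q) = contradiction (subst (In U) (cong walk (reverse-reverse e)) (closed (reverse e) q)) p
        ... | yes p@(inj₁ _) | yes q@(inj₁ _) = contradiction (trans (α-true q) (sym (α-true p))) fl
        ... | no p | no q = contradiction (trans (α-false q) (sym (α-false p))) fl

        -- At `head e` the boundary has no edges other than the two that its face has there; parity
        -- then makes it contain both or neither.
        Sector : Dart G → Set
        Sector e = ∀ g → tail g ≡ head e → Flip g → g ≡ reverse e ⊎ g ≡ face e

        sector : ∀ {F F′} e e′ → walk e ≡ F → walk e′ ≡ F′ → (∀ {f} → XY f → f ≡ F ⊎ f ≡ F′) →
                 ¬ Corner e′ (head e) → Sector e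
        sector e e′ refl refl XY⇒ off g tg fl with flip-at g fl
        ... | inj₁ xy with XY⇒ xy
        ...   | inj₂ p = contradiction (subst (Corner e′) tg (corner-tail e′ (sym p))) off
        ...   | inj₁ p with On-face e (sym p)
        ...     | inj₁ refl        = contradiction tg (tail≢head e)
        ...     | inj₂ (inj₁ q)    = inj₂ q
        ...     | inj₂ (inj₂ refl) = contradiction (trans (tail-face e) (trans (sym tg) (tail-face (face e)))) (tail≢head (face e))
        sector e e′ refl refl XY⇒ off g tg fl | inj₂ xy with XY⇒ xy
        ...   | inj₂ p = contradiction (subst (Corner e′) tg (corner-head e′ (sym p))) off
        ...   | inj₁ p with On-face e (sym p)
        ...     | inj₁ q           = inj₁ (trans (sym (reverse-reverse g)) (cong reverse q))
        ...     | inj₂ (inj₁ q)    = contradiction (trans (tail-face e) (trans (sym tg) (cong head q))) (tail≢head (face e))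
        ...     | inj₂ (inj₂ q)    = contradiction (trans (sym (head-face-face e)) (trans (sym (cong head q)) tg)) (tail≢head e)

        flip-forward : ∀ e → Sector e → Flip e → Flip (face e)
        flip-forward e sec fl eq = flip-reverse fl (no-single-change (reverse e) λ g tg g≢ →
          decidable-stable (α (reverse g) Bool.≟ α g) λ fg → case sec g tg fg of λ where
            (inj₁ p)    → g≢ p
            (inj₂ refl) → fg eq)

        flip-back : ∀ e → Sector e → Flip (face e) → Flip e
        flip-back e sec fl eq = fl (no-single-change (face e) λ g tg g≢ →
          decidable-stable (α (reverse g) Bool.≟ α g) λ fg → case sec g (trans tg (tail-face e)) fg of λ where
            (inj₁ refl) → fg (trans (cong α (reverse-reverse e)) (sym eq))
            (inj₂ p)    → g≢ p)

        V-done : Done V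
        V-done = [ V∉ , [ V≢X , V≢Y ]′ ]′

        in-X : ∀ {e} → walk e ≡ X → α e ≡ true
        in-X p = α-true (inj₂ (inj₁ p))

        in-Y : ∀ {e} → walk e ≡ Y → α e ≡ true
        in-Y p = α-true (inj₂ (inj₂ p))

        XY⇒YX : ∀ {f} → XY f → f ≡ Y ⊎ f ≡ X
        XY⇒YX (inj₁ p) = inj₂ p
        XY⇒YX (inj₂ p) = inj₁ p

        -- The boundary contains `e₁`, which separates X from V, and is followed round X through the
        -- two corners that do not belong to Y. The corner `tail d`, shared with Y, is never passed.
        -- For Y the same is done backwards from `e₂`.
        flip-X : ∀ {e} → walk e ≡ X → Flip e
        flip-X p = case On-face e₁ (sym p) of λ where
            (inj₁ refl)        → flip₁
            (inj₂ (inj₁ refl)) → flip₂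
            (inj₂ (inj₂ refl)) → flip-forward (face e₁)
              (sector (face e₁) e₃ (walk-face e₁) refl id λ c → off-tail {d} refl
                (trans (sym (head-face-next d)) (X∩Y (inj₂ (inj₂ refl)) c))) flip₂
          where
          flip₁ : Flip e₁
          flip₁ eq = contradiction (trans (sym (α-false (subst Done (sym V-reverse) V-done))) (trans eq (in-X refl))) λ ()
          flip₂ : Flip (face e₁)
          flip₂ = flip-forward e₁
            (sector e₁ e₃ refl refl id λ c → off-tail {e₁} t₁ (X∩Y (inj₂ (inj₁ refl)) c)) flip₁

        flip-Y : ∀ {e} → walk e ≡ Y → Flip e
        flip-Y p = case On-face e₃ (sym p) of λ where
            (inj₂ (inj₂ refl)) → flip₃
            (inj₂ (inj₁ refl)) → flip₂
            (inj₁ refl)        → flip-back e₃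
              (sector e₃ e₁ refl refl XY⇒YX λ c → off-tail {e₃} t₃ (X∩Y c (inj₂ (inj₁ refl)))) flip₂
          where
          start : Flip e₂
          start eq = contradiction (trans (sym (in-Y Y-reverse)) (trans eq (α-false V-done))) λ ()
          flip₃ : Flip (face (face e₃))
          flip₃ = subst Flip (sym (face-face-next e₂)) (flip-reverse start)
          flip₂ : Flip (face e₃)
          flip₂ = flip-back (face e₃)
            (sector (face e₃) e₁ (walk-face e₃) refl XY⇒YX λ c → off-tail {e₂} t₂
              (trans (sym (head-face-next e₂)) (X∩Y c (inj₂ (inj₂ refl))))) flip₃

        closed′ : ∀ e → walk e ∈ U → walk (reverse e) ∈ U
        closed′ e e∈ with closed e e∈
        ... | inj₁ p = p
        ... | inj₂ p = contradiction
          (trans (cong α (reverse-reverse e)) (trans (α-true (inj₁ e∈)) (sym (α-true (inj₂ p)))))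
          ([ flip-X , flip-Y ]′ p)

        empty : ∀ {f} → f ∉ U
        empty {f} f∈ = contradiction
          (trans (sym (dec-true (walk (Walk.member f) ∈? U) (subst (_∈ U) (sym (Walk.class-member f)) f∈)))
            (trans (constant (λ e → does (walk e ∈? U)) (λ e → cong (λ f → does (f ∈? U)) (walk-face e))
              (λ e → does-⇔ (mk⇔ (λ p → subst (_∈ U) (cong walk (reverse-reverse e)) (closed′ (reverse e) p)) (closed′ e))
                (walk (reverse e) ∈? U) (walk e ∈? U)) _ e₂)
            (dec-false (V ∈? U) V∉))) λ ()

      -- A face of `U` with a neighbour outside `U`, X and Y can be coloured last: at most two of
      -- its three neighbours then have colours. If there is no such face, `U` is closed in the
      -- sense of `Reachable` and cannot be nonempty.
      greedy : ∀ m U → length U < m → X ∉ U → Y ∉ U → V ∉ U →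
               ¬ ¬ (Σ[ c ∈ (Fin #walks → Fin 3) ] Coloured U c)
      greedy (suc m) [] _ X∉ Y∉ V∉ k = k ((λ _ → 0F) , record { at-X = refl ; at-Y = refl ; proper = λ e i j _ → clash e i j })
        where
        clash : ∀ e → In [] (walk e) → In [] (walk (reverse e)) → ⊥
        clash e (inj₂ (inj₁ p)) (inj₂ (inj₁ q)) = walk-reverse e (trans p (sym q))
        clash e (inj₂ (inj₂ p)) (inj₂ (inj₂ q)) = walk-reverse e (trans p (sym q))
        clash e (inj₂ (inj₁ p)) (inj₂ (inj₂ q)) = not-adjacent e p q
        clash e (inj₂ (inj₂ p)) (inj₂ (inj₁ q)) = not-adjacent (reverse e) q (trans (cong walk (reverse-reverse e)) p)
      greedy (suc m) U@(_ ∷ _) (s≤s U≤m) X∉ Y∉ V∉ k = Reachable.empty X∉ Y∉ V∉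
        (λ e e∈ → decidable-stable (In? U (walk (reverse e))) (extend e e∈)) (here refl)
        where
        extend : ∀ e → walk e ∈ U → ¬ ¬ In U (walk (reverse e))
        extend e e∈ ¬done = greedy m U′ (ℕ.<-≤-trans (List.filter-notAll keep? U (lose e∈ λ ¬p → ¬p refl)) U≤m)
            (X∉ ∘ back) (Y∉ ∘ back) (V∉ ∘ back) λ (c , C) →
              let a , ≢₁ , ≢₂ = another (c (walk (reverse (face e)))) (c (walk (reverse (face (face e)))))
              in k (recolour a C (λ p → X∉ (subst (_∈ U) p e∈)) (λ p → Y∉ (subst (_∈ U) p e∈)) split
                   λ g p i → case On-face e (sym p) of λ where
                     (inj₁ refl)        → contradiction ([ inj₁ ∘ back , inj₂ ]′ i) ¬done
                     (inj₂ (inj₁ refl)) → ≢₁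
                     (inj₂ (inj₂ refl)) → ≢₂)
          where
          keep? : ∀ g → Dec (¬ g ≡ walk e)
          keep? g = ¬? (g ≟ walk e)
          U′ : List (Fin #walks)
          U′ = filter keep? U
          back : ∀ {g} → g ∈ U′ → g ∈ U
          back g∈ = proj₁ (∈-filter⁻ keep? {xs = U} g∈)
          split : ∀ {g} → g ∈ U → g ≡ walk e ⊎ g ∈ U′
          split {g} g∈ with g ≟ walk e
          ... | yes p = inj₁ p
          ... | no p  = inj₂ (∈-filter⁺ keep? g∈ p)

    brooks : ¬ ¬ Colouring
    brooks k = greedy (suc (length U)) U ℕ.≤-refl (λ X∈ → proj₁ (kept X∈) refl)
      (λ Y∈ → proj₁ (proj₂ (kept Y∈)) refl) (λ V∈ → proj₂ (proj₂ (kept V∈)) refl) λ (c , C) →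
        let open Coloured C
            -- V is coloured last. Its neighbours X and Y share the colour `0F`, so only two colours
            -- are forbidden although all three neighbours are coloured.
            a , ≢₁ , ≢₂ = another 0F (c (walk (reverse (face e₂))))
            c⁺ , C⁺ = recolour {U = V ∷ U} a C V≢X V≢Y (λ { (here p) → inj₁ p ; (there p) → inj₂ p })
              λ g p _ → case On-face e₂ (sym p) of λ where
                (inj₁ refl)        → λ eq → ≢₁ (trans eq (trans (cong c Y-reverse) at-Y))
                (inj₂ (inj₁ refl)) → ≢₂
                (inj₂ (inj₂ refl)) → λ eq → ≢₁ (trans eq (trans (cong (c ∘ walk)
                  (trans (cong reverse (face-face-next e₁)) (reverse-reverse e₁))) at-X))
        in k (c⁺ , λ e → Coloured.proper C⁺ e (everywhere (walk e)) (everywhere (walk (reverse e))))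
      where
      others? : ∀ f → Dec (f ≢ X × f ≢ Y × f ≢ V)
      others? f = ¬? (f ≟ X) ×-dec ¬? (f ≟ Y) ×-dec ¬? (f ≟ V)
      U : List (Fin #walks)
      U = filter others? (allFin #walks)
      kept : ∀ {f} → f ∈ U → f ≢ X × f ≢ Y × f ≢ V
      kept f∈ = proj₂ (∈-filter⁻ others? {xs = allFin #walks} f∈)
      everywhere : ∀ f → In (V ∷ U) f
      everywhere f with f ≟ X | f ≟ Y | f ≟ V
      ... | yes p | _ | _ = inj₂ (inj₁ p)
      ... | no _ | yes p | _ = inj₂ (inj₂ p)
      ... | no _ | no _ | yes p = inj₁ (here p)
      ... | no p | no q | no r = inj₁ (there (∈-filter⁺ others? (∈-allFin f) (p , q , r)))

  colouring : ¬ (G ≅ K 4) → ¬ ¬ Colouring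
  colouring ≇K₄ k = ≇K₄ (all-degree-three not-two λ d →
    decidable-stable (next (next (next d)) ≟ᵈ d) λ not-three → Greedy.brooks d (not-two d) not-three k)
    where
    not-two : ∀ d → next (next d) ≢ d
    not-two d eq = k (two-faces d eq)

-- Sums over darts modulo 2

module DartSum {n : ℕ} {G : Graph n} (E : PlaneEmbedding G) where
  open Embedded E
  open Sum (CommutativeRing.+-commutativeMonoid Bool.xor-∧-commutativeRing)
    using (sum; sum-cong-≗; ∑-distrib-+; ∑-comm; sum-permute)

  sum-single : ∀ {m} (f : Fin m → Bool) j → (∀ i → i ≢ j → f i ≡ false) → sum f ≡ f j
  sum-single {suc m} f zero others = trans (cong (f zero xor_) (sum-zero (λ i → others (suc i) λ ()))) (xor-identityʳ (f zero))
    where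
    sum-zero : ∀ {m} {f : Fin m → Bool} → (∀ i → f i ≡ false) → sum f ≡ false
    sum-zero {zero}  _ = refl
    sum-zero {suc m} p = cong₂ _xor_ (p zero) (sum-zero (p ∘ suc))
  sum-single {suc m} f (suc j) others =
    cong₂ _xor_ (others zero λ ()) (sum-single (f ∘ suc) j (λ i i≢j → others (suc i) (i≢j ∘ Fin.suc-injective)))

  -- Extension by zero to all pairs of vertices, which turns a sum over darts into a double sum over
  -- `Fin n`.
  at : (Dart G → Bool) → Fin n → Fin n → Bool
  at F x y with Adj? G x y
  ... | yes a = F (dart x y a)
  ... | no _  = false

  at-dart : ∀ F d → at F (tail d) (head d) ≡ F d
  at-dart F d with Adj? G (tail d) (head d)
  ... | yes _ = cong F (dart-≡ refl refl)
  ... | no ¬a = contradiction (adjacent d) ¬a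

  at-none : ∀ F {x y} → ¬ Adj G x y → at F x y ≡ false
  at-none F {x} {y} ¬a with Adj? G x y
  ... | yes a = contradiction a ¬a
  ... | no _  = refl

  ∑ᵈ : (Dart G → Bool) → Bool
  ∑ᵈ F = sum λ x → sum λ y → at F x y

  ∑ᵈ-cong : ∀ {F H} → (∀ d → F d ≡ H d) → ∑ᵈ F ≡ ∑ᵈ H
  ∑ᵈ-cong {F} {H} eq = sum-cong-≗ λ x → sum-cong-≗ λ y → same x y
    where
    same : ∀ x y → at F x y ≡ at H x y
    same x y with Adj? G x y
    ... | yes a = eq (dart x y a)
    ... | no _  = refl

  ∑ᵈ-xor : ∀ F H → ∑ᵈ (λ d → F d xor H d) ≡ ∑ᵈ F xor ∑ᵈ H
  ∑ᵈ-xor F H = trans (sum-cong-≗ λ x → trans (sum-cong-≗ λ y → split x y) (∑-distrib-+ (at F x) (at H x)))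
    (∑-distrib-+ (λ x → sum (at F x)) (λ x → sum (at H x)))
    where
    split : ∀ x y → at (λ d → F d xor H d) x y ≡ at F x y xor at H x y
    split x y with Adj? G x y
    ... | yes _ = refl
    ... | no _  = refl

  ∑ᵈ-reverse : ∀ F → ∑ᵈ (F ∘ reverse) ≡ ∑ᵈ F
  ∑ᵈ-reverse F = trans (sum-cong-≗ λ x → sum-cong-≗ λ y → swap x y) (∑-comm (λ x y → at F y x))
    where
    swap : ∀ x y → at (F ∘ reverse) x y ≡ at F y x
    swap x y with Adj? G x y
    ... | yes a = sym (at-dart F (reverse (dart x y a)))
    ... | no ¬a = sym (at-none F (¬a ∘ Adj-sym {G = G}))

  -- At each vertex, `next` permutes the neighbours; left fixed on all other vertices, it becomes a
  -- permutation of `Fin n`, under which the inner sum is invariant.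
  ∑ᵈ-next : ∀ F → ∑ᵈ (F ∘ next) ≡ ∑ᵈ F
  ∑ᵈ-next F = sum-cong-≗ λ x → trans (sum-cong-≗ (λ y → turn x y)) (sym (sum-permute (at F x) (rotation x)))
    where
    to from : Fin n → Fin n → Fin n
    to x y with Adj? G x y
    ... | yes a = head (next (dart x y a))
    ... | no _  = y
    from x y with Adj? G x y
    ... | yes a = head (proj₁ (prev (dart x y a)))
    ... | no _  = y
    to-dart : ∀ d → to (tail d) (head d) ≡ head (next d)
    to-dart d with Adj? G (tail d) (head d)
    ... | yes _ = cong (head ∘ next) (dart-≡ refl refl)
    ... | no ¬a = contradiction (adjacent d) ¬a
    from-dart : ∀ d p → next p ≡ d → from (tail d) (head d) ≡ head p
    from-dart d p np with Adj? G (tail d) (head d)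
    ... | yes a = cong head (next-injective (trans (proj₁ (proj₂ (prev (dart (tail d) (head d) a)))) (trans (dart-≡ refl refl) (sym np))))
    ... | no ¬a = contradiction (adjacent d) ¬a
    to-none : ∀ x y → ¬ Adj G x y → to x y ≡ y
    to-none x y ¬a with Adj? G x y
    ... | yes a = contradiction a ¬a
    ... | no _  = refl
    from-none : ∀ x y → ¬ Adj G x y → from x y ≡ y
    from-none x y ¬a with Adj? G x y
    ... | yes a = contradiction a ¬a
    ... | no _  = refl
    to-from : ∀ x y → to x (from x y) ≡ y
    to-from x y = case Adj? G x y of λ where
      (no ¬a) → trans (cong (to x) (from-none x y ¬a)) (to-none x y ¬a)
      (yes a) → let p , np , tp = prev (dart x y a) in
        trans (cong (to x) (from-dart (dart x y a) p np))
          (trans (cong (λ v → to v (head p)) (sym tp)) (trans (to-dart p) (cong head np)))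
    from-to : ∀ x y → from x (to x y) ≡ y
    from-to x y = case Adj? G x y of λ where
      (no ¬a) → trans (cong (from x) (to-none x y ¬a)) (from-none x y ¬a)
      (yes a) → let d = dart x y a in
        trans (cong (from x) (to-dart d))
          (trans (cong (λ v → from v (head (next d))) (sym (next-tail d))) (from-dart (next d) d refl))
    rotation : Fin n → Permutation n n
    rotation x = permutation (to x) (from x) (to-from x) (from-to x)
    turn : ∀ x y → at (F ∘ next) x y ≡ at F x (to x y)
    turn x y = case Adj? G x y of λ where
      (no ¬a) → trans (at-none (F ∘ next) ¬a) (sym (trans (cong (at F x) (to-none x y ¬a)) (at-none F ¬a)))
      (yes a) → let d = dart x y a in
        trans (at-dart (F ∘ next) d) (sym (trans (cong (at F x) (to-dart d))
          (trans (cong (λ v → at F v (head (next d))) (sym (next-tail d))) (at-dart F (next d)))))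

  ∑ᵈ-face : ∀ F → ∑ᵈ (F ∘ face) ≡ ∑ᵈ F
  ∑ᵈ-face F = trans (∑ᵈ-reverse (F ∘ next)) (∑ᵈ-next F)

  -- Each edge is counted by both of its darts. `H` keeps the increasing one, and its sum agrees
  -- with that of its reversal.
  ∑ᵈ-symmetric : ∀ {F} → (∀ d → F (reverse d) ≡ F d) → ∑ᵈ F ≡ false
  ∑ᵈ-symmetric {F} F-rev = begin
    ∑ᵈ F                              ≡⟨ ∑ᵈ-cong split ⟩
    ∑ᵈ (λ d → H d xor H (reverse d))  ≡⟨ ∑ᵈ-xor H (H ∘ reverse) ⟩
    ∑ᵈ H xor ∑ᵈ (H ∘ reverse)         ≡⟨ cong (∑ᵈ H xor_) (∑ᵈ-reverse H) ⟩
    ∑ᵈ H xor ∑ᵈ H                     ≡⟨ xor-same (∑ᵈ H) ⟩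
    false                             ∎
    where
    open ≡-Reasoning
    up : Dart G → Bool
    up d = does (tail d <? head d)
    H : Dart G → Bool
    H d = up d ∧ F d
    one-up : ∀ d → up d xor up (reverse d) ≡ true
    one-up d with Fin.<-cmp (tail d) (head d)
    ... | tri< lt _ ¬gt = cong₂ _xor_ (dec-true (tail d <? head d) lt) (dec-false (head d <? tail d) ¬gt)
    ... | tri≈ _ eq _   = contradiction eq (tail≢head d)
    ... | tri> ¬lt _ gt = cong₂ _xor_ (dec-false (tail d <? head d) ¬lt) (dec-true (head d <? tail d) gt)
    split : ∀ d → F d ≡ H d xor H (reverse d)
    split d = sym (begin
      (up d ∧ F d) xor (up (reverse d) ∧ F (reverse d)) ≡⟨ cong (λ b → (up d ∧ F d) xor (up (reverse d) ∧ b)) (F-rev d) ⟩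
      (up d ∧ F d) xor (up (reverse d) ∧ F d)           ≡⟨ Bool.∧-distribʳ-xor (F d) (up d) (up (reverse d)) ⟨
      (up d xor up (reverse d)) ∧ F d                   ≡⟨ cong (_∧ F d) (one-up d) ⟩
      F d                                               ∎)

  ∑ᵈ-single : ∀ e → ∑ᵈ (λ d → does (d ≟ᵈ e)) ≡ true
  ∑ᵈ-single e = trans (sum-single (λ x → sum (at δ x)) (tail e) row)
    (trans (sum-single (at δ (tail e)) (head e) λ y y≢ → off (tail e) y λ p → y≢ (proj₂ p))
      (trans (at-dart δ e) (dec-true (e ≟ᵈ e) refl)))
    where
    δ : Dart G → Bool
    δ d = does (d ≟ᵈ e)
    off : ∀ x y → ¬ (x ≡ tail e × y ≡ head e) → at δ x y ≡ false
    off x y ¬p with Adj? G x y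
    ... | yes a = dec-false (dart x y a ≟ᵈ e) λ { refl → ¬p (refl , refl) }
    ... | no _  = refl
    row : ∀ x → x ≢ tail e → sum (at δ x) ≡ false
    row x x≢ = trans (sum-single (at δ x) x λ y _ → off x y (x≢ ∘ proj₁)) (off x x (x≢ ∘ proj₁))

-- Every triangle has a matched edge

module Covering {n : ℕ} {G : Graph n} (M : MaximalPlanar G)
                {x y z : Fin n} (xy : Adj G x y) (xz : Adj G x z) (yz : Adj G y z) where

  open Triangulation M xy xz yz
  open DartSum (proj₁ M)

  module Matching (matched : Dart G → Bool) (m-rev : ∀ d → matched (reverse d) ≡ matched d)
    (m-one : ∀ d → ExactlyOne (matched d) (matched (face d)) (matched (face (face d)))) where

    -- Count the unmatched darts on one side of the triangle: each face there
    -- has two of them, whereas reversal pairs them up except for the three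
    -- darts of the triangle itself, if its edges are unmatched.
    triangle-hit : ∀ {u v w} (uv : Adj G u v) (vw : Adj G v w) (wu : Adj G w u) →
      ¬ (matched (dart u v uv) ≡ false × matched (dart v w vw) ≡ false × matched (dart w u wu) ≡ false)
    triangle-hit {u} {v} {w} uv vw wu (m-uv , m-vw , m-wu) =
      contradiction (trans (sym sum-odd) (trans (sym (xor-identityʳ _)) (trans (cong (∑ᵈ C xor_) (sym sum-even))
        (trans (xor-comm (∑ᵈ C) (∑ᵈ g)) (trans (sym (∑ᵈ-xor g C)) (∑ᵈ-symmetric symmetric)))))) λ ()
      where
      open Separation (separation uv (Adj-sym {G = G} wu) vw)
      d₁ d₂ d₃ : Dart G
      d₁ = dart u v uv
      d₂ = dart v w vw
      d₃ = dart w u wu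
      α g h C : Dart G → Bool
      α d = side (walk d)
      g d = α d ∧ not (matched d)
      h d = α d ∧ matched d
      Cycle : Dart G → Set
      Cycle d = d ≡ d₁ ⊎ d ≡ d₂ ⊎ d ≡ d₃
      Cycle? : ∀ d → Dec (Cycle d)
      Cycle? d = (d ≟ᵈ d₁) ⊎-dec (d ≟ᵈ d₂) ⊎-dec (d ≟ᵈ d₃)
      C d = does (Cycle? d)
      u≢v : u ≢ v
      u≢v = tail≢head d₁
      v≢w : v ≢ w
      v≢w = tail≢head d₂
      w≢u : w ≢ u
      w≢u = tail≢head d₃
      not-one : ∀ {a b c} → ExactlyOne a b c → not a ≡ b xor c
      not-one first  = refl
      not-one second = refl
      not-one third  = refl
      -- In a face with one matched dart, a dart is unmatched exactly if one of the other two is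
      -- matched. Rotating the faces then shows that the sum of `g` is twice that of `h`.
      g-h : ∀ d → g d ≡ h (face d) xor h (face (face d))
      g-h d = trans (cong (α d ∧_) (not-one (m-one d))) (trans (Bool.∧-distribˡ-xor (α d) (matched (face d)) (matched (face (face d))))
        (cong₂ (λ a b → (side a ∧ matched (face d)) xor (side b ∧ matched (face (face d))))
          (sym (walk-face d)) (sym (trans (walk-face (face d)) (walk-face d)))))
      sum-even : ∑ᵈ g ≡ false
      sum-even = trans (∑ᵈ-cong g-h) (trans (∑ᵈ-xor (h ∘ face) (h ∘ face ∘ face)) (≡-xor
        (trans (∑ᵈ-face h) (sym (trans (∑ᵈ-face (h ∘ face)) (∑ᵈ-face h))))))
      sum-odd : ∑ᵈ C ≡ true
      sum-odd = trans (∑ᵈ-cong apart) (trans (∑ᵈ-xor (λ d → does (d ≟ᵈ d₁)) (λ d → does (d ≟ᵈ d₂) xor does (d ≟ᵈ d₃)))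
        (cong₂ _xor_ (∑ᵈ-single d₁) (trans (∑ᵈ-xor (λ d → does (d ≟ᵈ d₂)) (λ d → does (d ≟ᵈ d₃)))
          (cong₂ _xor_ (∑ᵈ-single d₂) (∑ᵈ-single d₃)))))
        where
        exclusive : ∀ {A B D : Set} (a : Dec A) (b : Dec B) (d : Dec D) → ¬ (A × B) → ¬ (A × D) → ¬ (B × D) →
                    does a ∨ does b ∨ does d ≡ does a xor (does b xor does d)
        exclusive (yes a) (yes b) _ p _ _ = contradiction (a , b) p
        exclusive (yes a) (no _) (yes d) _ q _ = contradiction (a , d) q
        exclusive (yes _) (no _) (no _) _ _ _ = refl
        exclusive (no _) (yes b) (yes d) _ _ r = contradiction (b , d) r
        exclusive (no _) (yes _) (no _) _ _ _ = refl
        exclusive (no _) (no _) (yes _) _ _ _ = refl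
        exclusive (no _) (no _) (no _) _ _ _ = refl
        apart : ∀ d → C d ≡ does (d ≟ᵈ d₁) xor (does (d ≟ᵈ d₂) xor does (d ≟ᵈ d₃))
        apart d = exclusive (d ≟ᵈ d₁) (d ≟ᵈ d₂) (d ≟ᵈ d₃)
          (λ (p , q) → u≢v (cong tail (trans (sym p) q)))
          (λ (p , q) → w≢u (cong tail (trans (sym q) p)))
          (λ (p , q) → v≢w (cong tail (trans (sym p) q)))
      On : Dart G → Set
      On d = (tail d ≡ u ⊎ tail d ≡ v ⊎ tail d ≡ w) × (head d ≡ u ⊎ head d ≡ v ⊎ head d ≡ w)
      on-cycle : ∀ {d} → Cycle d → On d
      on-cycle (inj₁ refl)        = inj₁ refl , inj₂ (inj₁ refl)
      on-cycle (inj₂ (inj₁ refl)) = inj₂ (inj₁ refl) , inj₂ (inj₂ refl)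
      on-cycle (inj₂ (inj₂ refl)) = inj₂ (inj₂ refl) , inj₁ refl
      cycle-on : ∀ d → On d → Cycle d ⊎ Cycle (reverse d)
      cycle-on d (inj₁ p , inj₁ q)               = contradiction (trans p (sym q)) (tail≢head d)
      cycle-on d (inj₂ (inj₁ p) , inj₂ (inj₁ q)) = contradiction (trans p (sym q)) (tail≢head d)
      cycle-on d (inj₂ (inj₂ p) , inj₂ (inj₂ q)) = contradiction (trans p (sym q)) (tail≢head d)
      cycle-on d (inj₁ p , inj₂ (inj₁ q))        = inj₁ (inj₁ (dart-≡ p q))
      cycle-on d (inj₂ (inj₁ p) , inj₂ (inj₂ q)) = inj₁ (inj₂ (inj₁ (dart-≡ p q)))
      cycle-on d (inj₂ (inj₂ p) , inj₁ q)        = inj₁ (inj₂ (inj₂ (dart-≡ p q)))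
      cycle-on d (inj₂ (inj₁ p) , inj₁ q)        = inj₂ (inj₁ (dart-≡ q p))
      cycle-on d (inj₂ (inj₂ p) , inj₂ (inj₁ q)) = inj₂ (inj₂ (inj₁ (dart-≡ q p)))
      cycle-on d (inj₁ p , inj₂ (inj₂ q))        = inj₂ (inj₂ (inj₂ (dart-≡ q p)))
      one-way : ∀ {d} → Cycle d → ¬ Cycle (reverse d)
      one-way (inj₁ refl) (inj₁ q)               = u≢v (cong head q)
      one-way (inj₁ refl) (inj₂ (inj₁ q))        = w≢u (sym (cong head q))
      one-way (inj₁ refl) (inj₂ (inj₂ q))        = v≢w (cong tail q)
      one-way (inj₂ (inj₁ refl)) (inj₁ q)        = w≢u (cong tail q)
      one-way (inj₂ (inj₁ refl)) (inj₂ (inj₁ q)) = v≢w (cong head q)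
      one-way (inj₂ (inj₁ refl)) (inj₂ (inj₂ q)) = u≢v (sym (cong head q))
      one-way (inj₂ (inj₂ refl)) (inj₁ q)        = v≢w (sym (cong head q))
      one-way (inj₂ (inj₂ refl)) (inj₂ (inj₁ q)) = u≢v (cong tail q)
      one-way (inj₂ (inj₂ refl)) (inj₂ (inj₂ q)) = w≢u (cong head q)
      unmatched : ∀ {d} → Cycle d → matched d ≡ false
      unmatched (inj₁ refl)        = m-uv
      unmatched (inj₂ (inj₁ refl)) = m-vw
      unmatched (inj₂ (inj₂ refl)) = m-wu
      g-unmatched : ∀ {d} → matched d ≡ false → g d ≡ α d
      g-unmatched {d} p = trans (cong (λ m → α d ∧ not m) p) (Bool.∧-identityʳ (α d))
      -- Reversing an edge of the triangle changes `g`, since the side changes and the edge is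
      -- unmatched. It also changes `C`, which holds one dart of each such edge, so the two changes
      -- cancel.
      on-symmetric : ∀ {d} → Cycle d → g (reverse d) xor C (reverse d) ≡ g d xor C d
      on-symmetric {d} c = trans
        (cong₂ _xor_ (g-unmatched (trans (m-rev d) (unmatched c))) (dec-false (Cycle? (reverse d)) (one-way c)))
        (trans (xor-identityʳ _) (trans (¬-not (separated d (on-cycle c)))
          (trans (trans (sym (Bool.true-xor (α d))) (xor-comm true (α d)))
            (sym (cong₂ _xor_ (g-unmatched (unmatched c)) (dec-true (Cycle? d) c))))))
      symmetric : ∀ d → g (reverse d) xor C (reverse d) ≡ g d xor C d
      symmetric d with Cycle? d | Cycle? (reverse d)
      ... | yes c | _ = on-symmetric c
      ... | no _ | yes c = sym (trans (cong (λ e → g e xor C e) (sym (reverse-reverse d))) (on-symmetric c))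
      ... | no ¬c | no ¬c′ = cong₂ _xor_
        (cong₂ (λ a m → a ∧ not m) (joined d λ on → [ ¬c , ¬c′ ]′ (cycle-on d on)) (m-rev d))
        (trans (dec-false (Cycle? (reverse d)) ¬c′) (sym (dec-false (Cycle? d) ¬c)))

-- Bounds on τ and ν

module _ {A : Set} where

  filter∈sublists : {P : A → Set} (P? : ∀ x → Dec (P x)) (xs : List A) → filter P? xs ∈ sublists xs
  filter∈sublists P? [] = here refl
  filter∈sublists P? (x ∷ xs) with P? x
  ... | yes _ = ∈-++⁺ˡ (∈-map⁺ (x ∷_) (filter∈sublists P? xs))
  ... | no _  = ∈-++⁺ʳ (map (x ∷_) (sublists xs)) (filter∈sublists P? xs)

  []∈sublists : (xs : List A) → [] ∈ sublists xs
  []∈sublists []       = here refl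
  []∈sublists (x ∷ xs) = ∈-++⁺ʳ (map (x ∷_) (sublists xs)) ([]∈sublists xs)

  pairwise : {R : A → A → Set} {xs : List A} → Unique xs →
             (∀ {s t} → s ∈ xs → t ∈ xs → s ≢ t → R s t) → AllPairs R xs
  pairwise []          rel = []
  pairwise (x∉ ∷ uniq) rel =
    All.tabulate (λ t∈ → rel (here refl) (there t∈) (All.lookup x∉ t∈)) ∷ pairwise uniq (λ s∈ t∈ → rel (there s∈) (there t∈))

module _ {n : ℕ} (G : Graph n) where

  τ-≤ : ∀ {S} → S ∈ sublists (edges G) → TriangleFree (deleteEdges G S) → τ G ≤ℕ length S
  τ-≤ S∈ free = Extrema.min≤v⁺ (length (edges G)) _ (inj₂ (lose
    (∈-map⁺ length (∈-filter⁺ (λ S → triangleFree? (deleteEdges G S)) S∈ free)) ℕ.≤-refl))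

  ν-≥ : ∀ {R} → R ∈ sublists (triangles G) → EdgeDisjoint R → length R ≤ℕ ν G
  ν-≥ R∈ disjoint = Extrema.v≤max⁺ 0 _ (inj₂ (lose (∈-map⁺ length (∈-filter⁺ edgeDisjoint? R∈ disjoint)) ℕ.≤-refl))

  τ-triangle-free : TriangleFree G → τ G ≤ℕ 0
  τ-triangle-free free = τ-≤ ([]∈sublists (edges G)) λ u v w (uv , vw , uw) → free u v w (old uv , old vw , old uw)
    where
    old : ∀ {x y} → Adj (deleteEdges G []) x y → Adj G x y
    old {x} {y} = proj₁ ∘ Equivalence.to (T-∧ {x = adj G x y})

module Bounds {n : ℕ} {G : Graph n} (M : MaximalPlanar G)
              {x y z : Fin n} (xy : Adj G x y) (xz : Adj G x z) (yz : Adj G y z) where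

  open Triangulation M xy xz yz
  open DartSum (proj₁ M) using (at; at-dart)

  private
    isTriangle? : (t : Triple n) → let (u , v , w) = t in
      Dec (toℕ u < toℕ v × toℕ v < toℕ w × Adj G u v × Adj G v w × Adj G u w)
    isTriangle? (u , v , w) = (u <? v) ×-dec (v <? w) ×-dec Adj? G u v ×-dec Adj? G v w ×-dec Adj? G u w

    unique-triangles : Unique (triangles G)
    unique-triangles = Unique.filter⁺ isTriangle? (Unique.cartesianProduct⁺ (Unique.allFin⁺ n) (unique-pairs n))

    T-not : ∀ {b} → T (not b) → b ≡ false
    T-not {false} _ = refl

  module MatchedEdges (matched : Dart G → Bool) (m-rev : ∀ d → matched (reverse d) ≡ matched d)
    (m-one : ∀ d → ExactlyOne (matched d) (matched (face d)) (matched (face (face d)))) where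

    open Covering.Matching M xy xz yz matched m-rev m-one using (triangle-hit)
    open import Data.List.Membership.DecPropositional (_≟ₚ_ {n}) using (_∈?_)

    chosen? : (p : Pair n) → Dec (T (at matched (proj₁ p) (proj₂ p)))
    chosen? p = Bool.T? (at matched (proj₁ p) (proj₂ p))

    S : List (Pair n)
    S = filter chosen? (edges G)

    surviving : ∀ {u v} → Adj (deleteEdges G S) u v → Σ[ uv ∈ Adj G u v ] matched (dart u v uv) ≡ false
    surviving {u} {v} a = uv , ¬-not λ m → case Fin.<-cmp u v of λ where
        (tri< lt _ _) → clash (trans (cong (_∨ does ((v , u) ∈? S)) (dec-true ((u , v) ∈? S) (in-S lt uv m))) refl)
        (tri≈ _ eq _) → tail≢head {G = G} (dart u v uv) eq
        (tri> _ _ gt) → clash (trans (cong (does ((u , v) ∈? S) ∨_) (dec-true ((v , u) ∈? S)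
          (in-S gt (Adj-sym {G = G} uv) (trans (m-rev (dart u v uv)) m)))) (Bool.∨-zeroʳ _))
      where
      uv : Adj G u v
      uv = proj₁ (Equivalence.to (T-∧ {x = adj G u v}) a)
      clash : joins S u v ≢ true
      clash p = contradiction (trans (sym p) (T-not (proj₂ (Equivalence.to (T-∧ {x = adj G u v}) a)))) λ ()
      in-S : ∀ {p q} → toℕ p < toℕ q → (pq : Adj G p q) → matched (dart p q pq) ≡ true → (p , q) ∈ S
      in-S {p} {q} lt pq m = ∈-filter⁺ chosen?
        (∈-filter⁺ (isEdge? G) (∈-cartesianProduct⁺ (∈-allFin p) (∈-allFin q)) (lt , pq))
        (Equivalence.from T-≡ (trans (at-dart matched (dart p q pq)) m))

    τ-≤-S : τ G ≤ℕ length S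
    τ-≤-S = τ-≤ G (filter∈sublists chosen? (edges G)) λ u v w (uv , vw , uw) →
      let uv′ , m₁ = surviving uv
          vw′ , m₂ = surviving vw
          uw′ , m₃ = surviving uw
      in triangle-hit uv′ vw′ (Adj-sym {G = G} uw′)
           (m₁ , m₂ , trans (m-rev (dart u w uw′)) m₃)

    matched-unique : ∀ {d e} → walk d ≡ walk e → matched d ≡ true → matched e ≡ true → d ≡ e
    matched-unique {d} eq p q with On-face d eq
    ... | inj₁ refl        = refl
    ... | inj₂ (inj₁ refl) = contradiction (subst₂ (λ a b → ExactlyOne a b (matched (face (face d)))) p q (m-one d)) λ ()
    ... | inj₂ (inj₂ refl) = contradiction (subst₂ (λ a b → ExactlyOne a (matched (face d)) b) p q (m-one d)) λ ()

    -- Both darts of an edge in `S` are matched, and no two matched darts lie on one face, so the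
    -- edges of `S` occupy two faces each.
    S+S≤walks : length S + length S ≤ℕ #walks
    S+S≤walks = Fin.injective⇒≤ {f = λ k → walk (ends (splitAt (length S) k))} λ {k} {l} eq →
      trans (sym (Fin.join-splitAt (length S) (length S) k)) (trans
        (cong (join (length S) (length S)) (ends-injective (splitAt (length S) k) (splitAt (length S) l)
          (matched-unique eq (ends-matched (splitAt (length S) k)) (ends-matched (splitAt (length S) l)))))
        (Fin.join-splitAt (length S) (length S) l))
      where
      edge∈ : ∀ i → lookup S i ∈ edges G × T (at matched (proj₁ (lookup S i)) (proj₂ (lookup S i)))
      edge∈ i = ∈-filter⁻ chosen? {xs = edges G} (∈-lookup i)
      is-edge : ∀ i → toℕ (proj₁ (lookup S i)) < toℕ (proj₂ (lookup S i)) × Adj G (proj₁ (lookup S i)) (proj₂ (lookup S i))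
      is-edge i = proj₂ (∈-filter⁻ (isEdge? G) {xs = pairs n} (proj₁ (edge∈ i)))
      edge : Fin (length S) → Dart G
      edge i = dart (proj₁ (lookup S i)) (proj₂ (lookup S i)) (proj₂ (is-edge i))
      edge-matched : ∀ i → matched (edge i) ≡ true
      edge-matched i = trans (sym (at-dart matched (edge i))) (Equivalence.to T-≡ (proj₂ (edge∈ i)))
      edge-injective : ∀ {i j} → edge i ≡ edge j → i ≡ j
      edge-injective eq = lookup-injective (Unique.filter⁺ chosen? (Unique.filter⁺ (isEdge? G) (unique-pairs n)))
        (cong₂ _,_ (cong tail eq) (cong head eq))
      edge≢reverse : ∀ i j → edge i ≢ reverse (edge j)
      edge≢reverse i j eq = ℕ.<-asym (proj₁ (is-edge i))
        (subst₂ (λ u v → toℕ u < toℕ v) (sym (cong head eq)) (sym (cong tail eq)) (proj₁ (is-edge j)))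
      ends : Fin (length S) ⊎ Fin (length S) → Dart G
      ends (inj₁ i) = edge i
      ends (inj₂ i) = reverse (edge i)
      ends-matched : ∀ s → matched (ends s) ≡ true
      ends-matched (inj₁ i) = edge-matched i
      ends-matched (inj₂ i) = trans (m-rev (edge i)) (edge-matched i)
      ends-injective : ∀ s t → ends s ≡ ends t → s ≡ t
      ends-injective (inj₁ i) (inj₁ j) eq = cong inj₁ (edge-injective eq)
      ends-injective (inj₁ i) (inj₂ j) eq = contradiction eq (edge≢reverse i j)
      ends-injective (inj₂ i) (inj₁ j) eq = contradiction (sym eq) (edge≢reverse j i)
      ends-injective (inj₂ i) (inj₂ j) eq = cong inj₂ (edge-injective (reverse-injective eq))

    τ+τ≤walks : τ G + τ G ≤ℕ #walks
    τ+τ≤walks = ℕ.≤-trans (ℕ.+-mono-≤ τ-≤-S τ-≤-S) S+S≤walks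

  -- Direction is ignored because the sides of a listed triangle are increasing pairs, whereas the
  -- darts of a face follow its boundary.
  Edge : Fin #walks → Fin n → Fin n → Set
  Edge f p q = Σ[ e ∈ Dart G ] walk e ≡ f × ((tail e ≡ p × head e ≡ q) ⊎ (tail e ≡ q × head e ≡ p))

  Edge-sym : ∀ {f p q} → Edge f p q → Edge f q p
  Edge-sym (e , we , inj₁ p) = e , we , inj₂ p
  Edge-sym (e , we , inj₂ p) = e , we , inj₁ p

  Edge-adj : ∀ {f p q} → Edge f p q → Adj G p q
  Edge-adj (e , _ , inj₁ (refl , refl)) = adjacent e
  Edge-adj (e , _ , inj₂ (refl , refl)) = adjacent (reverse e)

  FacialTriangle : Fin #walks → Set
  FacialTriangle f = Σ[ t ∈ Triple n ] t ∈ triangles G × (∀ {p q} → (p , q) ∈ sides t → Edge f p q)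

  private
    sorted : ∀ {f u v w} → toℕ u < toℕ v → toℕ v < toℕ w → Edge f u v → Edge f v w → Edge f u w → FacialTriangle f
    sorted {f} {u} {v} {w} u<v v<w uv vw uw = (u , v , w) ,
      ∈-filter⁺ isTriangle? (∈-cartesianProduct⁺ (∈-allFin u) (∈-cartesianProduct⁺ (∈-allFin v) (∈-allFin w)))
        (u<v , v<w , Edge-adj uv , Edge-adj vw , Edge-adj uw) ,
      λ { (here refl) → uv ; (there (here refl)) → vw ; (there (there (here refl))) → uw }

  facial-triangle : ∀ d → FacialTriangle (walk d)
  facial-triangle d = order (Fin.<-cmp a b) (Fin.<-cmp b c) (Fin.<-cmp a c)
    where
    a b c : Fin n
    a = tail d
    b = head d
    c = head (face d)
    ab : Edge (walk d) a b
    ab = d , refl , inj₁ (refl , refl)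
    bc : Edge (walk d) b c
    bc = face d , walk-face d , inj₁ (tail-face d , refl)
    ca : Edge (walk d) c a
    ca = face (face d) , trans (walk-face (face d)) (walk-face d) , inj₁ (tail-face (face d) , head-face-face d)
    order : Tri (toℕ a < toℕ b) (a ≡ b) (toℕ b < toℕ a) → Tri (toℕ b < toℕ c) (b ≡ c) (toℕ c < toℕ b) →
            Tri (toℕ a < toℕ c) (a ≡ c) (toℕ c < toℕ a) → FacialTriangle (walk d)
    order (tri≈ _ p _) _ _ = contradiction p (tail≢head d)
    order _ (tri≈ _ p _) _ = contradiction (trans (tail-face d) p) (tail≢head (face d))
    order _ _ (tri≈ _ p _) = contradiction (sym p) (no-leaf d)
    order (tri< p _ _) (tri< q _ _) _            = sorted p q ab bc (Edge-sym ca)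
    order (tri< p _ _) (tri> _ _ q) (tri< r _ _) = sorted r q (Edge-sym ca) (Edge-sym bc) ab
    order (tri< p _ _) (tri> _ _ q) (tri> _ _ r) = sorted r p ca ab (Edge-sym bc)
    order (tri> _ _ p) (tri< q _ _) (tri< r _ _) = sorted p r (Edge-sym ab) (Edge-sym ca) bc
    order (tri> _ _ p) (tri< q _ _) (tri> _ _ r) = sorted q r bc ca (Edge-sym ab)
    order (tri> _ _ p) (tri> _ _ q) _            = sorted q p (Edge-sym bc) (Edge-sym ab) ca

  module ColourClasses (c : Fin #walks → Fin 3) (proper : ∀ d → c (walk d) ≢ c (walk (reverse d))) where
    open import Data.List.Membership.DecPropositional (≡-dec (_≟_ {n}) (_≟ₚ_ {n})) using (_∈?_)

    facial : ∀ f → FacialTriangle f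
    facial f = subst FacialTriangle (Walk.class-member f) (facial-triangle (Walk.member f))

    triangle : Fin #walks → Triple n
    triangle f = proj₁ (facial f)

    coloured : Fin 3 → List (Triple n)
    coloured j = map triangle (filter (λ f → c f ≟ j) (allFin #walks))

    -- A colour class is taken as a filter of `triangles G`, in the order of that list, because the
    -- maximum in `ν` ranges over its sublists.
    R : Fin 3 → List (Triple n)
    R j = filter (_∈? coloured j) (triangles G)

    R⁺ : ∀ f → triangle f ∈ R (c f)
    R⁺ f = ∈-filter⁺ (_∈? coloured (c f)) (proj₁ (proj₂ (facial f)))
      (∈-map⁺ triangle (∈-filter⁺ (λ g → c g ≟ c f) (∈-allFin f) refl))

    R⁻ : ∀ {j t} → t ∈ R j → ∃[ f ] c f ≡ j × t ≡ triangle f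
    R⁻ {j} t∈ =
      let f , f∈ , eq = ∈-map⁻ triangle (proj₂ (∈-filter⁻ (_∈? coloured j) {xs = triangles G} t∈))
      in f , proj₂ (∈-filter⁻ (λ f → c f ≟ j) {xs = allFin #walks} f∈) , eq

    -- Two faces with a common edge contain either the same dart of it or opposite ones; a proper
    -- colouring excludes the latter.
    common-edge : ∀ {f g p q} → c f ≡ c g → Edge f p q → Edge g p q → f ≡ g
    common-edge cf≡cg (d , refl , d-ends) (e , refl , e-ends) with d-ends | e-ends
    ... | inj₁ (p , q) | inj₁ (r , s) = cong walk (dart-≡ (trans p (sym r)) (trans q (sym s)))
    ... | inj₂ (p , q) | inj₂ (r , s) = cong walk (dart-≡ (trans p (sym r)) (trans q (sym s)))
    ... | inj₁ (p , q) | inj₂ (r , s) =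
      contradiction (trans cf≡cg (cong (c ∘ walk) (dart-≡ {d = e} {e = reverse d} (trans r (sym q)) (trans s (sym p))))) (proper d)
    ... | inj₂ (p , q) | inj₁ (r , s) =
      contradiction (trans cf≡cg (cong (c ∘ walk) (dart-≡ {d = e} {e = reverse d} (trans r (sym q)) (trans s (sym p))))) (proper d)

    R-disjoint : ∀ j → EdgeDisjoint (R j)
    R-disjoint j = pairwise (Unique.filter⁺ (_∈? coloured j) unique-triangles) λ s∈ t∈ s≢t (p∈s , p∈t) →
      let f , cf , s≡ = R⁻ s∈
          g , cg , t≡ = R⁻ t∈
      in s≢t (trans s≡ (trans (cong triangle (common-edge (trans cf (sym cg))
           (proj₂ (proj₂ (facial f)) (subst (λ t → _ ∈ sides t) s≡ p∈s))
           (proj₂ (proj₂ (facial g)) (subst (λ t → _ ∈ sides t) t≡ p∈t)))) (sym t≡)))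

    R≤ν : ∀ j → length (R j) ≤ℕ ν G
    R≤ν j = ν-≥ G (filter∈sublists (_∈? coloured j) (triangles G)) (R-disjoint j)

    -- A face is determined by its colour and the position of its triangle in the colour class.
    -- Different faces may have the same corners, as when G is a triangle, but they then share an
    -- edge and differ in colour.
    walks≤3ν : #walks ≤ℕ 3 *ℕ ν G
    walks≤3ν = Fin.injective⇒≤ {f = λ f → combine (c f) (position f)} λ {f} {g} eq →
      let cf≡cg , pf≡pg = Fin.combine-injective (c f) (position f) (c g) (position g) eq
      in same-triangle f g cf≡cg (trans (at-index f) (trans (same-position cf≡cg (R⁺ f) (R⁺ g) pf≡pg) (sym (at-index g))))
      where
      position : Fin #walks → Fin (ν G)
      position f = inject≤ (index (R⁺ f)) (R≤ν (c f))
      at-index : ∀ f → triangle f ≡ lookup (R (c f)) (index (R⁺ f))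
      at-index f = Any.lookup-index (R⁺ f)
      same-position : ∀ {i j s t} → i ≡ j → (s∈ : s ∈ R i) (t∈ : t ∈ R j) →
                      inject≤ (index s∈) (R≤ν i) ≡ inject≤ (index t∈) (R≤ν j) →
                      lookup (R i) (index s∈) ≡ lookup (R j) (index t∈)
      same-position {i} refl s∈ t∈ eq = cong (lookup (R i)) (Fin.inject≤-injective (R≤ν i) (R≤ν i) (index s∈) (index t∈) eq)
      same-triangle : ∀ f g → c f ≡ c g → triangle f ≡ triangle g → f ≡ g
      same-triangle f g cf≡cg eq = common-edge cf≡cg
        (proj₂ (proj₂ (facial f)) (here refl))
        (proj₂ (proj₂ (facial g)) (subst (λ t → _ ∈ sides t) eq (here refl)))

-- With the inequality assumed false, the goal is absurdity, so the doubly negated matching and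
-- colouring can be unpacked. They start from a triangle of G; if there is none, `τ G` is 0.
2τ≤3ν : ∀ {n} (G : Graph n) → MaximalPlanar G → ¬ (G ≅ K 4) → τ G *ℕ 2 ≤ℕ 3 *ℕ ν G
2τ≤3ν G M ≇K₄ = decidable-stable (τ G *ℕ 2 ℕ.≤? 3 *ℕ ν G) λ ≰ → case triangleFree? G of λ where
  (yes free) → ≰ (ℕ.≤-trans (ℕ.*-monoˡ-≤ 2 (τ-triangle-free G free)) z≤n)
  (no ¬free) → ¬free λ u v w (uv , vw , uw) →
    Triangulation.dual-matching M uv uw vw λ matching →
    FaceColouring.colouring M uv uw vw ≇K₄ λ (c , proper) →
      let open Triangulation M uv uw vw using (#walks; ∈-darts; face; face³; face≢)
          open CubicMultigraph.PerfectMatching matching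
          open Bounds M uv uw vw
      in ≰ (ℕ.≤-trans
           (subst (_≤ℕ #walks) (sym (trans (ℕ.*-comm (τ G) 2) (cong (τ G +_) (ℕ.+-identityʳ (τ G)))))
             (MatchedEdges.τ+τ≤walks matched (λ d → m-rev (∈-darts d)) (λ d → m-one (∈-darts d))))
           (ColourClasses.walks≤3ν c proper))

-- From natural to rational numbers

open import Data.Integer.Base using (+_)
open import Data.Rational.Base using (_/_; _*_; _≤_)

theorem4p5 : ∀ {n : ℕ} (G : Graph n) → MaximalPlanar G → ¬ (G ≅ K 4) →
    (+ τ G) / 1 ≤ ((+ 3) / 2) * ((+ ν G) / 1)
theorem4p5 G M ≇K₄ = ℚ.toℚᵘ-cancel-≤ (begin
  toℚᵘ (t / 1)                      ≃⟨ ℚ.toℚᵘ-fromℚᵘ (mkℚᵘ t 0) ⟩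
  -- `mkℚᵘ` stores the denominator less one, so the sides have denominators 1 and 2, and
  -- cross-multiplication gives `2τ≤3ν`.
  mkℚᵘ t 0                          ≤⟨ *≤* (subst₂ ℤ._≤_ (ℤ.pos-* (τ G) 2) bound (ℤ.+≤+ (2τ≤3ν G M ≇K₄))) ⟩
  mkℚᵘ (+ 3) 1 ℚᵘ.* mkℚᵘ v 0        ≃⟨ ℚᵘ.*-cong (ℚ.toℚᵘ-fromℚᵘ (mkℚᵘ (+ 3) 1)) (ℚ.toℚᵘ-fromℚᵘ (mkℚᵘ v 0)) ⟨
  toℚᵘ ((+ 3) / 2) ℚᵘ.* toℚᵘ (v / 1) ≃⟨ ℚ.toℚᵘ-homo-* ((+ 3) / 2) (v / 1) ⟨
  toℚᵘ (((+ 3) / 2) * (v / 1))      ∎)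
  where
  open ℚᵘ.≤-Reasoning
  t = + τ G
  v = + ν G
  bound : + (3 *ℕ ν G) ≡ (+ 3 ℤ.* v) ℤ.* + 1
  bound = trans (ℤ.pos-* 3 (ν G)) (sym (ℤ.*-identityʳ (+ 3 ℤ.* v)))
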